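{- Let $t$ be a positive integer and let $\tau:\mathbb{Z}\to F$ be any function from $\mathbb{Z}$ to a field $F$. Then there is a bijection $\phi_t:\lambda\mapsto \vec V=(v_0,v_1,\ldots,v_{t-1})$ from the set of $t$-core partitions onto the set of $V_t$-codings such that for every $t$-core $\lambda$, with $\vec V=\phi_t(\lambda)$, $$|\lambda|=\frac{1}{2t}\left(v_0^2+v_1^2+\cdots+v_{t-1}^2\right)-\frac{t^2-1}{24},$$ and, whenever all denominators below are nonzero (i.e. $\tau(h)\neq 0$ for all $h\in\mathcal{H}(\lambda)$ and $\tau(i)\ne 0$ for $1\le i\le t-1$), $$\prod_{h\in\mathcal{H}(\lambda)}\frac{\tau(h-t)\,\tau(h+t)}{\tau(h)^2}=\prod_{i=1}^{t-1}\frac{\tau(-i)^{\beta_i(\lambda)}}{\tau(i)^{\beta_i(\lambda)+t-i}}\;\prod_{0\le i<j\le t-1}\tau(v_i-v_j),$$ where $\beta_i(\lambda)=\#\{\square\in\lambda: h(\square)=t-i\}$ is the number of boxes of $\lambda$ with hook length $t-i$.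
   Context: Partitions are integer partitions (including the empty one); $|\lambda|$ is the size of $\lambda$, $h(\square)$ is the hook length of a box $\square$ in the Ferrers diagram of $\lambda$, and $\mathcal{H}(\lambda)$ is the multiset of all hook lengths of $\lambda$. A partition is a $t$-core if none of its hook lengths is divisible by $t$. Put $t_0=0$ if $t$ is odd and $t_0=1/2$ if $t$ is even, and $\mathbb{Z}'=t_0+\mathbb{Z}$. A vector $\vec V=(v_0,\ldots,v_{t-1})\in(\mathbb{Z}')^t$ is called a $V_t$-coding if: (i) the classes modulo $t$ of $v_0,\ldots,v_{t-1}$ are exactly the classes modulo $t$ of the elements of $t_0+\{0,1,\ldots,t-1\}$ (each occurring once); (ii) $v_0+v_1+\cdots+v_{t-1}=0$; (iii) $v_0>v_1>\cdots>v_{t-1}$. -}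

module Defs where

open import Algebra.Apartness.Bundles using (HeytingField)
open import Algebra.Bundles using (CommutativeRing; Semiring)
open import Data.Bool.Base using (if_then_else_)
open import Data.Fin.Base as Fin using (Fin; toℕ)
import Data.Fin.Properties as Fin
open import Data.Integer.Base as ℤ using (ℤ; +_)
open import Data.Integer.Divisibility using () renaming (_∣_ to _∣ℤ_)
import Data.Integer.Properties as ℤ
open import Data.List.Base as List
  using (List; []; _∷_; allFin; applyUpTo; cartesianProduct; concatMap; drop; filter; foldr; length; map; upTo)
open import Data.List.Membership.Propositional using (_∈_; mapWith∈)
open import Data.List.Relation.Unary.All using (All)
open import Data.List.Relation.Unary.Linked using (Linked)
open import Data.Nat.Base as ℕ using (ℕ; zero; suc; _≥_; _>_; _∸_)
open import Data.Nat.Divisibility using (_∣_; _∣?_)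
open import Data.Nat.ListAction using (sum)
import Data.Nat.Properties as ℕ
open import Data.Product using (_×_; _,_; ∃!; proj₁)
open import Data.Rational.Base as ℚ using (ℚ; 0ℚ; ½)
import Data.Rational.Properties as ℚ
open import Data.Rational.Solver using (module +-*-Solver)
import Data.Rational.Unnormalised.Base as ℚᵘ
import Data.Rational.Unnormalised.Properties as ℚᵘ
open import Data.Vec.Base as Vec using (Vec; lookup)
open import Level using (0ℓ)
open import Relation.Binary.Bundles using (Setoid)
import Relation.Binary.Construct.On as On
open import Relation.Binary.PropositionalEquality
open import Relation.Nullary using (¬_; does)

record Partition : Set where
  constructor mkPartition
  field
    parts      : List ℕ
    decreasing : Linked _≥_ parts
    positive   : All (_> 0) parts

open Partition public

size : Partition → ℕ
size μ = sum (parts μ)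

-- Rows and columns are numbered from 0; `row xs i` is 0 past the last part.
row : List ℕ → ℕ → ℕ
row []       _       = 0
row (x ∷ _)  zero    = x
row (_ ∷ xs) (suc i) = row xs i

Box : Set
Box = ℕ × ℕ

boxes : Partition → List Box
boxes μ = concatMap (λ i → map (i ,_) (upTo (row (parts μ) i))) (upTo (length (parts μ)))

arm : Partition → Box → ℕ
arm μ (i , j) = row (parts μ) i ∸ suc j

-- The box (k , j) belongs to the diagram exactly when j < row k.
leg : Partition → Box → ℕ
leg μ (i , j) = length (filter (j ℕ.<?_) (drop (suc i) (parts μ)))

hook : Partition → Box → ℕ
hook μ b = suc (arm μ b ℕ.+ leg μ b)

hookLengths : Partition → List ℕ
hookLengths μ = map (hook μ) (boxes μ)

β : ℕ → Partition → ℕ → ℕ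
β t μ i = length (filter (λ b → hook μ b ℕ.≟ t ∸ i) (boxes μ))

record Core (t : ℕ) : Set where
  constructor mkCore
  field
    partition : Partition
    isCore    : All (λ h → ¬ (t ∣ h)) (hookLengths partition)

open Core public

-- Cores are compared by their parts only, never by their proof components.
Cores : ℕ → Setoid 0ℓ 0ℓ
Cores t = On.setoid (setoid (List ℕ)) (λ (κ : Core t) → parts (partition κ))

fromℤ : ℤ → ℚ
fromℤ z = z ℚ./ 1

t₀ : ℕ → ℚ
t₀ t = if does (2 ∣? t) then ½ else 0ℚ

-- An element of t₀ + ℤ is represented by its distance from t₀.
record ℤ′ (t : ℕ) : Set where
  constructor t₀+_
  field
    offset : ℤ

open ℤ′ public

value : ∀ {t} → ℤ′ t → ℚ
value {t} v = t₀ t ℚ.+ fromℤ (offset v)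

-- The difference of two elements of t₀ + ℤ, which is an integer; see `value-diff`.
diff : ∀ {t} → ℤ′ t → ℤ′ t → ℤ
diff v w = offset v ℤ.- offset w

_≡ₜ_ : ∀ {t} → ℤ′ t → ℤ′ t → Set
_≡ₜ_ {t} v w = + t ∣ℤ diff v w

sumℚ : List ℚ → ℚ
sumℚ = foldr ℚ._+_ 0ℚ

-- In `classes`, the elements t₀ + 0, …, t₀ + (t - 1) represent all classes
-- modulo t, so no entry can lie in a class other than those listed.
record Coding (t : ℕ) : Set where
  constructor mkCoding
  field
    entries  : Vec (ℤ′ t) t
    classes  : ∀ (k : Fin t) → ∃! _≡_ λ (i : Fin t) → lookup entries i ≡ₜ (t₀+ (+ toℕ k))
    sum≡0    : sumℚ (map (λ i → value (lookup entries i)) (allFin t)) ≡ 0ℚ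
    strictly : ∀ {i j : Fin t} → i Fin.< j → value (lookup entries i) ℚ.> value (lookup entries j)

open Coding public

Codings : ℕ → Setoid 0ℓ 0ℓ
Codings t = On.setoid (setoid (Vec (ℤ′ t) t)) entries

sumOfSquares : ∀ {t} → Coding t → ℚ
sumOfSquares {t} V = sumℚ (map (λ i → v i ℚ.* v i) (allFin t))
  where
  v : Fin t → ℚ
  v i = value (lookup (entries V) i)

private
  fromℤ-sub : ∀ a b → fromℤ a ℚ.- fromℤ b ≡ fromℤ (a ℤ.- b)
  fromℤ-sub a b = ℚ.toℚᵘ-injective (begin
    ℚ.toℚᵘ (fromℤ a ℚ.- fromℤ b)
      ≈⟨ ℚ.toℚᵘ-homo-+ (fromℤ a) (ℚ.- fromℤ b) ⟩
    ℚ.toℚᵘ (fromℤ a) ℚᵘ.+ ℚ.toℚᵘ (ℚ.- fromℤ b)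
      ≈⟨ ℚᵘ.+-cong (ℚ.toℚᵘ-fromℚᵘ (a ℚᵘ./ 1)) (ℚᵘ.≃-trans (ℚ.toℚᵘ-homo‿- (fromℤ b)) (ℚᵘ.-‿cong (ℚ.toℚᵘ-fromℚᵘ (b ℚᵘ./ 1)))) ⟩
    (a ℚᵘ./ 1) ℚᵘ.- (b ℚᵘ./ 1)
      ≈⟨ ℚᵘ.*≡* (cong (ℤ._* + 1) (cong₂ ℤ._+_ (ℤ.*-identityʳ a) (ℤ.*-identityʳ (ℤ.- b)))) ⟩
    (a ℤ.- b) ℚᵘ./ 1
      ≈⟨ ℚ.toℚᵘ-fromℚᵘ ((a ℤ.- b) ℚᵘ./ 1) ⟨
    ℚ.toℚᵘ (fromℤ (a ℤ.- b)) ∎)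
    where open ℚᵘ.≃-Reasoning

value-diff : ∀ {t} (v w : ℤ′ t) → value v ℚ.- value w ≡ fromℤ (diff v w)
value-diff {t} v w = trans
  (solve 3 (λ c x y → (c :+ x) :- (c :+ y) := x :- y) refl (t₀ t) (fromℤ (offset v)) (fromℤ (offset w)))
  (fromℤ-sub (offset v) (offset w))
  where open +-*-Solver

[1⋯_-1] : ℕ → List ℕ
[1⋯ t -1] = applyUpTo suc (t ∸ 1)

increasingPairs : ∀ t → List (Fin t × Fin t)
increasingPairs t = filter (λ (i , j) → i Fin.<? j) (cartesianProduct (allFin t) (allFin t))

module FieldNotation {c ℓ₁ ℓ₂} (F : HeytingField c ℓ₁ ℓ₂) where

  open HeytingField F
  open import Algebra.Apartness.Properties.HeytingCommutativeRing heytingCommutativeRing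
    using (1#0; x#0y#0→xy#0)

  semiring : Semiring c ℓ₁
  semiring = CommutativeRing.semiring (record { isCommutativeRing = isCommutativeRing })

  open import Algebra.Properties.Semiring.Exp semiring public using (_^_)

  -- The library supplies an inverse of y - 0#, which is ≈ y.
  inverse : ∀ {y} → y # 0# → Carrier
  inverse y#0 = proj₁ (#⇒invertible y#0)

  infixl 7 _/_[_]
  _/_[_] : ∀ (x y : Carrier) → y # 0# → Carrier
  x / _ [ y#0 ] = x * inverse y#0

  ^-#0 : ∀ {x} n → x # 0# → x ^ n # 0#
  ^-#0 zero    _   = 1#0
  ^-#0 (suc n) x#0 = x#0y#0→xy#0 x#0 (^-#0 n x#0)

  product : List Carrier → Carrier
  product = foldr _*_ 1#

  ∏ : ∀ {a} {A : Set a} → List A → (A → Carrier) → Carrier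
  ∏ xs f = product (map f xs)

  ∏∈ : ∀ {a} {A : Set a} (xs : List A) → (∀ x → x ∈ xs → Carrier) → Carrier
  ∏∈ xs f = product (mapWith∈ xs (λ {x} x∈xs → f x x∈xs))

{-# OPTIONS --safe #-}

-- The first column hook lengths X of a partition encode its hook lengths: those of the row with
-- first column hook length x are the x − y with 0 ≤ y < x and y ∉ X. The partition is a t-core
-- exactly when X is closed under subtracting t (as long as the result is ≥ 0). Let G be the set of
-- the y ≥ 0 outside X with y < t or y − t ∈ X; it has one element in each class modulo t, and
-- G ⊎ X = {0, …, t − 1} ⊎ (X + t) as multisets. The coding is G, in decreasing order and
-- translated to have sum 0.
--
-- For f supported on the positive integers, put S(A, B) = Σ f(a − b) over a ∈ A and b ∈ B. Expanding
-- S(G, G) by bilinearity through the multiset equation leaves a sum over x ∈ X that telescopes,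
-- and the result says that the two sides of the product formula, with denominators cleared, have
-- the same factors τ(n) with the same multiplicities. The case f(n) = n² is the formula for |λ|.
module Submission where

open import Defs
open import Algebra.Apartness.Bundles using (HeytingField)
open import Algebra.Bundles using (CommutativeRing)
import Data.Nat.Properties as ℕ
import Data.Integer.Properties as ℤ
open import Agda.Builtin.Int using (pos)
open import Algebra.Properties.AbelianGroup ℤ.+-0-abelianGroup using (∙-cancelˡ; ∙-cancelʳ)
open import Algebra.Properties.CommutativeSemigroup ℕ.+-commutativeSemigroup using ()
  renaming (x∙yz≈y∙xz to x+[y+z]≡y+[x+z])
open import Algebra.Properties.CommutativeSemigroup ℤ.+-commutativeSemigroup
  using (interchange; x∙yz≈y∙xz)
open import Data.Bool.Base using (true; false; if_then_else_)
open import Data.Fin.Base as Fin using (Fin; toℕ; fromℕ; fromℕ<)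
import Data.Fin.Properties as Fin
open import Data.Integer.Base as ℤ using (ℤ; +_; 0ℤ)
import Data.Integer.Divisibility as Unsigned
import Data.Integer.Divisibility.Signed as Signed
open import Data.Integer.DivMod using (_%ℕ_; _/ℕ_; a≡a%ℕn+[a/ℕn]*n; n%ℕd<d)
open import Data.Integer.Tactic.RingSolver using (solve-∀)
open import Data.List.Base
  using (List; []; _∷_; _++_; allFin; applyDownFrom; applyUpTo; cartesianProduct; concatMap; downFrom; drop;
         filter; length; map; replicate; tabulate; upTo)
open import Data.List.Extrema.Nat using (max; xs≤max)
open import Data.List.Membership.DecPropositional ℕ._≟_ using (_∈?_)
open import Data.List.Membership.Propositional using (_∈_; _∉_)
open import Data.List.Membership.Propositional.Properties
open import Data.List.Membership.Propositional.Properties.WithK using (unique∧set⇒bag)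
open import Data.List.Properties
  using (++-assoc; ++-identityʳ; ∷-injectiveʳ; ∷-injectiveˡ; concatMap-cong; concatMap-map; filter-accept;
         filter-none; length-++; length-applyUpTo; length-map; length-tabulate; length-upTo; map-++;
         map-applyUpTo; map-concatMap; map-cong; map-tabulate; map-upTo; map-∘; reverse-applyUpTo; upTo-∷ʳ)
open import Data.List.Relation.Binary.BagAndSetEquality using (∼bag⇒↭)
open import Data.List.Relation.Binary.Permutation.Propositional as ↭
  using (_↭_; ↭⇒↭ₛ; module PermutationReasoning)
import Data.List.Relation.Binary.Permutation.Propositional.Properties as ↭
import Data.List.Relation.Binary.Permutation.Setoid.Properties as ↭ₛ
open import Data.List.Relation.Unary.All as All using (All; []; _∷_)
open import Data.List.Relation.Unary.AllPairs as AllPairs using (AllPairs; []; _∷_)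
import Data.List.Relation.Unary.AllPairs.Properties as AllPairs
open import Data.List.Relation.Unary.Any using (here; there)
open import Data.List.Relation.Unary.Linked using (Linked; []; [-]; _∷_)
open import Data.List.Relation.Unary.Linked.Properties using (Linked⇒AllPairs)
open import Data.List.Relation.Unary.Unique.Propositional using (Unique)
import Data.List.Relation.Unary.Unique.Propositional.Properties as Unique
open import Data.Nat.Base as ℕ using (ℕ; zero; suc; NonZero; _∸_; _≥_; _>_; s≤s; z≤n)
open import Data.Nat.Coprimality as Coprime using (1-coprimeTo)
open import Data.Nat.Divisibility using (_∣_; _∣?_; divides; m%n≡0⇒n∣m; n∣m⇒m%n≡0; ∣-refl; ∣⇒≤)
open import Data.Nat.DivMod using (m%n<n; m≡m%n+[m/n]*n)
open import Data.Nat.Induction using (<-rec)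
open import Data.Nat.ListAction using (sum)
open import Data.Nat.Properties using (m*n≢0)
open import Data.Product using (_×_; _,_; proj₁; proj₂; ∃!; ∃-syntax; Σ-syntax)
open import Data.Rational.Base as ℚ using (ℚ; 0ℚ; 1ℚ; ½; mkℚ)
import Data.Rational.Properties as ℚ
open import Data.Rational.Solver using (module +-*-Solver)
import Data.Rational.Unnormalised.Base as ℚᵘ
import Data.Rational.Unnormalised.Properties as ℚᵘ
open import Data.Sum.Base using (_⊎_; inj₁; inj₂; [_,_]′)
open import Data.Vec.Base as Vec using (Vec; lookup)
open import Data.Vec.Properties using (lookup∘tabulate; tabulate-cong; tabulate∘lookup)
open import Function.Base using (_∘_; id)
open import Function.Bundles using (Bijection; mk⇔)
open import Relation.Binary.Definitions using (DecidableEquality; tri<; tri≈; tri>)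
open import Relation.Binary.PropositionalEquality
  using (_≡_; _≢_; refl; sym; trans; cong; cong₂; subst; setoid; resp₂; ≢-sym; module ≡-Reasoning)
open import Relation.Nullary using (¬_; Dec; yes; no; contradiction; does; ¬?; _×-dec_)
open import Relation.Nullary.Decidable using (dec-false; dec-true)
open import Relation.Unary using (Decidable)

open +-*-Solver using (solve; _:+_; _:*_; _:-_; :-_; _:=_; con)


-- The factors of the product formula are compared as integers, before `τ` is applied: `τ` may
-- vanish in the numerators, and only the denominators are known to be apart from 0. A multiset of
-- integers is recovered from its sums against all test functions with values in ℤ (`∑-≗⇒↭`), so
-- each comparison becomes a linear identity in ℤ.
--
-- S sees only positive differences, whereas h - t is negative for h < t. Such a factor τ(h - t) is
-- matched with a τ(-i), where i = t - h; the τ(i) in the denominator below it then contributes f(t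
-- - h) in place of the missing f(h - t). This is where the exponents β_i come from.
--
-- The expansion of S(G, G) also involves S(G, X) and S(X, G). They are eliminated by applying the
-- multiset equation to one argument only.
--
-- Translating G to sum 0 forgets the number of parts. It can be recovered because parts are
-- positive, so that 0 always lies in G.

module _ where

  open import Data.Integer.Base using (_+_; _*_; _-_; -_)

  private variable
    A B : Set

  -- Finite sums of integers

  ∑ : List A → (A → ℤ) → ℤ
  ∑ []       f = 0ℤ
  ∑ (x ∷ xs) f = f x + ∑ xs f

  ∑-cong : ∀ {f g : A → ℤ} (xs : List A) → (∀ x → f x ≡ g x) → ∑ xs f ≡ ∑ xs g
  ∑-cong []       f≗g = refl
  ∑-cong (x ∷ xs) f≗g = cong₂ _+_ (f≗g x) (∑-cong xs f≗g)

  ∑-++ : ∀ {f : A → ℤ} (xs ys : List A) → ∑ (xs ++ ys) f ≡ ∑ xs f + ∑ ys f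
  ∑-++     []       ys = sym (ℤ.+-identityˡ _)
  ∑-++ {f = f} (x ∷ xs) ys = trans (cong₂ _+_ (refl {x = f x}) (∑-++ xs ys)) (sym (ℤ.+-assoc (f x) _ _))

  ∑-map : ∀ {f : B → ℤ} (g : A → B) (xs : List A) → ∑ (map g xs) f ≡ ∑ xs (λ x → f (g x))
  ∑-map g []       = refl
  ∑-map {f = f} g (x ∷ xs) = cong₂ _+_ (refl {x = f (g x)}) (∑-map g xs)

  ∑-+ : ∀ (f g : A → ℤ) (xs : List A) → ∑ xs (λ x → f x + g x) ≡ ∑ xs f + ∑ xs g
  ∑-+ f g []       = refl
  ∑-+ f g (x ∷ xs) = trans (cong₂ _+_ (refl {x = f x + g x}) (∑-+ f g xs)) (interchange (f x) (g x) _ _)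

  ∑-*ˡ : ∀ c (f : A → ℤ) (xs : List A) → ∑ xs (λ x → c * f x) ≡ c * ∑ xs f
  ∑-*ˡ c f []       = sym (ℤ.*-zeroʳ c)
  ∑-*ˡ c f (x ∷ xs) = trans (cong₂ _+_ (refl {x = c * f x}) (∑-*ˡ c f xs)) (sym (ℤ.*-distribˡ-+ c (f x) _))

  ∑-*ʳ : ∀ c (f : A → ℤ) (xs : List A) → ∑ xs (λ x → f x * c) ≡ ∑ xs f * c
  ∑-*ʳ c f []       = refl
  ∑-*ʳ c f (x ∷ xs) = trans (cong₂ _+_ (refl {x = f x * c}) (∑-*ʳ c f xs)) (sym (ℤ.*-distribʳ-+ c (f x) _))

  ∑-zero : ∀ {f : A → ℤ} (xs : List A) → (∀ x → f x ≡ 0ℤ) → ∑ xs f ≡ 0ℤ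
  ∑-zero []       f≗0 = refl
  ∑-zero (x ∷ xs) f≗0 = cong₂ _+_ (f≗0 x) (∑-zero xs f≗0)

  ∑-const : ∀ c (xs : List A) → ∑ xs (λ _ → c) ≡ + length xs * c
  ∑-const c []       = refl
  ∑-const c (x ∷ xs) = trans (cong₂ _+_ (refl {x = c}) (∑-const c xs)) (sym (ℤ.suc-* (+ length xs) c))

  ∑-swap : ∀ (f : A → B → ℤ) (xs : List A) (ys : List B) →
           ∑ xs (λ x → ∑ ys (f x)) ≡ ∑ ys (λ y → ∑ xs (λ x → f x y))
  ∑-swap f []       ys = sym (∑-zero ys λ _ → refl)
  ∑-swap f (x ∷ xs) ys = trans (cong₂ _+_ (refl {x = ∑ ys (f x)}) (∑-swap f xs ys)) (sym (∑-+ (f x) _ ys))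

  ∑-concatMap : ∀ {f : B → ℤ} (g : A → List B) (xs : List A) →
                ∑ (concatMap g xs) f ≡ ∑ xs (λ x → ∑ (g x) f)
  ∑-concatMap g []       = refl
  ∑-concatMap {f = f} g (x ∷ xs) = trans (∑-++ (g x) _) (cong (λ s → ∑ (g x) f + s) (∑-concatMap g xs))

  ∑-↭ : ∀ (f : A → ℤ) {xs ys : List A} → xs ↭ ys → ∑ xs f ≡ ∑ ys f
  ∑-↭ f ↭.refl          = refl
  ∑-↭ f (↭.prep x p)    = cong₂ _+_ (refl {x = f x}) (∑-↭ f p)
  ∑-↭ f (↭.swap x y p) = trans (cong (λ s → f x + (f y + s)) (∑-↭ f p)) (x∙yz≈y∙xz (f x) (f y) _)
  ∑-↭ f (↭.trans p q)   = trans (∑-↭ f p) (∑-↭ f q)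

  ∑-upTo-suc : ∀ n (f : ℕ → ℤ) → ∑ (upTo (suc n)) f ≡ f 0 + ∑ (upTo n) (λ k → f (suc k))
  ∑-upTo-suc n f = cong₂ _+_ (refl {x = f 0}) (trans (cong (λ xs → ∑ xs f) (sym (map-upTo suc n))) (∑-map suc (upTo n)))

  ∑-upTo-last : ∀ n (f : ℕ → ℤ) → ∑ (upTo (suc n)) f ≡ ∑ (upTo n) f + f n
  ∑-upTo-last n f = trans (cong (λ xs → ∑ xs f) (sym (upTo-∷ʳ n)))
    (trans (∑-++ (upTo n) (n ∷ [])) (cong₂ _+_ (refl {x = ∑ (upTo n) f}) (ℤ.+-identityʳ (f n))))

  ∑-applyUpTo : ∀ (g : ℕ → A) n (f : A → ℤ) → ∑ (applyUpTo g n) f ≡ ∑ (upTo n) (λ k → f (g k))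
  ∑-applyUpTo g n f = trans (cong (λ xs → ∑ xs f) (sym (map-upTo g n))) (∑-map g (upTo n))

  -- Truncated differences and the bilinear form S

  -- Δ f a b is f (a − b) when a > b, and 0 otherwise.
  Δ : (ℕ → ℤ) → ℕ → ℕ → ℤ
  Δ f zero    b       = 0ℤ
  Δ f (suc a) zero    = f (suc a)
  Δ f (suc a) (suc b) = Δ f a b

  Δ-cancel : ∀ f c a b → Δ f (c ℕ.+ a) (c ℕ.+ b) ≡ Δ f a b
  Δ-cancel f zero    a b = refl
  Δ-cancel f (suc c) a b = Δ-cancel f c a b

  Δ-≤ : ∀ f {a b} → a ℕ.≤ b → Δ f a b ≡ 0ℤ
  Δ-≤ f z≤n       = refl
  Δ-≤ f (s≤s a≤b) = Δ-≤ f a≤b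

  Δ-> : ∀ f {a b} → b ℕ.< a → Δ f a b ≡ f (a ∸ b)
  Δ-> f {suc a} {zero}  (s≤s z≤n) = refl
  Δ-> f {suc a} {suc b} (s≤s b<a) = Δ-> f b<a

  Δ-shift : ∀ f d c → Δ f (suc d ℕ.+ c) c ≡ f (suc d)
  Δ-shift f d c = trans (Δ-> f (s≤s (ℕ.m≤n+m c d))) (cong f (ℕ.m+n∸n≡m (suc d) c))

  -- This is S(A, B) of the overview; `Δ` makes the value `f 0` irrelevant.
  ⟪_⟫ : (ℕ → ℤ) → List ℕ → List ℕ → ℤ
  ⟪ f ⟫ as bs = ∑ as (λ a → ∑ bs (Δ f a))

  ⟪⟫-++ˡ : ∀ f as as′ bs → ⟪ f ⟫ (as ++ as′) bs ≡ ⟪ f ⟫ as bs + ⟪ f ⟫ as′ bs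
  ⟪⟫-++ˡ f as as′ bs = ∑-++ as as′

  ⟪⟫-++ʳ : ∀ f as bs bs′ → ⟪ f ⟫ as (bs ++ bs′) ≡ ⟪ f ⟫ as bs + ⟪ f ⟫ as bs′
  ⟪⟫-++ʳ f as bs bs′ = trans (∑-cong as (λ a → ∑-++ bs bs′)) (∑-+ _ _ as)

  ⟪⟫-↭ˡ : ∀ f {as as′} bs → as ↭ as′ → ⟪ f ⟫ as bs ≡ ⟪ f ⟫ as′ bs
  ⟪⟫-↭ˡ f bs p = ∑-↭ _ p

  ⟪⟫-↭ʳ : ∀ f as {bs bs′} → bs ↭ bs′ → ⟪ f ⟫ as bs ≡ ⟪ f ⟫ as bs′
  ⟪⟫-↭ʳ f as p = ∑-cong as (λ a → ∑-↭ _ p)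

  ⟪⟫-cancel : ∀ f t as bs → ⟪ f ⟫ (map (t ℕ.+_) as) (map (t ℕ.+_) bs) ≡ ⟪ f ⟫ as bs
  ⟪⟫-cancel f t as bs = trans (∑-map (t ℕ.+_) as)
    (∑-cong as (λ a → trans (∑-map (t ℕ.+_) bs) (∑-cong bs (λ b → Δ-cancel f t a b))))

  ⟪⟫-+ : ∀ f g as bs → ⟪ (λ n → f n + g n) ⟫ as bs ≡ ⟪ f ⟫ as bs + ⟪ g ⟫ as bs
  ⟪⟫-+ f g as bs = trans (∑-cong as (λ a → trans (∑-cong bs (Δ-+ a)) (∑-+ _ _ bs))) (∑-+ _ _ as)
    where
    Δ-+ : ∀ a b → Δ (λ n → f n + g n) a b ≡ Δ f a b + Δ g a b
    Δ-+ zero    b       = refl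
    Δ-+ (suc a) zero    = refl
    Δ-+ (suc a) (suc b) = Δ-+ a b

  Decreasing : List ℕ → Set
  Decreasing = AllPairs ℕ._>_

  -- As `x` is larger than every entry of `xs`, it contributes only as a minuend: its column and its
  -- diagonal entry vanish.
  ⟪⟫-∷ : ∀ f {x xs} → All (x ℕ.>_) xs → ⟪ f ⟫ (x ∷ xs) (x ∷ xs) ≡ ∑ xs (Δ f x) + ⟪ f ⟫ xs xs
  ⟪⟫-∷ f {x} {xs} x> = cong₂ _+_
    (trans (cong (_+ ∑ xs (Δ f x)) (Δ-≤ f (ℕ.≤-refl {x}))) (ℤ.+-identityˡ (∑ xs (Δ f x))))
    (trans (∑-+ (λ a → Δ f a x) _ xs) (trans (cong (_+ ⟪ f ⟫ xs xs) (below x>)) (ℤ.+-identityˡ (⟪ f ⟫ xs xs))))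
    where
    below : ∀ {ys} → All (x ℕ.>_) ys → ∑ ys (λ a → Δ f a x) ≡ 0ℤ
    below []        = refl
    below (x>y ∷ p) = cong₂ _+_ (Δ-≤ f (ℕ.<⇒≤ x>y)) (below p)

  -- Translation by `t` in one argument

  module _ (t : ℕ) where

    -- In a difference x + t − x′ with x, x′ ∈ X, the cases x > x′, x = x′ and x < x′
    -- account for the three terms on the right.
    ⟪⟫-shiftˡ : ∀ f → .{{NonZero t}} → ∀ {xs} → Decreasing xs →
      ⟪ f ⟫ (map (t ℕ.+_) xs) xs ≡
        ⟪ (λ n → f (t ℕ.+ n)) ⟫ xs xs + ⟪ Δ f t ⟫ xs xs + + length xs * f t
    ⟪⟫-shiftˡ f [] = refl
    ⟪⟫-shiftˡ f {xs = x ∷ xs} (x> ∷ xs↓) = begin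
      (Δ f (t ℕ.+ x) x + ∑ xs (Δ f (t ℕ.+ x))) + ∑ (map (t ℕ.+_) xs) (λ a → Δ f a x + ∑ xs (Δ f a))
        ≡⟨ cong₂ (λ p q → (p + ∑ xs (Δ f (t ℕ.+ x))) + q) (diag t)
            (trans (∑-+ (λ a → Δ f a x) _ (map (t ℕ.+_) xs)) (cong₂ _+_ (∑-map (t ℕ.+_) xs) (⟪⟫-shiftˡ f xs↓))) ⟩
      (f t + ∑ xs (Δ f (t ℕ.+ x))) + (∑ xs (λ a → Δ f (t ℕ.+ a) x) + (⟪ f₂ ⟫ xs xs + ⟪ f₃ ⟫ xs xs + + length xs * f t))
        ≡⟨ cong₂ (λ p q → (f t + p) + (q + (⟪ f₂ ⟫ xs xs + ⟪ f₃ ⟫ xs xs + + length xs * f t)))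
             (over₂ x>) (over₃ x>) ⟩
      (f t + ∑ xs (Δ f₂ x)) + (∑ xs (Δ f₃ x) + (⟪ f₂ ⟫ xs xs + ⟪ f₃ ⟫ xs xs + + length xs * f t))
        ≡⟨ collect (f t) (∑ xs (Δ f₂ x)) (∑ xs (Δ f₃ x)) (⟪ f₂ ⟫ xs xs) (⟪ f₃ ⟫ xs xs) (+ length xs * f t) ⟩
      (∑ xs (Δ f₂ x) + ⟪ f₂ ⟫ xs xs) + (∑ xs (Δ f₃ x) + ⟪ f₃ ⟫ xs xs) + (f t + + length xs * f t)
        ≡⟨ cong₂ _+_ (cong₂ _+_ (sym (⟪⟫-∷ f₂ x>)) (sym (⟪⟫-∷ f₃ x>))) (sym (ℤ.suc-* (+ length xs) (f t))) ⟩
      ⟪ f₂ ⟫ (x ∷ xs) (x ∷ xs) + ⟪ f₃ ⟫ (x ∷ xs) (x ∷ xs) + + length (x ∷ xs) * f t ∎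
      where
      open ≡-Reasoning
      f₂ = λ n → f (t ℕ.+ n)
      f₃ = Δ f t
      -- Positivity of the step matters: for step 0 the left side is 0, while `f 0` is arbitrary.
      diag : ∀ s → .{{NonZero s}} → Δ f (s ℕ.+ x) x ≡ f s
      diag (suc s) = Δ-shift f s x
      over₂ : ∀ {ys} → All (x ℕ.>_) ys → ∑ ys (Δ f (t ℕ.+ x)) ≡ ∑ ys (Δ f₂ x)
      over₂ [] = refl
      over₂ {y ∷ _} (x>y ∷ p) = cong₂ _+_
        (trans (Δ-> f (ℕ.<-≤-trans x>y (ℕ.m≤n+m x t)))
          (trans (cong f (ℕ.+-∸-assoc t (ℕ.<⇒≤ x>y))) (sym (Δ-> f₂ x>y))))
        (over₂ p)
      -- Writing `x` as `y + (x ∸ y)` lets `y` cancel, so the truncation at 0 becomes the condition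
      -- x - y < t.
      over₃ : ∀ {ys} → All (x ℕ.>_) ys → ∑ ys (λ a → Δ f (t ℕ.+ a) x) ≡ ∑ ys (Δ f₃ x)
      over₃ [] = refl
      over₃ {y ∷ _} (x>y ∷ p) = cong₂ _+_
        (begin
          Δ f (t ℕ.+ y) x               ≡⟨ cong₂ (Δ f) (ℕ.+-comm t y) (sym (ℕ.m+[n∸m]≡n (ℕ.<⇒≤ x>y))) ⟩
          Δ f (y ℕ.+ t) (y ℕ.+ (x ∸ y)) ≡⟨ Δ-cancel f y t (x ∸ y) ⟩
          Δ f t (x ∸ y)                 ≡⟨ Δ-> f₃ x>y ⟨
          Δ f₃ x y ∎)
        (over₃ p)
      collect : ∀ a b c d e m → (a + b) + (c + (d + e + m)) ≡
        (b + d) + (c + e) + (a + m)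
      collect = solve-∀

    -- Subtracting t + b is subtracting b and then t. A difference that is not positive after the
    -- first subtraction stays so after the second, so truncating twice agrees with truncating once.
    ⟪⟫-shiftʳ : ∀ f xs → ⟪ f ⟫ xs (map (t ℕ.+_) xs) ≡ ⟪ (λ n → Δ f n t) ⟫ xs xs
    ⟪⟫-shiftʳ f xs = ∑-cong xs (λ a → trans (∑-map (t ℕ.+_) xs) (∑-cong xs (pointwise a)))
      where
      Δ0 : ∀ a → Δ f a t ≡ Δ f a (t ℕ.+ 0)
      Δ0 a = cong (Δ f a) (sym (ℕ.+-identityʳ t))
      pointwise : ∀ a b → Δ f a (t ℕ.+ b) ≡ Δ (λ n → Δ f n t) a b
      pointwise zero    b       = refl
      pointwise (suc a) zero    = sym (Δ0 (suc a))
      pointwise (suc a) (suc b) = trans (cong (Δ f (suc a)) (ℕ.+-suc t b)) (pointwise a b)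

  -- The telescoping sum of a single first column hook length

  module _ (f : ℕ → ℤ) (t : ℕ) where

    private
      -- With U = {0, ..., t - 1}, these are the contributions of one element of X to S(X, U) and to
      -- S(U, X).
      T₁ T₃ : ℕ → ℤ
      T₁ a = ∑ (upTo t) (Δ f a)
      T₃ b = ∑ (upTo t) (λ u → Δ f u b)

      -- Two ways to split the sum over u ≤ t: at the last term and at the first. In the second,
      -- `suc a` and the remaining `suc u` both drop by 1.
      T₁-suc : ∀ a → T₁ (suc a) + Δ f (suc a) t ≡ f (suc a) + T₁ a
      T₁-suc a = trans (sym (∑-upTo-last t (Δ f (suc a)))) (∑-upTo-suc t (Δ f (suc a)))

      T₃-suc : ∀ b → T₃ (suc b) + Δ f t (suc b) ≡ T₃ b
      T₃-suc b = trans (sym (∑-upTo-last t (λ u → Δ f u (suc b))))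
        (trans (∑-upTo-suc t (λ u → Δ f u (suc b))) (ℤ.+-identityˡ _))

    -- Both sides are f 1 + ... + f t, in opposite orders.
    T₁-base : .{{NonZero t}} → f t + T₃ 0 ≡ T₁ t
    T₁-base = go t
      where
      go : ∀ n → .{{_ : NonZero n}} → f n + ∑ (upTo n) (λ u → Δ f u 0) ≡ ∑ (upTo n) (Δ f n)
      go (suc zero)      = cong (λ s → f 1 + s) (ℤ.+-identityˡ 0ℤ)
      go (suc n@(suc _)) = begin
        f (suc n) + ∑ (upTo (suc n)) (λ u → Δ f u 0)
          ≡⟨ cong (λ s → f (suc n) + s) (∑-upTo-last n (λ u → Δ f u 0)) ⟩
        f (suc n) + (∑ (upTo n) (λ u → Δ f u 0) + f n)
          ≡⟨ cong (λ s → f (suc n) + s) (trans (ℤ.+-comm _ (f n)) (go n)) ⟩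
        f (suc n) + ∑ (upTo n) (Δ f n)                   ≡⟨ ∑-upTo-suc n (Δ f (suc n)) ⟨
        ∑ (upTo (suc n)) (Δ f (suc n))                   ∎
        where open ≡-Reasoning

    -- The second difference of f with step t, with f (t − n) standing in for f (n − t) when n < t.
    D₂ : ℕ → ℤ
    D₂ n = f (t ℕ.+ n) + Δ f n t + Δ f t n

    -- From x to x + 1 both sides grow by f (x + 1) + f (t + x + 1): the truncated terms of `D₂` are
    -- just what `T₁` and `T₃` lose. The start x = 0 is `T₁-base`. Summed over x in X, this controls
    -- all differences x - y with y < x, whether or not y lies in X.
    D₂-telescope : .{{NonZero t}} → ∀ x →
      ∑ (upTo x) (λ k → D₂ (suc k)) + f t + T₁ x + T₃ x ≡ ∑ (upTo x) (λ k → f (suc k) + f (suc k)) + T₁ (t ℕ.+ x)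
    D₂-telescope zero = begin
      0ℤ + f t + T₁ 0 + T₃ 0  ≡⟨ cong (λ s → 0ℤ + f t + s + T₃ 0) (∑-zero (upTo t) (λ _ → refl)) ⟩
      0ℤ + f t + 0ℤ + T₃ 0    ≡⟨ drop-zeros (f t) (T₃ 0) ⟩
      0ℤ + (f t + T₃ 0)       ≡⟨ cong (λ s → 0ℤ + s) (trans T₁-base (cong T₁ (sym (ℕ.+-identityʳ t)))) ⟩
      0ℤ + T₁ (t ℕ.+ 0)       ∎
      where
      open ≡-Reasoning
      drop-zeros : ∀ a b → 0ℤ + a + 0ℤ + b ≡ 0ℤ + (a + b)
      drop-zeros = solve-∀
    D₂-telescope (suc x) = begin
      ∑ (upTo x′) (λ k → D₂ (suc k)) + f t + T₁ x′ + T₃ x′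
        ≡⟨ cong (λ s → s + f t + T₁ x′ + T₃ x′) (∑-upTo-last x (λ k → D₂ (suc k))) ⟩
      R + (f (t ℕ.+ x′) + Δ f x′ t + Δ f t x′) + f t + T₁ x′ + T₃ x′
        ≡⟨ regroup₁ R (f (t ℕ.+ x′)) (Δ f x′ t) (Δ f t x′) (f t) (T₁ x′) (T₃ x′) ⟩
      R + f t + (T₁ x′ + Δ f x′ t) + (T₃ x′ + Δ f t x′) + f (t ℕ.+ x′)
        ≡⟨ cong₂ (λ p q → R + f t + p + q + f (t ℕ.+ x′)) (T₁-suc x) (T₃-suc x) ⟩
      R + f t + (f x′ + T₁ x) + T₃ x + f (t ℕ.+ x′)
        ≡⟨ regroup₂ R (f t) (f x′) (T₁ x) (T₃ x) (f (t ℕ.+ x′)) ⟩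
      (R + f t + T₁ x + T₃ x) + (f x′ + f (t ℕ.+ x′))
        ≡⟨ cong (_+ (f x′ + f (t ℕ.+ x′))) (D₂-telescope x) ⟩
      (S + T₁ (t ℕ.+ x)) + (f x′ + f (t ℕ.+ x′))
        ≡⟨ regroup₃ S (T₁ (t ℕ.+ x)) (f x′) (f (t ℕ.+ x′)) ⟩
      S + f x′ + (f (t ℕ.+ x′) + T₁ (t ℕ.+ x))
        ≡⟨ cong (λ s → S + f x′ + s) top ⟨
      S + f x′ + (T₁ (t ℕ.+ x′) + f x′)
        ≡⟨ regroup₄ S (f x′) (T₁ (t ℕ.+ x′)) ⟩
      (S + (f x′ + f x′)) + T₁ (t ℕ.+ x′)
        ≡⟨ cong (_+ T₁ (t ℕ.+ x′)) (∑-upTo-last x (λ k → f (suc k) + f (suc k))) ⟨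
      ∑ (upTo x′) (λ k → f (suc k) + f (suc k)) + T₁ (t ℕ.+ x′) ∎
      where
      open ≡-Reasoning
      x′ = suc x
      R = ∑ (upTo x) (λ k → D₂ (suc k))
      S = ∑ (upTo x) (λ k → f (suc k) + f (suc k))
      top : T₁ (t ℕ.+ x′) + f x′ ≡ f (t ℕ.+ x′) + T₁ (t ℕ.+ x)
      top = subst (λ n → T₁ n + f x′ ≡ f n + T₁ (t ℕ.+ x)) (sym (ℕ.+-suc t x))
        (trans (cong (λ s → T₁ (suc (t ℕ.+ x)) + s)
          (sym (trans (cong (λ n → Δ f (suc n) t) (ℕ.+-comm t x)) (Δ-shift f x t)))) (T₁-suc (t ℕ.+ x)))
      regroup₁ : ∀ r a b c d p q → r + (a + b + c) + d + p + q ≡ r + d + (p + b) + (q + c) + a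
      regroup₁ = solve-∀
      regroup₂ : ∀ r d b p q a → r + d + (b + p) + q + a ≡ (r + d + p + q) + (b + a)
      regroup₂ = solve-∀
      regroup₃ : ∀ s p b a → (s + p) + (b + a) ≡ s + b + (a + p)
      regroup₃ = solve-∀
      regroup₄ : ∀ s b p → s + b + (p + b) ≡ (s + (b + b)) + p
      regroup₄ = solve-∀

  -- The identity between hook lengths and gaps

  -- The difference i is attained by t - i pairs. This is the origin of the summand t - i in the
  -- exponents of the product formula.
  ⟪⟫-upTo : ∀ f t → ⟪ f ⟫ (upTo t) (upTo t) ≡ ∑ (applyUpTo suc (t ∸ 1)) (λ i → + (t ∸ i) * f i)
  ⟪⟫-upTo f t = trans (∑-swap (Δ f) (upTo t) (upTo t)) (trans (step t) (sym (∑-applyUpTo suc (t ∸ 1) _)))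
    where
    open ≡-Reasoning
    column : ∀ t b → ∑ (upTo t) (λ a → Δ f a b) ≡ ∑ (upTo (t ∸ suc b)) (λ k → f (suc k))
    column zero    b       = refl
    column (suc t) zero    = trans (∑-upTo-suc t (λ a → Δ f a 0)) (ℤ.+-identityˡ _)
    column (suc t) (suc b) = trans (∑-upTo-suc t (λ a → Δ f a (suc b))) (trans (ℤ.+-identityˡ _) (column t b))
    step : ∀ t → ∑ (upTo t) (λ b → ∑ (upTo t) (λ a → Δ f a b)) ≡ ∑ (upTo (t ∸ 1)) (λ k → + (t ∸ suc k) * f (suc k))
    step zero          = refl
    step (suc zero)    = refl
    step (suc t@(suc s)) = begin
      ∑ (upTo (suc t)) (λ b → ∑ (upTo (suc t)) (λ a → Δ f a b))
        ≡⟨ ∑-upTo-suc t (λ b → ∑ (upTo (suc t)) (λ a → Δ f a b)) ⟩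
      ∑ (upTo (suc t)) (λ a → Δ f a 0) + ∑ (upTo t) (λ b → ∑ (upTo (suc t)) (λ a → Δ f a (suc b)))
        ≡⟨ cong₂ _+_ (column (suc t) 0)
             (∑-cong {g = λ b → ∑ (upTo t) (λ a → Δ f a b)} (upTo t) (λ b → trans (∑-upTo-suc t (λ a → Δ f a (suc b))) (ℤ.+-identityˡ _))) ⟩
      ∑ (upTo t) (λ k → f (suc k)) + ∑ (upTo t) (λ b → ∑ (upTo t) (λ a → Δ f a b))
        ≡⟨ cong (λ x → ∑ (upTo t) (λ k → f (suc k)) + x) (step t) ⟩
      ∑ (upTo t) (λ k → f (suc k)) + ∑ (upTo s) (λ k → + (s ∸ k) * f (suc k))
        -- The second sum is extended by the term k = s, whose coefficient s ∸ s is 0, so that both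
        -- sums range over k < t.
        ≡⟨ cong (λ x → ∑ (upTo t) (λ k → f (suc k)) + x) (trans (sym (ℤ.+-identityʳ _))
             (cong (λ x → ∑ (upTo s) (λ k → + (s ∸ k) * f (suc k)) + x)
               (sym (cong (λ n → + n * f t) (ℕ.n∸n≡0 s))))) ⟩
      ∑ (upTo t) (λ k → f (suc k)) + (∑ (upTo s) (λ k → + (s ∸ k) * f (suc k)) + + (s ∸ s) * f t)
        ≡⟨ cong (λ x → ∑ (upTo t) (λ k → f (suc k)) + x) (∑-upTo-last s (λ k → + (s ∸ k) * f (suc k))) ⟨
      ∑ (upTo t) (λ k → f (suc k)) + ∑ (upTo t) (λ k → + (s ∸ k) * f (suc k))
        ≡⟨ combine t ℕ.≤-refl ⟩
      ∑ (upTo t) (λ k → + (t ∸ k) * f (suc k)) ∎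
      where
      -- The bound n ≤ t is carried along because 1 + (s ∸ k) = t ∸ k requires k ≤ s.
      combine : ∀ n → n ℕ.≤ t → ∑ (upTo n) (λ k → f (suc k)) + ∑ (upTo n) (λ k → + (s ∸ k) * f (suc k))
                                ≡ ∑ (upTo n) (λ k → + (t ∸ k) * f (suc k))
      combine zero    _   = refl
      combine (suc n) n<t = begin
        ∑ (upTo (suc n)) (λ k → f (suc k)) + ∑ (upTo (suc n)) (λ k → + (s ∸ k) * f (suc k))
          ≡⟨ cong₂ _+_ (∑-upTo-last n (λ k → f (suc k))) (∑-upTo-last n (λ k → + (s ∸ k) * f (suc k))) ⟩
        (p + f (suc n)) + (q + + (s ∸ n) * f (suc n))
          ≡⟨ regroup p (f (suc n)) q (+ (s ∸ n)) ⟩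
        (p + q) + (+ 1 + + (s ∸ n)) * f (suc n)
          ≡⟨ cong₂ (λ x y → x + + y * f (suc n)) (combine n (ℕ.<⇒≤ n<t)) (sym (ℕ.+-∸-assoc 1 (ℕ.≤-pred n<t))) ⟩
        ∑ (upTo n) (λ k → + (t ∸ k) * f (suc k)) + + (t ∸ n) * f (suc n)
          ≡⟨ ∑-upTo-last n (λ k → + (t ∸ k) * f (suc k)) ⟨
        ∑ (upTo (suc n)) (λ k → + (t ∸ k) * f (suc k)) ∎
        where
        p = ∑ (upTo n) (λ k → f (suc k))
        q = ∑ (upTo n) (λ k → + (s ∸ k) * f (suc k))
        regroup : ∀ a b c d → (a + b) + (c + d * b) ≡ (a + c) + (+ 1 + d) * b
        regroup = solve-∀

  -- H stands for the hook lengths of the partition whose first column hook lengths are xs.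
  hook-identity : ∀ t → .{{NonZero t}} → ∀ {xs gs H : List ℕ} → Decreasing xs →
    gs ++ xs ↭ upTo t ++ map (t ℕ.+_) xs →
    (∀ g → ∑ H g + ⟪ g ⟫ xs xs ≡ ∑ xs (λ x → ∑ (upTo x) (λ k → g (suc k)))) →
    ∀ f → ∑ H (D₂ f t) + ∑ (applyUpTo suc (t ∸ 1)) (λ i → + (t ∸ i) * f i)
          ≡ ∑ H (λ h → f h + f h) + ⟪ f ⟫ gs gs
  hook-identity t {xs} {gs} {H} xs↓ gs++xs↭ hooks f =
    linear (∑ H (D₂ f t)) (∑ H (λ h → f h + f h)) (rows (D₂ f t)) (rows (λ h → f h + f h))
           (⟪ f ⟫ us us) (∑ is (λ i → + (t ∸ i) * f i)) (⟪ f ⟫ xs xs) (⟪ f ⟫ gs gs) (⟪ f ⟫ gs xs) (⟪ f ⟫ xs gs)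
           (⟪ f ⟫ us xs) (⟪ f ⟫ xs us) (⟪ f ⟫ us xs′) (⟪ f ⟫ xs′ us) (⟪ f ⟫ xs′ xs) (⟪ f ⟫ xs xs′)
           (⟪ f₁ ⟫ xs xs) (⟪ f₂ ⟫ xs xs) (⟪ f₃ ⟫ xs xs) (+ length xs * f t)
           square (expandʳ (⟪⟫-↭ˡ f xs gs++xs↭) (⟪⟫-++ˡ f gs xs xs) (⟪⟫-++ˡ f us xs′ xs))
           (expandʳ (⟪⟫-↭ʳ f xs gs++xs↭) (⟪⟫-++ʳ f xs gs xs) (⟪⟫-++ʳ f xs us xs′))
           (⟪⟫-shiftˡ t f xs↓) (⟪⟫-shiftʳ t f xs) us-xs′ telescope
           (trans (cong (λ s → ∑ H (D₂ f t) + s) (sym D₂-⟪⟫)) (hooks (D₂ f t)))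
           (trans (cong (λ s → ∑ H (λ h → f h + f h) + s) (sym (⟪⟫-+ f f xs xs))) (hooks (λ h → f h + f h)))
           (⟪⟫-upTo f t)
    where
    us = upTo t
    xs′ = map (t ℕ.+_) xs
    is = applyUpTo suc (t ∸ 1)
    f₁ = λ n → Δ f n t
    f₂ = λ n → f (t ℕ.+ n)
    f₃ = Δ f t
    rows : (ℕ → ℤ) → ℤ
    rows g = ∑ xs (λ x → ∑ (upTo x) (λ k → g (suc k)))
    expandʳ : ∀ {a b c d : ℤ} → a ≡ b → a ≡ c → b ≡ d → c ≡ d
    expandʳ p q r = trans (sym q) (trans p r)
    square : ⟪ f ⟫ gs gs + ⟪ f ⟫ gs xs + (⟪ f ⟫ xs gs + ⟪ f ⟫ xs xs)
           ≡ ⟪ f ⟫ us us + ⟪ f ⟫ us xs′ + (⟪ f ⟫ xs′ us + ⟪ f ⟫ xs xs)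
    square = expandʳ (trans (⟪⟫-↭ˡ f (gs ++ xs) gs++xs↭) (⟪⟫-↭ʳ f (us ++ xs′) gs++xs↭))
      (trans (⟪⟫-++ˡ f gs xs (gs ++ xs)) (cong₂ _+_ (⟪⟫-++ʳ f gs gs xs) (⟪⟫-++ʳ f xs gs xs)))
      (trans (⟪⟫-++ˡ f us xs′ (us ++ xs′)) (cong₂ _+_ (⟪⟫-++ʳ f us us xs′)
        (trans (⟪⟫-++ʳ f xs′ us xs′) (cong (λ s → ⟪ f ⟫ xs′ us + s) (⟪⟫-cancel f t xs xs)))))
    us-xs′ : ⟪ f ⟫ us xs′ ≡ 0ℤ
    us-xs′ = trans (∑-swap (Δ f) us xs′) (trans (∑-map (t ℕ.+_) xs) (∑-zero xs (λ x → small t x t ℕ.≤-refl)))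
      where
      small : ∀ t x n → n ℕ.≤ t → ∑ (upTo n) (λ u → Δ f u (t ℕ.+ x)) ≡ 0ℤ
      small t x zero    _   = refl
      small t x (suc n) n<t = trans (∑-upTo-last n (λ u → Δ f u (t ℕ.+ x)))
        (cong₂ _+_ (small t x n (ℕ.<⇒≤ n<t)) (Δ-≤ f (ℕ.≤-trans (ℕ.<⇒≤ n<t) (ℕ.m≤m+n t x))))
    D₂-⟪⟫ : ⟪ D₂ f t ⟫ xs xs ≡ ⟪ f₂ ⟫ xs xs + ⟪ f₁ ⟫ xs xs + ⟪ f₃ ⟫ xs xs
    D₂-⟪⟫ = trans (⟪⟫-+ _ f₃ xs xs) (cong (_+ ⟪ f₃ ⟫ xs xs) (⟪⟫-+ f₂ f₁ xs xs))
    telescope : rows (D₂ f t) + + length xs * f t + ⟪ f ⟫ xs us + ⟪ f ⟫ us xs ≡ rows (λ h → f h + f h) + ⟪ f ⟫ xs′ us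
    telescope = trans (sym lhs) (trans (∑-cong xs (D₂-telescope f t)) rhs)
      where
      lhs = trans (∑-+ _ (λ x → ∑ us (λ u → Δ f u x)) xs) (cong₂ _+_
        (trans (∑-+ _ (λ x → ∑ us (Δ f x)) xs) (cong (_+ ⟪ f ⟫ xs us)
          (trans (∑-+ _ (λ _ → f t) xs) (cong (λ s → rows (D₂ f t) + s) (∑-const (f t) xs)))))
        (sym (∑-swap (Δ f) us xs)))
      rhs = trans (∑-+ _ (λ x → ∑ us (Δ f (t ℕ.+ x))) xs) (cong (λ s → rows (λ h → f h + f h) + s) (sym (∑-map (t ℕ.+_) xs)))
    linear : ∀ n n₂ r r₂ uu uu′ xx gg gx xg ux xu ux′ x′u x′x xx′ p₁ p₂ p₃ m →
      gg + gx + (xg + xx) ≡ uu + ux′ + (x′u + xx) →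
      gx + xx ≡ ux + x′x → xg + xx ≡ xu + xx′ →
      x′x ≡ p₂ + p₃ + m → xx′ ≡ p₁ → ux′ ≡ 0ℤ → r + m + xu + ux ≡ r₂ + x′u →
      n + (p₂ + p₁ + p₃) ≡ r → n₂ + (xx + xx) ≡ r₂ → uu ≡ uu′ →
      n + uu′ ≡ n₂ + gg
    linear n n₂ r r₂ uu uu′ xx gg gx xg ux xu ux′ x′u x′x xx′ p₁ p₂ p₃ m e₁ e₂ e₃ refl refl refl e₄ refl refl refl =
      ℤ.i-j≡0⇒i≡j _ _ (begin
        n + uu - (n₂ + gg)
          -- Once the other relations are substituted, the claim is the combination `telescope` -
          -- `square` + the two one-sided expansions, which cancel S(G, X) and S(X, G).
          ≡⟨ combination n n₂ uu xx gg gx xg ux xu x′u p₁ p₂ p₃ m ⟩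
        (n + (p₂ + p₁ + p₃) + m + xu + ux - (n₂ + (xx + xx) + x′u))
          - (gg + gx + (xg + xx) - (uu + 0ℤ + (x′u + xx)))
          + (gx + xx - (ux + (p₂ + p₃ + m)))
          + (xg + xx - (xu + p₁))
          ≡⟨ cong₂ _+_ (cong₂ _+_ (cong₂ _-_ (ℤ.i≡j⇒i-j≡0 e₄) (ℤ.i≡j⇒i-j≡0 e₁))
               (ℤ.i≡j⇒i-j≡0 e₂)) (ℤ.i≡j⇒i-j≡0 e₃) ⟩
        0ℤ ∎)
      where
      open ≡-Reasoning
      combination : ∀ n n₂ uu xx gg gx xg ux xu x′u p₁ p₂ p₃ m → n + uu - (n₂ + gg) ≡
        (n + (p₂ + p₁ + p₃) + m + xu + ux - (n₂ + (xx + xx) + x′u))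
          - (gg + gx + (xg + xx) - (uu + 0ℤ + (x′u + xx)))
          + (gx + xx - (ux + (p₂ + p₃ + m)))
          + (xg + xx - (xu + p₁))
      combination = solve-∀

  -- Recovering a multiset from its sums

  module _ {A : Set} (_≟_ : DecidableEquality A) where

    private
      δ : A → A → ℤ
      δ x y with x ≟ y
      ... | yes _ = + 1
      ... | no  _ = 0ℤ

      δ-diag : ∀ x → δ x x ≡ + 1
      δ-diag x with x ≟ x
      ... | yes _   = refl
      ... | no  x≢x = contradiction refl x≢x

      ∑-δ-∈ : ∀ x ys → ¬ ∑ ys (δ x) ≡ 0ℤ → x ∈ ys
      ∑-δ-∈ x []       ∑≢0 = contradiction refl ∑≢0
      ∑-δ-∈ x (y ∷ ys) ∑≢0 with x ≟ y
      ... | yes x≡y = here x≡y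
      ... | no  _   = there (∑-δ-∈ x ys (∑≢0 ∘ trans (ℤ.+-identityˡ _)))

      ∑-δ-ℕ : ∀ x ys → 0ℤ ℤ.≤ ∑ ys (δ x)
      ∑-δ-ℕ x []       = ℤ.≤-refl
      ∑-δ-ℕ x (y ∷ ys) with x ≟ y
      ... | yes _ = ℤ.+-mono-≤ {0ℤ} {+ 1} (ℤ.+≤+ z≤n) (∑-δ-ℕ x ys)
      ... | no  _ = ℤ.+-mono-≤ {0ℤ} {0ℤ} ℤ.≤-refl (∑-δ-ℕ x ys)

    -- Testing against the indicator of the head `x` gives a positive sum over `x ∷ xs`, hence over
    -- `ys`, so `x` occurs in `ys`. Removing it on both sides preserves the hypothesis. For an empty
    -- left side the constant 1 counts the entries of `ys`.
    ∑-≗⇒↭ : ∀ xs ys → (∀ f → ∑ xs f ≡ ∑ ys f) → xs ↭ ys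
    ∑-≗⇒↭ [] []       eq = ↭.refl
    ∑-≗⇒↭ [] (y ∷ ys) eq with () ← trans (eq (λ _ → + 1)) (∑-const (+ 1) (y ∷ ys))
    ∑-≗⇒↭ (x ∷ xs) ys eq
      with as , bs , refl ← ∈-∃++ (∑-δ-∈ x ys λ ∑≡0 →
        ℤ.<⇒≢ (ℤ.<-≤-trans (ℤ.+<+ (s≤s z≤n)) (ℤ.+-mono-≤ {+ 1} (ℤ.≤-reflexive (sym (δ-diag x))) (∑-δ-ℕ x xs)))
          (sym (trans (eq (δ x)) ∑≡0)))
      = ↭.trans (↭.prep x (∑-≗⇒↭ xs (as ++ bs) λ f →
          ∙-cancelˡ (f x) _ _ (trans (eq f) (∑-↭ f (↭.shift x as bs)))))
        (↭.↭-sym (↭.shift x as bs))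

  -- First column hook lengths and hook lengths

  -- First column hook lengths.
  betas : List ℕ → List ℕ
  betas []       = []
  betas (l ∷ ls) = l ℕ.+ length ls ∷ betas ls

  legs : ℕ → List ℕ → ℕ
  legs j ls = length (filter (j ℕ.<?_) ls)

  firstRow : ℕ → List ℕ → List ℕ
  firstRow l ls = applyUpTo (λ j → suc (l ∸ suc j ℕ.+ legs j ls)) l

  hookList : List ℕ → List ℕ
  hookList []       = []
  hookList (l ∷ ls) = firstRow l ls ++ hookList ls

  -- Arms and legs in the lower rows do not see the first row, so the boxes can be listed by
  -- recursion on the rows; the inductions on partitions use this form.
  hookLengths≡ : ∀ μ → hookLengths μ ≡ hookList (parts μ)
  hookLengths≡ μ = go (parts μ)
    where
    open ≡-Reasoning
    hook′ : List ℕ → Box → ℕ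
    hook′ ls (i , j) = suc (row ls i ∸ suc j ℕ.+ legs j (drop (suc i) ls))
    rowBoxes : List ℕ → ℕ → List Box
    rowBoxes ls i = map (i ,_) (upTo (row ls i))
    go : ∀ ls → map (hook′ ls) (concatMap (rowBoxes ls) (upTo (length ls))) ≡ hookList ls
    go []       = refl
    go (l ∷ ls) = begin
      map h (rowBoxes (l ∷ ls) 0 ++ concatMap (rowBoxes (l ∷ ls)) (applyUpTo suc (length ls)))
        ≡⟨ map-++ h (rowBoxes (l ∷ ls) 0) _ ⟩
      map h (rowBoxes (l ∷ ls) 0) ++ map h (concatMap (rowBoxes (l ∷ ls)) (applyUpTo suc (length ls)))
        ≡⟨ cong₂ _++_ (trans (sym (map-∘ (upTo l))) (map-upTo _ l)) (begin
          map h (concatMap (rowBoxes (l ∷ ls)) (applyUpTo suc (length ls)))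
            ≡⟨ cong (map h ∘ concatMap (rowBoxes (l ∷ ls))) (map-upTo suc (length ls)) ⟨
          map h (concatMap (rowBoxes (l ∷ ls)) (map suc (upTo (length ls))))
            ≡⟨ cong (map h) (concatMap-map (rowBoxes (l ∷ ls)) suc (upTo (length ls))) ⟩
          map h (concatMap (rowBoxes (l ∷ ls) ∘ suc) (upTo (length ls)))
            ≡⟨ map-concatMap h (rowBoxes (l ∷ ls) ∘ suc) (upTo (length ls)) ⟩
          concatMap (map h ∘ rowBoxes (l ∷ ls) ∘ suc) (upTo (length ls))
            ≡⟨ concatMap-cong (λ i → trans (sym (map-∘ (upTo (row ls i)))) (map-∘ (upTo (row ls i)))) (upTo (length ls)) ⟩
          concatMap (map (hook′ ls) ∘ rowBoxes ls) (upTo (length ls))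
            ≡⟨ map-concatMap (hook′ ls) (rowBoxes ls) (upTo (length ls)) ⟨
          map (hook′ ls) (concatMap (rowBoxes ls) (upTo (length ls)))
            ≡⟨ go ls ⟩
          hookList ls ∎) ⟩
      firstRow l ls ++ hookList ls ∎
      where h = hook′ (l ∷ ls)

  betas-below : ∀ {l ls} → AllPairs _≥_ (l ∷ ls) → All (l ℕ.+ length ls ℕ.>_) (betas ls)
  betas-below {ls = []} _ = []
  betas-below {l} {m ∷ ls} ((l≥m ∷ _) ∷ ls↓) =
    subst (ℕ._> m ℕ.+ length ls) (sym (ℕ.+-suc l _)) (s≤s (ℕ.+-monoˡ-≤ _ l≥m))
    ∷ All.map (λ p → ℕ.<-≤-trans p (ℕ.+-mono-≤ l≥m (ℕ.n≤1+n _))) (betas-below ls↓)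

  betas-decreasing : ∀ {ls} → AllPairs _≥_ ls → Decreasing (betas ls)
  betas-decreasing []            = []
  betas-decreasing (l≥ ∷ ls↓) = betas-below (l≥ ∷ ls↓) ∷ betas-decreasing ls↓

  parts-decreasing : ∀ μ → AllPairs _≥_ (parts μ)
  parts-decreasing μ = Linked⇒AllPairs (λ p q → ℕ.≤-trans q p) (decreasing μ)

  applyUpTo-cong : ∀ {A : Set} {f g : ℕ → A} n → (∀ {i} → i ℕ.< n → f i ≡ g i) → applyUpTo f n ≡ applyUpTo g n
  applyUpTo-cong zero    eq = refl
  applyUpTo-cong (suc n) eq = cong₂ _∷_ (eq (s≤s z≤n)) (applyUpTo-cong n (λ i<n → eq (s≤s i<n)))

  applyUpTo-+ : ∀ {A : Set} (f : ℕ → A) m n → applyUpTo f (m ℕ.+ n) ≡ applyUpTo f m ++ applyUpTo (λ i → f (m ℕ.+ i)) n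
  applyUpTo-+ f zero    n = refl
  applyUpTo-+ f (suc m) n = cong (f 0 ∷_) (applyUpTo-+ (f ∘ suc) m n)

  applyUpTo-∸ : ∀ n → applyUpTo (λ j → suc (n ∸ suc j)) n ≡ applyDownFrom suc n
  applyUpTo-∸ zero    = refl
  applyUpTo-∸ (suc n) = cong (suc n ∷_) (applyUpTo-∸ n)

  applyDownFrom↭applyUpTo : ∀ {A : Set} (f : ℕ → A) n → applyDownFrom f n ↭ applyUpTo f n
  applyDownFrom↭applyUpTo f n = subst (_↭ applyUpTo f n) (reverse-applyUpTo f n) (↭.↭-reverse (applyUpTo f n))

  -- Compare with the next row, of length m. In the columns they share, the arm grows by d and the
  -- leg by 1; the last d columns have leg 0 and hook lengths d, ..., 1.
  firstRow-∷ : ∀ m d ls → All (m ≥_) ls →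
               firstRow (m ℕ.+ d) (m ∷ ls) ≡ map (suc d ℕ.+_) (firstRow m ls) ++ applyDownFrom suc d
  firstRow-∷ m d ls m≥ = begin
    applyUpTo F (m ℕ.+ d)
      ≡⟨ applyUpTo-+ F m d ⟩
    applyUpTo F m ++ applyUpTo (λ k → F (m ℕ.+ k)) d
      ≡⟨ cong₂ _++_
           (trans (applyUpTo-cong m left) (sym (map-applyUpTo _ (suc d ℕ.+_) m)))
           (trans (applyUpTo-cong d (λ {k} _ → right k)) (applyUpTo-∸ d)) ⟩
    map (suc d ℕ.+_) (firstRow m ls) ++ applyDownFrom suc d ∎
    where
    open ≡-Reasoning
    F = λ j → suc ((m ℕ.+ d) ∸ suc j ℕ.+ legs j (m ∷ ls))
    left : ∀ {j} → j ℕ.< m → F j ≡ suc d ℕ.+ suc (m ∸ suc j ℕ.+ legs j ls)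
    left {j} j<m = cong suc (begin
      (m ℕ.+ d) ∸ suc j ℕ.+ legs j (m ∷ ls)
        ≡⟨ cong₂ ℕ._+_ (trans (cong (_∸ suc j) (ℕ.+-comm m d)) (ℕ.+-∸-assoc d j<m))
             (cong length (filter-accept (j ℕ.<?_) j<m)) ⟩
      (d ℕ.+ (m ∸ suc j)) ℕ.+ suc (legs j ls)
        ≡⟨ trans (ℕ.+-assoc d _ _) (cong (d ℕ.+_) (ℕ.+-suc _ _)) ⟩
      d ℕ.+ suc (m ∸ suc j ℕ.+ legs j ls) ∎)
    right : ∀ k → F (m ℕ.+ k) ≡ suc (d ∸ suc k)
    right k = cong suc (begin
      (m ℕ.+ d) ∸ suc (m ℕ.+ k) ℕ.+ legs (m ℕ.+ k) (m ∷ ls)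
        ≡⟨ cong₂ ℕ._+_
             (trans (cong ((m ℕ.+ d) ∸_) (sym (ℕ.+-suc m k))) (ℕ.[m+n]∸[m+o]≡n∸o m d (suc k)))
             (cong length (filter-none ((m ℕ.+ k) ℕ.<?_)
               (All.map (λ p → ℕ.≤⇒≯ (ℕ.≤-trans p (ℕ.m≤m+n m k))) (ℕ.≤-refl ∷ m≥)))) ⟩
      d ∸ suc k ℕ.+ 0
        ≡⟨ ℕ.+-identityʳ _ ⟩
      d ∸ suc k ∎)

  -- Induction on the rows, with c = d + 1 the difference of the first two first column hook
  -- lengths. The statement for the next row, shifted by c, covers the values above c; the last d
  -- columns cover 1, ..., d; and c itself is the difference with the next first column hook length.
  firstRow-↭ : ∀ l ls → AllPairs _≥_ (l ∷ ls) →
    firstRow l ls ++ map (l ℕ.+ length ls ∸_) (betas ls) ↭ applyUpTo suc (l ℕ.+ length ls)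
  firstRow-↭ l [] _ = subst (_↭ applyUpTo suc (l ℕ.+ 0)) (sym eq) (applyDownFrom↭applyUpTo suc (l ℕ.+ 0))
    where
    eq : firstRow l [] ++ [] ≡ applyDownFrom suc (l ℕ.+ 0)
    eq = trans (++-identityʳ _) (trans (applyUpTo-cong l (λ _ → cong suc (ℕ.+-identityʳ _)))
      (trans (applyUpTo-∸ l) (cong (applyDownFrom suc) (sym (ℕ.+-identityʳ l)))))
  firstRow-↭ l (m ∷ ls) ((l≥m ∷ _) ∷ m≥ ∷ ls↓) with d , refl ← ℕ.m≤n⇒∃[o]m+o≡n l≥m = begin
    firstRow (m ℕ.+ d) (m ∷ ls) ++ map ((m ℕ.+ d) ℕ.+ suc n ∸_) (x ∷ betas ls)
      ≡⟨ cong₂ (λ p y → p ++ map (y ∸_) (x ∷ betas ls)) (firstRow-∷ m d ls m≥) len ⟩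
    (map (c ℕ.+_) (firstRow m ls) ++ applyDownFrom suc d) ++ map (c ℕ.+ x ∸_) (x ∷ betas ls)
      ≡⟨ cong ((map (c ℕ.+_) (firstRow m ls) ++ applyDownFrom suc d) ++_)
           (cong₂ _∷_ (ℕ.m+n∸n≡m c x) (shifted (betas-below (m≥ ∷ ls↓)))) ⟩
    (map (c ℕ.+_) (firstRow m ls) ++ applyDownFrom suc d) ++ c ∷ map (c ℕ.+_) (map (x ∸_) (betas ls))
      ↭⟨ ↭.++⁺ʳ _ (↭.++-comm (map (c ℕ.+_) (firstRow m ls)) (applyDownFrom suc d)) ⟩
    (applyDownFrom suc d ++ map (c ℕ.+_) (firstRow m ls)) ++ c ∷ map (c ℕ.+_) (map (x ∸_) (betas ls))
      ↭⟨ ↭.shift c (applyDownFrom suc d ++ map (c ℕ.+_) (firstRow m ls)) _ ⟩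
    c ∷ (applyDownFrom suc d ++ map (c ℕ.+_) (firstRow m ls)) ++ map (c ℕ.+_) (map (x ∸_) (betas ls))
      ≡⟨ cong (c ∷_) (trans (++-assoc (applyDownFrom suc d) _ _)
           (cong (applyDownFrom suc d ++_) (sym (map-++ (c ℕ.+_) (firstRow m ls) _)))) ⟩
    applyDownFrom suc c ++ map (c ℕ.+_) (firstRow m ls ++ map (x ∸_) (betas ls))
      ↭⟨ ↭.++⁺ (applyDownFrom↭applyUpTo suc c) (↭.map⁺ (c ℕ.+_) (firstRow-↭ m ls (m≥ ∷ ls↓))) ⟩
    applyUpTo suc c ++ map (c ℕ.+_) (applyUpTo suc x)
      ≡⟨ cong (applyUpTo suc c ++_) (trans (map-applyUpTo suc (c ℕ.+_) x) (applyUpTo-cong x (λ _ → ℕ.+-suc c _))) ⟩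
    applyUpTo suc c ++ applyUpTo (λ i → suc (c ℕ.+ i)) x
      ≡⟨ applyUpTo-+ suc c x ⟨
    applyUpTo suc (c ℕ.+ x)
      ≡⟨ cong (applyUpTo suc) len ⟨
    applyUpTo suc ((m ℕ.+ d) ℕ.+ suc n) ∎
    where
    open PermutationReasoning
    n = length ls
    x = m ℕ.+ n
    c = suc d
    len : (m ℕ.+ d) ℕ.+ suc n ≡ c ℕ.+ x
    len = trans (ℕ.+-suc (m ℕ.+ d) n) (cong suc (trans (cong (ℕ._+ n) (ℕ.+-comm m d)) (ℕ.+-assoc d m n)))
    shifted : ∀ {ys} → All (x ℕ.>_) ys → map (c ℕ.+ x ∸_) ys ≡ map (c ℕ.+_) (map (x ∸_) ys)
    shifted []        = refl
    shifted (x>y ∷ p) = cong₂ _∷_ (ℕ.+-∸-assoc c (ℕ.<⇒≤ x>y)) (shifted p)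

  -- Row by row this is `firstRow-↭` in summed form: the differences of `x` with the smaller first
  -- column hook lengths are what the row omits from 1, ..., x.
  hookList-∑ : ∀ {ls} → AllPairs _≥_ ls → ∀ g →
    ∑ (hookList ls) g + ⟪ g ⟫ (betas ls) (betas ls) ≡ ∑ (betas ls) (λ x → ∑ (upTo x) (λ k → g (suc k)))
  hookList-∑ []                     g = refl
  hookList-∑ {l ∷ ls} (l≥ ∷ ls↓) g = begin
    ∑ (firstRow l ls ++ hookList ls) g + ⟪ g ⟫ (x ∷ betas ls) (x ∷ betas ls)
      ≡⟨ cong₂ _+_ (∑-++ (firstRow l ls) (hookList ls)) (⟪⟫-∷ g (betas-below (l≥ ∷ ls↓))) ⟩
    (∑ (firstRow l ls) g + ∑ (hookList ls) g) + (∑ (betas ls) (Δ g x) + ⟪ g ⟫ (betas ls) (betas ls))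
      ≡⟨ interchange (∑ (firstRow l ls) g) _ _ _ ⟩
    (∑ (firstRow l ls) g + ∑ (betas ls) (Δ g x)) + (∑ (hookList ls) g + ⟪ g ⟫ (betas ls) (betas ls))
      ≡⟨ cong₂ _+_ (begin
           ∑ (firstRow l ls) g + ∑ (betas ls) (Δ g x)
             ≡⟨ cong (λ s → ∑ (firstRow l ls) g + s) (differences (betas-below (l≥ ∷ ls↓))) ⟩
           ∑ (firstRow l ls) g + ∑ (map (x ∸_) (betas ls)) g
             ≡⟨ ∑-++ (firstRow l ls) _ ⟨
           ∑ (firstRow l ls ++ map (x ∸_) (betas ls)) g
             ≡⟨ ∑-↭ g (firstRow-↭ l ls (l≥ ∷ ls↓)) ⟩
           ∑ (applyUpTo suc x) g
             ≡⟨ ∑-applyUpTo suc x g ⟩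
           ∑ (upTo x) (λ k → g (suc k)) ∎) (hookList-∑ ls↓ g) ⟩
    ∑ (upTo x) (λ k → g (suc k)) + ∑ (betas ls) (λ x → ∑ (upTo x) (λ k → g (suc k))) ∎
    where
    open ≡-Reasoning
    x = l ℕ.+ length ls
    differences : ∀ {ys} → All (x ℕ.>_) ys → ∑ ys (Δ g x) ≡ ∑ (map (x ∸_) ys) g
    differences []        = refl
    differences (x>y ∷ p) = cong₂ _+_ (Δ-> g x>y) (differences p)

  -- The number x - y is among 1, ..., x. If it were not in the row of x, then by `firstRow-↭` it
  -- would be x - z with z a first column hook length, which forces y = z.
  ∈-hookList⁺ : ∀ {ls x y} → AllPairs _≥_ ls → x ∈ betas ls → y ∉ betas ls → y ℕ.< x → x ∸ y ∈ hookList ls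
  ∈-hookList⁺ {l ∷ ls} {x} {y} ls↓ (here refl) y∉ y<x
    with ∈-++⁻ (firstRow l ls) (↭.∈-resp-↭ (↭.↭-sym (firstRow-↭ l ls ls↓))
           (subst (_∈ applyUpTo suc x) (ℕ.suc-pred (x ∸ y) {{ℕ.>-nonZero (ℕ.m<n⇒0<n∸m y<x)}})
             (∈-applyUpTo⁺ suc (subst (ℕ._≤ x) (sym (ℕ.suc-pred (x ∸ y) {{ℕ.>-nonZero (ℕ.m<n⇒0<n∸m y<x)}})) (ℕ.m∸n≤m x y)))))
  ... | inj₁ x-y∈ = ∈-++⁺ˡ x-y∈
  ... | inj₂ x-y∈ with z , z∈ , eq ← ∈-map⁻ (x ∸_) x-y∈ =
    contradiction (subst (_∈ betas ls) (sym (ℕ.∸-cancelˡ-≡ (ℕ.<⇒≤ y<x) (ℕ.<⇒≤ (All.lookup (betas-below ls↓) z∈)) eq)) z∈) (y∉ ∘ there)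
  ∈-hookList⁺ {l ∷ ls} (_ ∷ ls↓) (there x∈) y∉ y<x = ∈-++⁺ʳ (firstRow l ls) (∈-hookList⁺ ls↓ x∈ (y∉ ∘ there) y<x)

  -- For h in the first row, take y = x - h. The list 1, ..., x has no repetitions, so by
  -- `firstRow-↭` h is not also a difference of first column hook lengths, and y is not one of them.
  -- For a lower row, y stays below the new head.
  ∈-hookList⁻ : ∀ {ls h} → AllPairs _≥_ ls → h ∈ hookList ls →
    ∃[ x ] ∃[ y ] x ∈ betas ls × y ∉ betas ls × y ℕ.< x × h ≡ x ∸ y
  ∈-hookList⁻ {l ∷ ls} {h} ls↓ h∈ with ∈-++⁻ (firstRow l ls) h∈
  ... | inj₁ h∈row with i , i<x , refl ← ∈-applyUpTo⁻ suc (↭.∈-resp-↭ (firstRow-↭ l ls ls↓) (∈-++⁺ˡ h∈row)) =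
    x , x ∸ suc i , here refl , (λ { (here eq) → ℕ.<⇒≢ y<x eq ; (there y∈) → clash y∈ }) , y<x , sym (ℕ.m∸[m∸n]≡n i<x)
    where
    x = l ℕ.+ length ls
    y<x : x ∸ suc i ℕ.< x
    y<x = ℕ.∸-monoʳ-< {o = 0} (s≤s z≤n) i<x
    disjoint : Unique (firstRow l ls ++ map (x ∸_) (betas ls))
    disjoint = ↭ₛ.AllPairs-resp-↭ (setoid ℕ) ≢-sym (resp₂ _≢_) (↭⇒↭ₛ (↭.↭-sym (firstRow-↭ l ls ls↓)))
      (Unique.applyUpTo⁺₁ suc x (λ i<j _ → ℕ.<⇒≢ (s≤s i<j)))
    separate : ∀ {as bs : List ℕ} {z} → Unique (as ++ bs) → z ∈ as → z ∉ bs
    separate {_ ∷ as} (z≢ ∷ u) (here refl) z∈bs = All.lookup z≢ (∈-++⁺ʳ as z∈bs) refl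
    separate          (_ ∷ u) (there z∈as) z∈bs = separate u z∈as z∈bs
    clash : x ∸ suc i ∉ betas ls
    clash y∈ = separate disjoint h∈row (subst (_∈ map (x ∸_) (betas ls)) (ℕ.m∸[m∸n]≡n i<x) (∈-map⁺ (x ∸_) y∈))
  ∈-hookList⁻ {l ∷ ls} {h} ls↓@(_ ∷ ls↓′) h∈ | inj₂ h∈rest
    with x , y , x∈ , y∉ , y<x , eq ← ∈-hookList⁻ ls↓′ h∈rest =
    x , y , there x∈ ,
    (λ { (here refl) → ℕ.<-asym y<x (All.lookup (betas-below ls↓) x∈) ; (there y∈) → y∉ y∈ }) , y<x , eq

  -- Strictly decreasing lists as finite sets

  decreasing⇒unique : ∀ {xs} → Decreasing xs → Unique xs
  decreasing⇒unique = AllPairs.map (λ x>y x≡y → ℕ.<⇒≢ x>y (sym x≡y))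

  -- Each head is the maximum of its list, so equal sets have equal heads, and the heads can be
  -- removed.
  decreasing-ext : ∀ {xs ys} → Decreasing xs → Decreasing ys →
    (∀ {x} → x ∈ xs → x ∈ ys) → (∀ {x} → x ∈ ys → x ∈ xs) → xs ≡ ys
  decreasing-ext {[]}     {[]}     _ _ _ _ = refl
  decreasing-ext {[]}     {y ∷ ys} _ _ _ ⊇ with () ← ⊇ (here refl)
  decreasing-ext {x ∷ xs} {[]}     _ _ ⊆ _ with () ← ⊆ (here refl)
  decreasing-ext {x ∷ xs} {y ∷ ys} (x> ∷ xs↓) (y> ∷ ys↓) ⊆ ⊇ with heads (⊆ (here refl)) (⊇ (here refl))
    where
    heads : x ∈ y ∷ ys → y ∈ x ∷ xs → x ≡ y
    heads (here eq)  _          = eq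
    heads (there _)  (here eq)  = sym eq
    heads (there x∈) (there y∈) = contradiction (All.lookup x> y∈) (ℕ.<-asym (All.lookup y> x∈))
  ... | refl = cong (x ∷_) (decreasing-ext xs↓ ys↓
    (λ z∈ → tail (ℕ.<⇒≢ (All.lookup x> z∈)) (⊆ (there z∈)))
    (λ z∈ → tail (ℕ.<⇒≢ (All.lookup y> z∈)) (⊇ (there z∈))))
    where
    tail : ∀ {z zs} → z ≢ x → z ∈ x ∷ zs → z ∈ zs
    tail z≢x (here z≡x) = contradiction z≡x z≢x
    tail z≢x (there z∈) = z∈

  row-∈ : ∀ xs {i} → i ℕ.< length xs → row xs i ∈ xs
  row-∈ (x ∷ xs) {zero}  _         = here refl
  row-∈ (x ∷ xs) {suc i} (s≤s i<) = there (row-∈ xs i<)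

  ∈-row : ∀ {xs x} → x ∈ xs → ∃[ i ] i ℕ.< length xs × row xs i ≡ x
  ∈-row (here refl) = 0 , s≤s z≤n , refl
  ∈-row (there x∈) with i , i< , eq ← ∈-row x∈ = suc i , s≤s i< , eq

  row-decreasing : ∀ {xs} → Decreasing xs → ∀ {i j} → i ℕ.< j → j ℕ.< length xs → row xs j ℕ.< row xs i
  row-decreasing {x ∷ xs} (x> ∷ _)   {zero}  {suc j} _         (s≤s j<) = All.lookup x> (row-∈ xs j<)
  row-decreasing {x ∷ xs} (_ ∷ xs↓) {suc i} {suc j} (s≤s i<j) (s≤s j<) = row-decreasing xs↓ i<j j<

  map-row-allFin : ∀ {t} xs → length xs ≡ t → map (λ (i : Fin t) → row xs (toℕ i)) (allFin t) ≡ xs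
  map-row-allFin xs refl = trans (map-tabulate id (λ i → row xs (toℕ i))) (go xs)
    where
    go : ∀ xs → tabulate {n = length xs} (λ i → row xs (toℕ i)) ≡ xs
    go []       = refl
    go (x ∷ xs) = cong (x ∷_) (go xs)

  row-tabulate : ∀ {t} (g : Fin t → ℕ) i → row (tabulate g) (toℕ i) ≡ g i
  row-tabulate g Fin.zero    = refl
  row-tabulate g (Fin.suc i) = row-tabulate (g ∘ Fin.suc) i

  -- The gaps of a closed set

  -- The first column hook lengths after appending t parts equal to 0.
  translate : ℕ → List ℕ → List ℕ
  translate t xs = upTo t ++ map (t ℕ.+_) xs

  -- On the t-abacus: no bead has a free position directly before it on its runner. Stated through
  -- `translate`, so that the same list contains both the beads and the gaps.
  Closed : ℕ → List ℕ → Set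
  Closed t xs = ∀ {x} → x ∈ xs → x ∈ translate t xs

  -- The first free position on each runner of the t-abacus with beads xs.
  gap? : ∀ t xs y → Dec (y ∉ xs × y ∈ translate t xs)
  gap? t xs y = ¬? (y ∈? xs) ×-dec (y ∈? translate t xs)

  -- Opaque, as only order and membership are ever used. The search bound suffices because gaps lie
  -- in `translate t xs`.
  opaque
    gaps : ℕ → List ℕ → List ℕ
    gaps t xs = filter (gap? t xs) (downFrom (suc (max 0 (translate t xs))))

    gaps-decreasing : ∀ t xs → Decreasing (gaps t xs)
    gaps-decreasing t xs = AllPairs.filter⁺ (gap? t xs) (AllPairs.applyDownFrom⁺₁ id _ (λ j<i _ → j<i))

    ∈-gaps⁺ : ∀ {t xs y} → y ∉ xs → y ∈ translate t xs → y ∈ gaps t xs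
    ∈-gaps⁺ {t} {xs} y∉ y∈ = ∈-filter⁺ (gap? t xs) (∈-downFrom⁺ (s≤s (All.lookup (xs≤max 0 (translate t xs)) y∈))) (y∉ , y∈)

    ∈-gaps⁻ : ∀ {t xs y} → y ∈ gaps t xs → y ∉ xs × y ∈ translate t xs
    ∈-gaps⁻ {t} {xs} y∈ = proj₂ (∈-filter⁻ (gap? t xs) y∈)

  ∈-translate⁻ : ∀ {t xs y} → t ℕ.+ y ∈ translate t xs → y ∈ xs
  ∈-translate⁻ {t} {xs} {y} t+y∈ with ∈-++⁻ (upTo t) t+y∈
  ... | inj₁ t+y∈upTo = contradiction (∈-upTo⁻ t+y∈upTo) (ℕ.≤⇒≯ (ℕ.m≤m+n t y))
  ... | inj₂ t+y∈map with x , x∈ , eq ← ∈-map⁻ (t ℕ.+_) t+y∈map = subst (_∈ xs) (sym (ℕ.+-cancelˡ-≡ t y x eq)) x∈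

  ∈-translate⁺ : ∀ {t xs y} → y ∈ xs → t ℕ.+ y ∈ translate t xs
  ∈-translate⁺ {t} y∈ = ∈-++⁺ʳ (upTo t) (∈-map⁺ (t ℕ.+_) y∈)

  -- Neither side repeats an entry, so equality as sets is enough. Closure puts `xs` inside
  -- `translate t xs`, and the rest of that list consists of gaps by definition.
  gaps-↭ : ∀ {t xs} → Decreasing xs → Closed t xs → gaps t xs ++ xs ↭ translate t xs
  gaps-↭ {t} {xs} xs↓ closed = ∼bag⇒↭ (unique∧set⇒bag
    (Unique.++⁺ (decreasing⇒unique (gaps-decreasing t xs)) (decreasing⇒unique xs↓)
      (λ (y∈gaps , y∈xs) → proj₁ (∈-gaps⁻ {t} y∈gaps) y∈xs))
    (Unique.++⁺ (Unique.upTo⁺ t) (Unique.map⁺ (ℕ.+-cancelˡ-≡ t _ _) (decreasing⇒unique xs↓)) apart)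
    (mk⇔ (λ y∈ → [ proj₂ ∘ ∈-gaps⁻ {t} {xs} , closed ]′ (∈-++⁻ (gaps t xs) y∈)) split))
    where
    apart : ∀ {y} → ¬ (y ∈ upTo t × y ∈ map (t ℕ.+_) xs)
    apart (y∈upTo , y∈map) with x , _ , refl ← ∈-map⁻ (t ℕ.+_) y∈map =
      contradiction (∈-upTo⁻ y∈upTo) (ℕ.≤⇒≯ (ℕ.m≤m+n t x))
    split : ∀ {y} → y ∈ translate t xs → y ∈ gaps t xs ++ xs
    split {y} y∈ with y ∈? xs
    ... | yes y∈xs = ∈-++⁺ʳ (gaps t xs) y∈xs
    ... | no  y∉xs = ∈-++⁺ˡ (∈-gaps⁺ y∉xs y∈)

  gaps-length : ∀ {t xs} → Decreasing xs → Closed t xs → length (gaps t xs) ≡ t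
  gaps-length {t} {xs} xs↓ closed = ℕ.+-cancelʳ-≡ (length xs) _ _ (begin
    length (gaps t xs) ℕ.+ length xs             ≡⟨ length-++ (gaps t xs) ⟨
    length (gaps t xs ++ xs)                     ≡⟨ ↭.↭-length (gaps-↭ xs↓ closed) ⟩
    length (translate t xs)                      ≡⟨ length-++ (upTo t) ⟩
    length (upTo t) ℕ.+ length (map (t ℕ.+_) xs) ≡⟨ cong₂ ℕ._+_ (length-upTo t) (length-map _ xs) ⟩
    t ℕ.+ length xs                              ∎)
    where open ≡-Reasoning

  module _ {t xs} (closed : Closed t xs) where

    descend : ∀ q {y} → y ℕ.+ q ℕ.* t ∈ xs → y ∈ xs
    descend zero    {y} y∈ = subst (_∈ xs) (ℕ.+-identityʳ y) y∈
    descend (suc q) {y} y∈ =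
      descend q (∈-translate⁻ {t} (subst (_∈ translate t xs) (x+[y+z]≡y+[x+z] y t _) (closed y∈)))

    -- If a gap z exceeded y by a positive multiple of t, then z - t would be in `xs`, and closure
    -- would carry it down to y, which is not in `xs`.
    gap-< : ∀ {y z} → y ∈ gaps t xs → z ∈ gaps t xs → y ℕ.< z → ¬ (t ∣ z ∸ y)
    gap-< _ _ y<z (divides zero eq) = ℕ.<⇒≱ y<z (ℕ.m∸n≡0⇒m≤n eq)
    gap-< {y} {z} y∈ z∈ y<z (divides (suc q) eq) = proj₁ (∈-gaps⁻ {t} y∈) (descend q
      (∈-translate⁻ {t} (subst (_∈ translate t xs)
        (trans (sym (ℕ.m+[n∸m]≡n (ℕ.<⇒≤ y<z))) (trans (cong (y ℕ.+_) eq) (x+[y+z]≡y+[x+z] y t _)))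
        (proj₂ (∈-gaps⁻ {t} z∈)))))

    gap-unique : ∀ {y z} → y ∈ gaps t xs → z ∈ gaps t xs → + t Unsigned.∣ + y - + z → y ≡ z
    gap-unique {y} {z} y∈ z∈ t∣ with ℕ.<-cmp y z
    ... | tri≈ _ y≡z _ = y≡z
    ... | tri< y<z _ _ = contradiction
      (subst (t ∣_) (trans (cong ℤ.∣_∣ (ℤ.m-n≡m⊖n y z)) (ℤ.∣⊖∣-≤ (ℕ.<⇒≤ y<z))) t∣) (gap-< y∈ z∈ y<z)
    ... | tri> _ _ z<y = contradiction
      (subst (t ∣_) (trans (cong ℤ.∣_∣ (ℤ.m-n≡m⊖n y z)) (trans (ℤ.∣m⊖n∣≡∣n⊖m∣ y z) (ℤ.∣⊖∣-≤ (ℕ.<⇒≤ z<y)))) t∣)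
      (gap-< z∈ y∈ z<y)

  -- Climb r, r + t, r + 2t, … until the progression leaves xs.
  gap-exists : ∀ t xs → .{{_ : NonZero t}} → ∀ z → ∃[ y ] y ∈ gaps t xs × + t Unsigned.∣ + y - z
  gap-exists t xs z = let y , q , y∈ , eq = climb (suc (max 0 xs)) outside in y , y∈ , Signed.∣⇒∣ᵤ
    (Signed.divides (+ q - z /ℕ t) (begin
      + y - z                                     ≡⟨ cong₂ (λ a b → + a - b) eq (a≡a%ℕn+[a/ℕn]*n z t) ⟩
      + (r ℕ.+ q ℕ.* t) - (+ r + z /ℕ t * + t)
        ≡⟨ cong (_- (+ r + z /ℕ t * + t)) (trans (ℤ.pos-+ r (q ℕ.* t)) (cong (λ a → + r + a) (ℤ.pos-* q t))) ⟩
      (+ r + + q * + t) - (+ r + z /ℕ t * + t)    ≡⟨ collect (+ r) (+ q) (z /ℕ t) (+ t) ⟩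
      (+ q - z /ℕ t) * + t                        ∎))
    where
    open ≡-Reasoning
    r = z %ℕ t
    collect : ∀ r q p t → (r + q * t) - (r + p * t) ≡ (q - p) * t
    collect = solve-∀
    outside : r ℕ.+ suc (max 0 xs) ℕ.* t ∉ xs
    outside ∈xs = ℕ.<⇒≱ (ℕ.≤-trans (ℕ.m≤m*n (suc (max 0 xs)) t) (ℕ.m≤n+m _ r)) (All.lookup (xs≤max 0 xs) ∈xs)
    -- The search runs downwards from an index beyond the maximum of `xs`, which makes the recursion
    -- structural. It ends at q = 0 or when the preceding position is occupied.
    climb : ∀ q → r ℕ.+ q ℕ.* t ∉ xs → ∃[ y ] ∃[ q′ ] y ∈ gaps t xs × y ≡ r ℕ.+ q′ ℕ.* t
    climb zero    r∉ = _ , 0 , ∈-gaps⁺ r∉ (∈-++⁺ˡ (∈-upTo⁺ (subst (ℕ._< t) (sym (ℕ.+-identityʳ r)) (n%ℕd<d z t)))) , refl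
    climb (suc q) r∉ with r ℕ.+ q ℕ.* t ∈? xs
    ... | no  prev∉ = climb q prev∉
    ... | yes prev∈ = _ , suc q , ∈-gaps⁺ r∉ (subst (_∈ translate t xs) (x+[y+z]≡y+[x+z] t r _) (∈-translate⁺ prev∈)) , refl

  -- Integers inside ℚ and the sum condition

  -- For a variable z, `z ℚ./ 1` does not reduce. With numerator z and denominator 1 explicit, the
  -- operations and the order of ℚ compute.
  fromℤ≡mkℚ : ∀ z → fromℤ z ≡ mkℚ z 0 (Coprime.sym (1-coprimeTo ℤ.∣ z ∣))
  fromℤ≡mkℚ z = ℚ.↥p/↧p≡p (mkℚ z 0 (Coprime.sym (1-coprimeTo ℤ.∣ z ∣)))

  fromℤ-+ : ∀ a b → fromℤ (a + b) ≡ fromℤ a ℚ.+ fromℤ b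
  fromℤ-+ a b rewrite fromℤ≡mkℚ a | fromℤ≡mkℚ b =
    cong (ℚ._/ 1) (sym (cong₂ _+_ (ℤ.*-identityʳ a) (ℤ.*-identityʳ b)))

  fromℤ-* : ∀ a b → fromℤ (a * b) ≡ fromℤ a ℚ.* fromℤ b
  fromℤ-* a b rewrite fromℤ≡mkℚ a | fromℤ≡mkℚ b = refl

  fromℤ-mono-< : ∀ {a b} → a ℤ.< b → fromℤ a ℚ.< fromℤ b
  fromℤ-mono-< {a} {b} a<b rewrite fromℤ≡mkℚ a | fromℤ≡mkℚ b =
    ℚ.*<* (subst (ℤ._< b * + 1) (sym (ℤ.*-identityʳ a)) (subst (a ℤ.<_) (sym (ℤ.*-identityʳ b)) a<b))

  fromℤ-cancel-< : ∀ {a b} → fromℤ a ℚ.< fromℤ b → a ℤ.< b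
  fromℤ-cancel-< {a} {b} a<b with ℤ.<-cmp a b
  ... | tri< a<b′ _ _  = a<b′
  ... | tri≈ _ refl _  = contradiction a<b (ℚ.<-irrefl refl)
  ... | tri> _ _ b<a   = contradiction a<b (ℚ.<-asym (fromℤ-mono-< b<a))

  fromℤ-injective : ∀ {a b} → fromℤ a ≡ fromℤ b → a ≡ b
  fromℤ-injective {a} {b} eq with ℤ.<-cmp a b
  ... | tri< a<b _ _  = contradiction (fromℤ-mono-< a<b) (ℚ.<-irrefl eq)
  ... | tri≈ _ a≡b _  = a≡b
  ... | tri> _ _ b<a  = contradiction (fromℤ-mono-< b<a) (ℚ.<-irrefl (sym eq))

  -- Twice `t₀ t`, as an integer.
  parity : ℕ → ℤ
  parity t = if does (2 ∣? t) then + 1 else + 0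

  t₀≡½*parity : ∀ t → t₀ t ≡ ½ ℚ.* fromℤ (parity t)
  t₀≡½*parity t with does (2 ∣? t)
  ... | true  = refl
  ... | false = refl

  half : ℕ → ℕ
  half t = t ℕ./ 2

  -- In other words (t - 1)/2 + t₀ is the integer ⌊t/2⌋, which is why `half t` is the right shift
  -- for both parities.
  parity-half : ∀ t → parity t + + t ≡ + 1 + (+ half t + + half t)
  parity-half t = trans (cong (λ n → parity t + + n) (m≡m%n+[m/n]*n t 2)) (split (2 ∣? t) (m%n<n t 2))
    where
    double : ∀ h → h ℕ.* 2 ≡ h ℕ.+ h
    double h = trans (ℕ.*-comm h 2) (cong (h ℕ.+_) (ℕ.+-identityʳ h))
    split : (d : Dec (2 ∣ t)) → t ℕ.% 2 ℕ.< 2 →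
      (if does d then + 1 else + 0) + + (t ℕ.% 2 ℕ.+ half t ℕ.* 2) ≡ + 1 + (+ half t + + half t)
    split (yes 2∣t) _ rewrite n∣m⇒m%n≡0 t 2 2∣t = cong (λ n → + (1 ℕ.+ n)) (double (half t))
    split (no ¬2∣t) t%2<2 with t ℕ.% 2 in eq
    ... | 0 = contradiction (m%n≡0⇒n∣m t 2 eq) ¬2∣t
    ... | 1 = cong (λ n → + (1 ℕ.+ n)) (double (half t))
    ... | suc (suc _) with s≤s (s≤s ()) ← t%2<2

  module _ {A : Set} (c : ℚ) (o : A → ℤ) where

    sumℚ-translate : ∀ xs → sumℚ (map (λ i → c ℚ.+ fromℤ (o i)) xs) ≡ fromℤ (+ length xs) ℚ.* c ℚ.+ fromℤ (∑ xs o)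
    sumℚ-translate []       = sym (trans (ℚ.+-identityʳ _) (ℚ.*-zeroˡ c))
    sumℚ-translate (x ∷ xs) = begin
      (c ℚ.+ fromℤ (o x)) ℚ.+ sumℚ (map (λ i → c ℚ.+ fromℤ (o i)) xs)
        ≡⟨ cong ((c ℚ.+ fromℤ (o x)) ℚ.+_) (sumℚ-translate xs) ⟩
      (c ℚ.+ fromℤ (o x)) ℚ.+ (fromℤ (+ length xs) ℚ.* c ℚ.+ fromℤ (∑ xs o))
        ≡⟨ solve 4 (λ c a n s → (c :+ a) :+ (n :* c :+ s) := (con 1ℚ :+ n) :* c :+ (a :+ s)) refl
             c (fromℤ (o x)) (fromℤ (+ length xs)) (fromℤ (∑ xs o)) ⟩
      (1ℚ ℚ.+ fromℤ (+ length xs)) ℚ.* c ℚ.+ (fromℤ (o x) ℚ.+ fromℤ (∑ xs o))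
        ≡⟨ cong₂ (λ p q → p ℚ.* c ℚ.+ q) (fromℤ-+ (+ 1) (+ length xs)) (fromℤ-+ (o x) (∑ xs o)) ⟨
      fromℤ (+ length (x ∷ xs)) ℚ.* c ℚ.+ fromℤ (∑ (x ∷ xs) o) ∎
      where open ≡-Reasoning

    sumℚ-translate² : ∀ xs → sumℚ (map (λ i → (c ℚ.+ fromℤ (o i)) ℚ.* (c ℚ.+ fromℤ (o i))) xs) ≡
      fromℤ (+ length xs) ℚ.* (c ℚ.* c) ℚ.+ (c ℚ.+ c) ℚ.* fromℤ (∑ xs o) ℚ.+ fromℤ (∑ xs (λ i → o i * o i))
    sumℚ-translate² []       = solve 1 (λ c → con 0ℚ := con 0ℚ :* (c :* c) :+ (c :+ c) :* con 0ℚ :+ con 0ℚ) refl c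
    sumℚ-translate² (x ∷ xs) = begin
      (c ℚ.+ a) ℚ.* (c ℚ.+ a) ℚ.+ sumℚ (map (λ i → (c ℚ.+ fromℤ (o i)) ℚ.* (c ℚ.+ fromℤ (o i))) xs)
        ≡⟨ cong ((c ℚ.+ a) ℚ.* (c ℚ.+ a) ℚ.+_) (sumℚ-translate² xs) ⟩
      (c ℚ.+ a) ℚ.* (c ℚ.+ a) ℚ.+ (fromℤ (+ length xs) ℚ.* (c ℚ.* c) ℚ.+ (c ℚ.+ c) ℚ.* fromℤ (∑ xs o) ℚ.+ q)
        ≡⟨ solve 5 (λ c a n s q → (c :+ a) :* (c :+ a) :+ (n :* (c :* c) :+ (c :+ c) :* s :+ q) :=
               (con 1ℚ :+ n) :* (c :* c) :+ (c :+ c) :* (a :+ s) :+ (a :* a :+ q)) refl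
             c a (fromℤ (+ length xs)) (fromℤ (∑ xs o)) q ⟩
      (1ℚ ℚ.+ fromℤ (+ length xs)) ℚ.* (c ℚ.* c) ℚ.+ (c ℚ.+ c) ℚ.* (a ℚ.+ fromℤ (∑ xs o)) ℚ.+ (a ℚ.* a ℚ.+ q)
        ≡⟨ cong₂ ℚ._+_ (cong₂ (λ p r → p ℚ.* (c ℚ.* c) ℚ.+ (c ℚ.+ c) ℚ.* r) (fromℤ-+ (+ 1) (+ length xs)) (fromℤ-+ (o x) (∑ xs o)))
             (trans (fromℤ-+ (o x * o x) _) (cong (ℚ._+ q) (fromℤ-* (o x) (o x)))) ⟨
      fromℤ (+ length (x ∷ xs)) ℚ.* (c ℚ.* c) ℚ.+ (c ℚ.+ c) ℚ.* fromℤ (∑ (x ∷ xs) o) ℚ.+ fromℤ (∑ (x ∷ xs) (λ i → o i * o i)) ∎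
      where
      open ≡-Reasoning
      a = fromℤ (o x)
      q = fromℤ (∑ xs (λ i → o i * o i))

  ∑offsets : ∀ {t} → (Fin t → ℤ′ t) → ℤ
  ∑offsets {t} v = ∑ (allFin t) (λ i → offset (v i))

  -- With ½ taken out, the condition that the sum is 0 becomes an equation in ℤ for twice the sum,
  -- uniformly in the parity of t.
  sumℚ-value : ∀ {t} (v : Fin t → ℤ′ t) →
    sumℚ (map (λ i → value (v i)) (allFin t)) ≡ ½ ℚ.* fromℤ (+ t * parity t + (∑offsets v + ∑offsets v))
  sumℚ-value {t} v = begin
    sumℚ (map (λ i → value (v i)) (allFin t))
      ≡⟨ sumℚ-translate (t₀ t) (λ i → offset (v i)) (allFin t) ⟩
    fromℤ (+ length (allFin t)) ℚ.* t₀ t ℚ.+ fromℤ s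
      ≡⟨ cong₂ (λ n c → fromℤ (+ n) ℚ.* c ℚ.+ fromℤ s) (length-tabulate {n = t} id) (t₀≡½*parity t) ⟩
    fromℤ (+ t) ℚ.* (½ ℚ.* fromℤ (parity t)) ℚ.+ fromℤ s
      ≡⟨ solve 3 (λ n e s → n :* (con ½ :* e) :+ s := con ½ :* (n :* e :+ (s :+ s))) refl (fromℤ (+ t)) (fromℤ (parity t)) (fromℤ s) ⟩
    ½ ℚ.* (fromℤ (+ t) ℚ.* fromℤ (parity t) ℚ.+ (fromℤ s ℚ.+ fromℤ s))
      ≡⟨ cong (½ ℚ.*_) (trans (fromℤ-+ (+ t * parity t) (s + s)) (cong₂ ℚ._+_ (fromℤ-* (+ t) (parity t)) (fromℤ-+ s s))) ⟨
    ½ ℚ.* fromℤ (+ t * parity t + (s + s)) ∎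
    where
    open ≡-Reasoning
    s = ∑offsets v

  balanced⇒sum≡0 : ∀ {t} (v : Fin t → ℤ′ t) → + t * parity t + (∑offsets v + ∑offsets v) ≡ 0ℤ →
                   sumℚ (map (λ i → value (v i)) (allFin t)) ≡ 0ℚ
  balanced⇒sum≡0 v eq = trans (sumℚ-value v) (cong (λ z → ½ ℚ.* fromℤ z) eq)

  sum≡0⇒balanced : ∀ {t} (v : Fin t → ℤ′ t) → sumℚ (map (λ i → value (v i)) (allFin t)) ≡ 0ℚ →
                   + t * parity t + (∑offsets v + ∑offsets v) ≡ 0ℤ
  sum≡0⇒balanced {t} v eq = fromℤ-injective (begin
    fromℤ z                        ≡⟨ solve 1 (λ z → z := con (1ℚ ℚ.+ 1ℚ) :* (con ½ :* z)) refl (fromℤ z) ⟩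
    (1ℚ ℚ.+ 1ℚ) ℚ.* (½ ℚ.* fromℤ z) ≡⟨ cong ((1ℚ ℚ.+ 1ℚ) ℚ.*_) (trans (sym (sumℚ-value v)) eq) ⟩
    0ℚ                             ∎)
    where
    open ≡-Reasoning
    z = + t * parity t + (∑offsets v + ∑offsets v)

  ∑-upTo-id : ∀ n → ∑ (upTo n) pos + ∑ (upTo n) pos ≡ + n * (+ n - + 1)
  ∑-upTo-id zero    = refl
  ∑-upTo-id (suc n) = begin
    ∑ (upTo (suc n)) pos + ∑ (upTo (suc n)) pos   ≡⟨ cong (λ s → s + s) (∑-upTo-last n pos) ⟩
    (s + + n) + (s + + n)                       ≡⟨ regroup s (+ n) ⟩
    (s + s) + (+ n + + n)                       ≡⟨ cong (_+ (+ n + + n)) (∑-upTo-id n) ⟩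
    + n * (+ n - + 1) + (+ n + + n)             ≡⟨ square (+ n) ⟩
    (+ 1 + + n) * ((+ 1 + + n) - + 1)           ∎
    where
    open ≡-Reasoning
    s = ∑ (upTo n) pos
    regroup : ∀ s n → (s + n) + (s + n) ≡ (s + s) + (n + n)
    regroup = solve-∀
    square : ∀ n → n * (n - + 1) + (n + n) ≡ (+ 1 + n) * ((+ 1 + n) - + 1)
    square = solve-∀

  -- In `gaps-↭` the sum of `xs` appears on both sides and cancels. Everything is doubled to avoid
  -- halving t(t - 1).
  ∑-gaps : ∀ {t xs} → Decreasing xs → Closed t xs →
           ∑ (gaps t xs) pos + ∑ (gaps t xs) pos ≡ + t * (+ t - + 1) + (+ t * + length xs + + t * + length xs)
  ∑-gaps {t} {xs} xs↓ closed = ℤ-lemma (∑ (gaps t xs) pos) (∑ xs pos) (∑ (upTo t) pos) (+ t * + length xs) _ (begin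
    ∑ (gaps t xs) pos + ∑ xs pos                  ≡⟨ ∑-++ (gaps t xs) xs ⟨
    ∑ (gaps t xs ++ xs) pos                      ≡⟨ ∑-↭ pos (gaps-↭ xs↓ closed) ⟩
    ∑ (translate t xs) pos                       ≡⟨ ∑-++ (upTo t) _ ⟩
    ∑ (upTo t) pos + ∑ (map (t ℕ.+_) xs) pos
      ≡⟨ cong (λ s → ∑ (upTo t) pos + s) (trans (∑-map (t ℕ.+_) xs) (trans (∑-cong xs (ℤ.pos-+ t)) (∑-+ (λ _ → + t) pos xs))) ⟩
    ∑ (upTo t) pos + (∑ xs (λ _ → + t) + ∑ xs pos)
      ≡⟨ cong (λ s → ∑ (upTo t) pos + (s + ∑ xs pos)) (trans (∑-const (+ t) xs) (ℤ.*-comm _ (+ t))) ⟩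
    ∑ (upTo t) pos + (+ t * + length xs + ∑ xs pos) ∎) (∑-upTo-id t)
    where
    open ≡-Reasoning
    ℤ-lemma : ∀ g x u n w → g + x ≡ u + (n + x) → u + u ≡ w → g + g ≡ w + (n + n)
    ℤ-lemma g x u n w p refl = begin
      g + g                                     ≡⟨ expand g x ⟩
      (g + x) + (g + x) - x - x                 ≡⟨ cong (λ s → s + s - x - x) p ⟩
      (u + (n + x)) + (u + (n + x)) - x - x     ≡⟨ contract u n x ⟩
      (u + u) + (n + n)                         ∎
      where
      expand : ∀ g x → g + g ≡ (g + x) + (g + x) - x - x
      expand = solve-∀
      contract : ∀ u n x → (u + (n + x)) + (u + (n + x)) - x - x ≡ (u + u) + (n + n)
      contract = solve-∀

  -- Partitions from first column hook lengths

  betas-length : ∀ ls → length (betas ls) ≡ length ls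
  betas-length []       = refl
  betas-length (_ ∷ ls) = cong suc (betas-length ls)

  betas-positive : ∀ {ls} → All (_> 0) ls → All (_> 0) (betas ls)
  betas-positive []         = []
  betas-positive (l> ∷ ls>) = ℕ.<-≤-trans l> (ℕ.m≤m+n _ _) ∷ betas-positive ls>

  betas-injective : ∀ {ls ls′} → betas ls ≡ betas ls′ → ls ≡ ls′
  betas-injective {[]}     {[]}       _  = refl
  betas-injective {l ∷ ls} {l′ ∷ ls′} eq with refl ← betas-injective {ls} {ls′} (∷-injectiveʳ eq)
    = cong (_∷ ls) (ℕ.+-cancelʳ-≡ (length ls) l l′ (∷-injectiveˡ eq))

  unbetas : List ℕ → List ℕ
  unbetas []       = []
  unbetas (x ∷ xs) = x ∸ length xs ∷ unbetas xs

  -- The entries after `x` are distinct, positive and smaller than `x`. Hence the subtraction in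
  -- `unbetas` is not truncated and yields positive parts.
  length-< : ∀ {x xs} → Decreasing (x ∷ xs) → All (_> 0) (x ∷ xs) → length xs ℕ.< x
  length-< {xs = []}     _                  (x> ∷ _)  = x>
  length-< {xs = y ∷ xs} ((x>y ∷ _) ∷ xs↓) (_ ∷ xs>) = ℕ.<-≤-trans (s≤s (length-< xs↓ xs>)) x>y

  betas-unbetas : ∀ {xs} → Decreasing xs → All (_> 0) xs → betas (unbetas xs) ≡ xs
  betas-unbetas []           []         = refl
  betas-unbetas {x ∷ xs} xs↓@(_ ∷ xs↓′) xs>@(_ ∷ xs>′) with eq ← betas-unbetas xs↓′ xs>′ = cong₂ _∷_
    (trans (cong (x ∸ length xs ℕ.+_) (trans (sym (betas-length (unbetas xs))) (cong length eq)))
           (ℕ.m∸n+n≡m (ℕ.<⇒≤ (length-< xs↓ xs>))))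
    eq

  unbetas-decreasing : ∀ {xs} → Decreasing xs → Linked _≥_ (unbetas xs)
  unbetas-decreasing []                                           = []
  unbetas-decreasing ([] ∷ [])                                    = [-]
  unbetas-decreasing {x ∷ y ∷ xs} ((x>y ∷ _) ∷ xs↓@(_ ∷ _)) =
    ℕ.∸-monoˡ-≤ (suc (length xs)) x>y ∷ unbetas-decreasing xs↓

  unbetas-positive : ∀ {xs} → Decreasing xs → All (_> 0) xs → All (_> 0) (unbetas xs)
  unbetas-positive []              []              = []
  unbetas-positive xs↓@(_ ∷ xs↓′) xs>@(_ ∷ xs>′) = ℕ.m<n⇒0<n∸m (length-< xs↓ xs>) ∷ unbetas-positive xs↓′ xs>′

  -- The coding of a core

  module _ {t : ℕ} .{{_ : NonZero t}} (κ : Core t) where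

    private
      ls = parts (partition κ)
      xs = betas ls
      ls↓ = parts-decreasing (partition κ)

    -- If x ≥ t and x - t were not a first column hook length, then t = x - (x - t) would be a hook
    -- length.
    core-closed : Closed t xs
    core-closed {x} x∈ with x ℕ.<? t
    ... | yes x<t = ∈-++⁺ˡ (∈-upTo⁺ x<t)
    ... | no  x≮t with x ∸ t ∈? xs
    ...   | yes x-t∈ = subst (_∈ translate t xs) (ℕ.m+[n∸m]≡n (ℕ.≮⇒≥ x≮t)) (∈-translate⁺ x-t∈)
    ...   | no  x-t∉ = contradiction (∣-refl {t}) (All.lookup (isCore κ)
      (subst (t ∈_) (sym (hookLengths≡ (partition κ))) (subst (_∈ hookList ls) (ℕ.m∸[m∸n]≡n (ℕ.≮⇒≥ x≮t))
        (∈-hookList⁺ ls↓ x∈ x-t∉ (ℕ.∸-monoʳ-< {o = 0} (ℕ.n≢0⇒n>0 (ℕ.≢-nonZero⁻¹ t)) (ℕ.≮⇒≥ x≮t))))))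

    betas↓ : Decreasing xs
    betas↓ = betas-decreasing ls↓

    core-gaps : List ℕ
    core-gaps = gaps t xs

    core-gaps-length : length core-gaps ≡ t
    core-gaps-length = gaps-length betas↓ core-closed

  -- The gaps sum to t (t − 1) / 2 + t · length ls, so this shift makes the values sum to 0.
  codingEntries : ∀ t → List ℕ → Vec (ℤ′ t) t
  codingEntries t ls = Vec.tabulate (λ i → t₀+ (+ row (gaps t (betas ls)) (toℕ i) - + (length ls ℕ.+ half t)))

  module _ {t : ℕ} .{{_ : NonZero t}} (κ : Core t) where

    private
      ls = parts (partition κ)
      gs = core-gaps κ
      s  = length ls ℕ.+ half t
      v  = lookup (codingEntries t ls)

    gap : Fin t → ℕ
    gap i = row gs (toℕ i)

    offset-coding : ∀ i → offset (v i) ≡ + gap i - + s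
    offset-coding i = cong offset (lookup∘tabulate _ i)

    private
      index< : ∀ (i : Fin t) → toℕ i ℕ.< length gs
      index< i = subst (toℕ i ℕ.<_) (sym (core-gaps-length κ)) (Fin.toℕ<n i)

    gap-∈ : ∀ i → gap i ∈ gs
    gap-∈ i = row-∈ gs (index< i)

    ∈-gap : ∀ {y} → y ∈ gs → ∃[ i ] gap i ≡ y
    ∈-gap y∈ with i , i< , eq ← ∈-row y∈ =
      fromℕ< i<t , trans (cong (row gs) (Fin.toℕ-fromℕ< i<t)) eq
      where i<t = subst (i ℕ.<_) (core-gaps-length κ) i<

    gap-decreasing : ∀ {i j} → i Fin.< j → gap j ℕ.< gap i
    gap-decreasing {i} {j} i<j = row-decreasing (gaps-decreasing t (betas ls)) i<j (index< j)

    gap-injective : ∀ {i j} → gap i ≡ gap j → i ≡ j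
    gap-injective {i} {j} eq with Fin.<-cmp i j
    ... | tri≈ _ i≡j _ = i≡j
    ... | tri< i<j _ _ = contradiction (sym eq) (ℕ.<⇒≢ (gap-decreasing i<j))
    ... | tri> _ _ j<i = contradiction eq (ℕ.<⇒≢ (gap-decreasing j<i))

    map-gap : map gap (allFin t) ≡ gs
    map-gap = map-row-allFin gs (core-gaps-length κ)

    -- Entries are gaps minus `s`, so class k among them is class k + s among the gaps, which
    -- `gap-exists` and `gap-unique` show to be hit exactly once.
    coding-classes : ∀ (k : Fin t) → ∃! _≡_ λ i → v i ≡ₜ (t₀+ (+ toℕ k))
    coding-classes k = let y , y∈ , t∣ = gap-exists t (betas ls) (+ toℕ k + + s)
                           i , gap-i≡y = ∈-gap y∈
                       in i , to i (subst (λ y → + t Unsigned.∣ + y - (+ toℕ k + + s)) (sym gap-i≡y) t∣) ,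
                          λ {j} t∣j → gap-injective (trans gap-i≡y (gap-unique (core-closed κ) y∈ (gap-∈ j)
                            (congruent (+ y) (+ gap j) t∣ (from j t∣j))))
      where
      regroup : ∀ g k s → g - (k + s) ≡ g - s - k
      regroup = solve-∀
      cancel : ∀ g h z → (g - z) - (h - z) ≡ g - h
      cancel = solve-∀
      eq : ∀ i → + gap i - (+ toℕ k + + s) ≡ offset (v i) - + toℕ k
      eq i = trans (regroup (+ gap i) (+ toℕ k) (+ s)) (cong (_- + toℕ k) (sym (offset-coding i)))
      to : ∀ i → + t Unsigned.∣ + gap i - (+ toℕ k + + s) → + t Unsigned.∣ offset (v i) - + toℕ k
      to i = subst (+ t Unsigned.∣_) (eq i)
      from : ∀ i → + t Unsigned.∣ offset (v i) - + toℕ k → + t Unsigned.∣ + gap i - (+ toℕ k + + s)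
      from i = subst (+ t Unsigned.∣_) (sym (eq i))
      congruent : ∀ g h → + t Unsigned.∣ g - (+ toℕ k + + s) → + t Unsigned.∣ h - (+ toℕ k + + s) → + t Unsigned.∣ g - h
      congruent g h p q = subst (+ t Unsigned.∣_) (cancel g h (+ toℕ k + + s))
        (Signed.∣⇒∣ᵤ (Signed.∣m∣n⇒∣m-n (Signed.∣ᵤ⇒∣ {+ t} {g - z} p) (Signed.∣ᵤ⇒∣ {+ t} {h - z} q)))
        where z = + toℕ k + + s

    coding-total : ∑offsets v ≡ ∑ gs (λ x → + x) - + t * + s
    coding-total = begin
      ∑ (allFin t) (λ i → offset (v i))
        ≡⟨ ∑-cong (allFin t) offset-coding ⟩
      ∑ (allFin t) (λ i → + gap i - + s)
        ≡⟨ ∑-+ (λ i → + gap i) (λ _ → - + s) (allFin t) ⟩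
      ∑ (allFin t) (λ i → + gap i) + ∑ (allFin t) (λ _ → - + s)
        ≡⟨ cong₂ _+_ (trans (sym (∑-map gap (allFin t))) (cong (λ l → ∑ l (λ x → + x)) map-gap))
                     (trans (∑-const (- + s) (allFin t)) (cong (λ n → + n * - + s) (length-tabulate {n = t} id))) ⟩
      ∑ gs (λ x → + x) + + t * - + s
        ≡⟨ cong (λ z → ∑ gs (λ x → + x) + z) (sym (ℤ.neg-distribʳ-* (+ t) (+ s))) ⟩
      ∑ gs (λ x → + x) - + t * + s ∎
      where open ≡-Reasoning

    -- By `∑-gaps` the number of parts cancels against the shift, and what remains is t times the
    -- difference of the two sides of `parity-half`.
    coding-balanced : + t * parity t + (∑offsets v + ∑offsets v) ≡ 0ℤ
    coding-balanced = arithmetic (+ t) (parity t) (∑ gs (λ x → + x)) (∑offsets v) (+ s) (+ length (betas ls)) (+ half t)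
      coding-total (∑-gaps (betas↓ κ) (core-closed κ))
      (trans (ℤ.pos-+ (length ls) (half t)) (cong (λ n → + n + + half t) (sym (betas-length ls)))) (parity-half t)
      where
      open ≡-Reasoning
      regroup : ∀ t e g s → t * e + ((g - t * s) + (g - t * s)) ≡ t * e + (g + g) - t * (s + s)
      regroup = solve-∀
      factor : ∀ t e m h → t * e + (t * (t - + 1) + (t * m + t * m)) - t * ((m + h) + (m + h)) ≡ t * (e + t - (+ 1 + (h + h)))
      factor = solve-∀
      arithmetic : ∀ t e g o s m h → o ≡ g - t * s → g + g ≡ t * (t - + 1) + (t * m + t * m) → s ≡ m + h →
                   e + t ≡ + 1 + (h + h) → t * e + (o + o) ≡ 0ℤ
      arithmetic t e g _ _ m h refl g+g refl e+t = begin
        t * e + ((g - t * (m + h)) + (g - t * (m + h)))                            ≡⟨ regroup t e g (m + h) ⟩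
        t * e + (g + g) - t * ((m + h) + (m + h))
          ≡⟨ cong (λ a → t * e + a - t * ((m + h) + (m + h))) g+g ⟩
        t * e + (t * (t - + 1) + (t * m + t * m)) - t * ((m + h) + (m + h))        ≡⟨ factor t e m h ⟩
        t * (e + t - (+ 1 + (h + h)))
          ≡⟨ cong (λ a → t * a) (ℤ.i≡j⇒i-j≡0 e+t) ⟩
        t * 0ℤ                                                                     ≡⟨ ℤ.*-zeroʳ t ⟩
        0ℤ                                                                         ∎

    coding-strictly : ∀ {i j} → i Fin.< j → offset (v j) ℤ.< offset (v i)
    coding-strictly {i} {j} i<j = subst (ℤ._< offset (v i)) (sym (offset-coding j)) (subst (+ gap j - + s ℤ.<_) (sym (offset-coding i))
      (ℤ.+-monoˡ-< (- + s) (ℤ.+<+ (gap-decreasing i<j))))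

    coding : Coding t
    coding = record
      { entries  = codingEntries t ls
      ; classes  = coding-classes
      ; sum≡0    = balanced⇒sum≡0 v coding-balanced
      ; strictly = λ i<j → ℚ.+-monoʳ-< (t₀ t) (fromℤ-mono-< (coding-strictly i<j))
      }

  -- Injectivity

  -- Let y be the least element of `xs` outside `ys`. Either y < t, or y - t is in `xs` and hence in
  -- `ys`; so y is a gap of `ys`, therefore of `xs`, contrary to y being in `xs`. Used in both
  -- directions, this shows that a closed set is determined by its gaps.
  tail-closed-ext : ∀ {t xs ys} → 0 ℕ.< t → Closed t xs →
    (∀ {y} → y ∈ gaps t ys → y ∈ gaps t xs) → ∀ y → y ∈ xs → y ∈ ys
  tail-closed-ext {t} {xs} {ys} 0<t closed gaps⊆ = <-rec _ step
    where
    step : ∀ y → (∀ {z} → z ℕ.< y → z ∈ xs → z ∈ ys) → y ∈ xs → y ∈ ys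
    step y rec y∈xs with y ∈? ys
    ... | yes y∈ys = y∈ys
    ... | no  y∉ys = contradiction y∈xs (proj₁ (∈-gaps⁻ (gaps⊆ (∈-gaps⁺ y∉ys (moved (∈-++⁻ (upTo t) (closed y∈xs)))))))
      where
      moved : y ∈ upTo t ⊎ y ∈ map (t ℕ.+_) xs → y ∈ translate t ys
      moved (inj₁ y∈upTo) = ∈-++⁺ˡ y∈upTo
      moved (inj₂ y∈map) with x , x∈ , refl ← ∈-map⁻ (t ℕ.+_) y∈map = ∈-translate⁺ (rec (ℕ.m<n+m x 0<t) x∈)

  module _ {t : ℕ} .{{_ : NonZero t}} where

    private
      0<t : 0 ℕ.< t
      0<t = ℕ.n≢0⇒n>0 (ℕ.≢-nonZero⁻¹ t)

      shift : Core t → ℕ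
      shift κ = length (parts (partition κ)) ℕ.+ half t

      -- Positive parts keep 0 out of `betas`. This fixes the position of the gap set, which the
      -- coding records only up to translation.
      0∈gaps : ∀ (κ : Core t) → 0 ∈ core-gaps κ
      0∈gaps κ = ∈-gaps⁺ (λ 0∈ → ℕ.<-irrefl refl (All.lookup (betas-positive (positive (partition κ))) 0∈))
                         (∈-++⁺ˡ (∈-upTo⁺ 0<t))

    same-offsets : ∀ (κ κ′ : Core t) → entries (coding κ) ≡ entries (coding κ′) →
                   ∀ i → + gap κ i - + shift κ ≡ + gap κ′ i - + shift κ′
    same-offsets κ κ′ eq i = trans (sym (offset-coding κ i))
      (trans (cong (λ es → offset (lookup es i)) eq) (offset-coding κ′ i))

    -- Both gap sets contain 0 and lie in ℕ, so the shifts agree.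
    shift-≤ : ∀ (κ κ′ : Core t) → entries (coding κ) ≡ entries (coding κ′) → shift κ ℕ.≤ shift κ′
    shift-≤ κ κ′ eq with i , gap≡0 ← ∈-gap κ (0∈gaps κ) =
      ℕ.≤-trans (ℕ.m≤n+m (shift κ) (gap κ′ i)) (ℕ.≤-reflexive (ℤ.+-injective (begin
        + (gap κ′ i ℕ.+ shift κ)                                ≡⟨ ℤ.pos-+ (gap κ′ i) (shift κ) ⟩
        + gap κ′ i + + shift κ
          ≡⟨ rearrange (+ gap κ′ i) (+ shift κ) (+ shift κ′) ⟩
        (+ gap κ′ i - + shift κ′) + (+ shift κ + + shift κ′)
          ≡⟨ cong (_+ (+ shift κ + + shift κ′)) (same-offsets κ κ′ eq i) ⟨
        (+ gap κ i - + shift κ) + (+ shift κ + + shift κ′)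
          ≡⟨ cong (λ g → (+ g - + shift κ) + (+ shift κ + + shift κ′)) gap≡0 ⟩
        (+ 0 - + shift κ) + (+ shift κ + + shift κ′)            ≡⟨ collapse (+ shift κ) (+ shift κ′) ⟩
        + shift κ′                                              ∎)))
      where
      open ≡-Reasoning
      rearrange : ∀ g s s′ → g + s ≡ (g - s′) + (s + s′)
      rearrange = solve-∀
      collapse : ∀ s s′ → (+ 0 - s) + (s + s′) ≡ s′
      collapse = solve-∀

    coding-injective : ∀ (κ κ′ : Core t) → entries (coding κ) ≡ entries (coding κ′) →
                       parts (partition κ) ≡ parts (partition κ′)
    coding-injective κ κ′ eq = betas-injective (decreasing-ext (betas↓ κ) (betas↓ κ′)
      (tail-closed-ext 0<t (core-closed κ) (subst (_ ∈_) (sym gaps≡)) _)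
      (tail-closed-ext 0<t (core-closed κ′) (subst (_ ∈_) gaps≡) _))
      where
      same-shift : shift κ ≡ shift κ′
      same-shift = ℕ.≤-antisym (shift-≤ κ κ′ eq) (shift-≤ κ′ κ (sym eq))
      same-gap : ∀ i → gap κ i ≡ gap κ′ i
      same-gap i = ℤ.+-injective (∙-cancelʳ (- + shift κ) _ _
        (trans (same-offsets κ κ′ eq i) (cong (λ s → + gap κ′ i - + s) (sym same-shift))))
      gaps≡ : core-gaps κ ≡ core-gaps κ′
      gaps≡ = trans (sym (map-gap κ)) (trans (map-cong same-gap (allFin t)) (map-gap κ′))

  -- Surjectivity

  module _ {n : ℕ} (V : Coding (suc n)) where

    private
      t = suc n
      v = lookup (entries V)
      o : Fin t → ℤ
      o i = offset (v i)
      oₗ : ℤ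
      oₗ = o (fromℕ n)

      o-decreasing : ∀ {i j} → i Fin.< j → o j ℤ.< o i
      o-decreasing {i} {j} i<j = fromℤ-cancel-< (+-cancelˡ-< (t₀ t) (strictly V i<j))
        where
        +-cancelˡ-< : ∀ r {p q} → r ℚ.+ p ℚ.< r ℚ.+ q → p ℚ.< q
        +-cancelˡ-< r {p} {q} lt = subst (ℚ._< q) (back r p) (subst (_ ℚ.<_) (back r q) (ℚ.+-monoʳ-< (ℚ.- r) lt))
          where
          back : ∀ r p → ℚ.- r ℚ.+ (r ℚ.+ p) ≡ p
          back r p = trans (sym (ℚ.+-assoc (ℚ.- r) r p)) (trans (cong (ℚ._+ p) (ℚ.+-inverseˡ r)) (ℚ.+-identityˡ p))

      oₗ≤o : ∀ i → oₗ ℤ.≤ o i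
      oₗ≤o i with Fin.<-cmp i (fromℕ n)
      ... | tri< i<l _ _  = ℤ.<⇒≤ (o-decreasing i<l)
      ... | tri≈ _ refl _ = ℤ.≤-refl
      ... | tri> _ _ l<i  = contradiction (Fin.≤fromℕ i) (ℕ.<⇒≱ l<i)

      -- The intended gaps: the offsets moved so that the last, which is the least, becomes 0, as
      -- `0∈gaps` demands.
      g : Fin t → ℕ
      g i = ℤ.∣ o i - oₗ ∣

      +g : ∀ i → + g i ≡ o i - oₗ
      +g i = ℤ.0≤i⇒+∣i∣≡i (ℤ.i≤j⇒0≤j-i (oₗ≤o i))

      g-decreasing : ∀ {i j} → i Fin.< j → g j ℕ.< g i
      g-decreasing {i} {j} i<j = ℤ.drop‿+<+ (subst (ℤ._< + g i) (sym (+g j)) (subst (o j - oₗ ℤ.<_) (sym (+g i))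
        (ℤ.+-monoˡ-< (- oₗ) (o-decreasing i<j))))

      gs : List ℕ
      gs = tabulate g

      gs↓ : Decreasing gs
      gs↓ = AllPairs.tabulate⁺-< g-decreasing

      -- The index of the intended gap congruent to y modulo t.
      class : ℕ → Fin t
      class y = proj₁ (classes V (fromℕ< (n%ℕd<d (+ y + oₗ) t)))

      offset-congruence : ∀ i y → ∃[ q ] + g i - + y ≡ (o i - + toℕ (fromℕ< (n%ℕd<d (+ y + oₗ) t))) - q * + t
      offset-congruence i y = q , (begin
        + g i - + y                                          ≡⟨ cong (_- + y) (+g i) ⟩
        (o i - oₗ) - + y                                     ≡⟨ regroup₁ (o i) oₗ (+ y) ⟩
        o i - (+ y + oₗ)
          ≡⟨ cong (λ z → o i - z) (a≡a%ℕn+[a/ℕn]*n (+ y + oₗ) t) ⟩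
        o i - (+ ((+ y + oₗ) %ℕ t) + q * + t)                ≡⟨ regroup₂ (o i) (+ ((+ y + oₗ) %ℕ t)) (q * + t) ⟩
        (o i - + ((+ y + oₗ) %ℕ t)) - q * + t
          ≡⟨ cong (λ k → (o i - + k) - q * + t) (Fin.toℕ-fromℕ< (n%ℕd<d (+ y + oₗ) t)) ⟨
        (o i - + toℕ (fromℕ< (n%ℕd<d (+ y + oₗ) t))) - q * + t ∎)
        where
        open ≡-Reasoning
        q = (+ y + oₗ) /ℕ t
        regroup₁ : ∀ a b y → (a - b) - y ≡ a - (y + b)
        regroup₁ = solve-∀
        regroup₂ : ∀ a k z → a - (k + z) ≡ (a - k) - z
        regroup₂ = solve-∀

      class-∣ : ∀ y → + t Signed.∣ + g (class y) - + y
      class-∣ y with q , eq ← offset-congruence (class y) y = subst (+ t Signed.∣_) (sym eq)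
        (Signed.∣m∣n⇒∣m-n (Signed.∣ᵤ⇒∣ {+ t} {o (class y) - _} (proj₁ (proj₂ (classes V (fromℕ< (n%ℕd<d (+ y + oₗ) t))))))
          (Signed.∣n⇒∣m*n q Signed.∣-refl))

      class-unique : ∀ {i y} → + t Signed.∣ + g i - + y → class y ≡ i
      class-unique {i} {y} t∣ with q , eq ← offset-congruence i y =
        proj₂ (proj₂ (classes V (fromℕ< (n%ℕd<d (+ y + oₗ) t)))) (Signed.∣⇒∣ᵤ {+ t} {o i - _}
          (subst (+ t Signed.∣_) (trans (cong (_+ q * + t) eq) (undo (o i - _) (q * + t)))
            (Signed.∣m∣n⇒∣m+n t∣ (Signed.∣n⇒∣m*n q Signed.∣-refl))))
        where
        undo : ∀ a b → a - b + b ≡ a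
        undo = solve-∀

      -- The intended first free position on the runner of y.
      rep : ℕ → ℕ
      rep y = g (class y)

      rep-g : ∀ i → rep (g i) ≡ g i
      rep-g i = cong g (class-unique (subst (+ t Signed.∣_) (sym (ℤ.+-inverseʳ (+ g i))) (Signed.divides 0ℤ refl)))

      rep-cong : ∀ {x y} → + t Signed.∣ + x - + y → rep x ≡ rep y
      rep-cong {x} {y} t∣ = cong g (sym (class-unique (subst (+ t Signed.∣_) (join (+ rep x) (+ x) (+ y))
        (Signed.∣m∣n⇒∣m+n (class-∣ x) t∣))))
        where
        join : ∀ r x y → (r - x) + (x - y) ≡ r - y
        join = solve-∀

      rep-+ : ∀ y → rep (t ℕ.+ y) ≡ rep y
      rep-+ y = rep-cong (Signed.divides (+ 1) (trans (cong (_- + y) (ℤ.pos-+ t y)) (simplify (+ t) (+ y))))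
        where
        simplify : ∀ t y → (t + y) - y ≡ + 1 * t
        simplify = solve-∀

      rep-0 : rep 0 ≡ 0
      rep-0 = trans (cong rep (sym g-last)) (trans (rep-g (fromℕ n)) g-last)
        where
        g-last : g (fromℕ n) ≡ 0
        g-last = cong ℤ.∣_∣ (ℤ.+-inverseʳ oₗ)

      rep-near : ∀ {y} → rep y ℕ.≤ y → y ℕ.< t ℕ.+ rep y → y ≡ rep y
      rep-near {y} r≤y y<t+r = ℕ.≤-antisym (ℕ.m∸n≡0⇒m≤n (small (y ∸ rep y) y-r<t t∣)) r≤y
        where
        y-r<t : y ∸ rep y ℕ.< t
        y-r<t = ℕ.+-cancelʳ-< (rep y) _ _ (subst (ℕ._< t ℕ.+ rep y) (sym (ℕ.m∸n+n≡m r≤y)) y<t+r)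
        t∣ : t ∣ y ∸ rep y
        t∣ = subst (t ∣_) (trans (cong ℤ.∣_∣ (ℤ.m-n≡m⊖n (rep y) y)) (ℤ.∣⊖∣-≤ r≤y)) (Signed.∣⇒∣ᵤ (class-∣ y))
        small : ∀ z → z ℕ.< t → t ∣ z → z ≡ 0
        small zero    _   _   = refl
        small (suc z) z<t t∣z = contradiction (∣⇒≤ t∣z) (ℕ.<⇒≱ z<t)

      -- The beads: on each runner, all positions before its free position `rep y`. As `rep y` is in
      -- `gs`, the bound `max 0 gs` loses none.
      xs : List ℕ
      xs = filter (λ y → y ℕ.<? rep y) (downFrom (max 0 gs))

      ∈-xs⁺ : ∀ {y} → y ℕ.< rep y → y ∈ xs
      ∈-xs⁺ {y} y<r = ∈-filter⁺ (λ y → y ℕ.<? rep y)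
        (∈-downFrom⁺ (ℕ.<-≤-trans y<r (All.lookup (xs≤max 0 gs) (∈-tabulate⁺ {f = g} (class y))))) y<r

      ∈-xs⁻ : ∀ {y} → y ∈ xs → y ℕ.< rep y
      ∈-xs⁻ y∈ = proj₂ (∈-filter⁻ (λ y → y ℕ.<? rep y) {xs = downFrom (max 0 gs)} y∈)

      xs↓ : Decreasing xs
      xs↓ = AllPairs.filter⁺ (λ y → y ℕ.<? rep y) (AllPairs.applyDownFrom⁺₁ id (max 0 gs) (λ j<i _ → j<i))

      xs> : All (_> 0) xs
      xs> = All.tabulate λ y∈ → ℕ.n≢0⇒n>0 λ { refl → ℕ.<-irrefl (sym rep-0) (∈-xs⁻ y∈) }

      -- A gap y is not a bead, so rep y ≤ y; it is below t or t above a bead, so y < t + rep y.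
      -- Being congruent, y and rep y are equal. Conversely, the position t before a `rep y`, if
      -- there is one, is a bead.
      gaps≡gs : gaps t xs ≡ gs
      gaps≡gs = decreasing-ext (gaps-decreasing t xs) gs↓
        (λ {y} y∈ → subst (_∈ gs) (sym (gap⇒rep y∈)) (∈-tabulate⁺ {f = g} (class y)))
        (λ y∈ → let i , eq = ∈-tabulate⁻ {f = g} y∈ in rep⇒gap (trans eq (trans (sym (rep-g i)) (cong rep (sym eq)))))
        where
        gap⇒rep : ∀ {y} → y ∈ gaps t xs → y ≡ rep y
        gap⇒rep {y} y∈ with y∉ , y∈tr ← ∈-gaps⁻ {t} y∈ = rep-near (ℕ.≮⇒≥ (y∉ ∘ ∈-xs⁺)) (near (∈-++⁻ (upTo t) y∈tr))
          where
          near : y ∈ upTo t ⊎ y ∈ map (t ℕ.+_) xs → y ℕ.< t ℕ.+ rep y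
          near (inj₁ y∈upTo) = ℕ.<-≤-trans (∈-upTo⁻ y∈upTo) (ℕ.m≤m+n t (rep y))
          near (inj₂ y∈map) with x , x∈ , refl ← ∈-map⁻ (t ℕ.+_) y∈map =
            ℕ.+-monoʳ-< t (subst (x ℕ.<_) (sym (rep-+ x)) (∈-xs⁻ x∈))
        rep⇒gap : ∀ {y} → y ≡ rep y → y ∈ gaps t xs
        rep⇒gap {y} y≡r = ∈-gaps⁺ (λ y∈ → ℕ.<-irrefl y≡r (∈-xs⁻ y∈)) (split (y ℕ.<? t))
          where
          split : Dec (y ℕ.< t) → y ∈ translate t xs
          split (yes y<t) = ∈-++⁺ˡ (∈-upTo⁺ y<t)
          split (no  y≮t) = subst (_∈ translate t xs) (ℕ.m+[n∸m]≡n t≤y) (∈-translate⁺ (∈-xs⁺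
            (subst (y ∸ t ℕ.<_) (trans y≡r (trans (cong rep (sym (ℕ.m+[n∸m]≡n t≤y))) (rep-+ (y ∸ t))))
              (ℕ.∸-monoʳ-< {o = 0} (s≤s z≤n) t≤y))))
            where t≤y = ℕ.≮⇒≥ y≮t

      μ : Partition
      μ = mkPartition (unbetas xs) (unbetas-decreasing xs↓) (unbetas-positive xs↓ xs>)

    preimage : Core t
    preimage = mkCore μ (All.tabulate λ {h} h∈ → not-core (subst (h ∈_) (hookLengths≡ μ) h∈))
      where
      -- If t divides x - y, then x and y share a runner, and y < x < rep x = rep y makes y a bead.
      not-core : ∀ {h} → h ∈ hookList (unbetas xs) → ¬ t ∣ h
      not-core h∈ t∣h with x , y , x∈ , y∉ , y<x , refl ← ∈-hookList⁻ (parts-decreasing μ) h∈ =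
        y∉ (subst (y ∈_) (sym (betas-unbetas xs↓ xs>)) (∈-xs⁺ (subst (y ℕ.<_) rep≡
          (ℕ.<-trans y<x (∈-xs⁻ (subst (x ∈_) (betas-unbetas xs↓ xs>) x∈))))))
        where
        rep≡ : rep x ≡ rep y
        rep≡ = rep-cong (Signed.∣ᵤ⇒∣ {+ t} {+ x - + y} (subst (t ∣_)
          (sym (cong ℤ.∣_∣ (trans (ℤ.m-n≡m⊖n x y) (ℤ.⊖-≥ (ℕ.<⇒≤ y<x))))) t∣h))

    private
      s = length (unbetas xs) ℕ.+ half t

      gap-preimage : ∀ i → gap preimage i ≡ g i
      gap-preimage i = trans (cong (λ l → row (gaps t l) (toℕ i)) (betas-unbetas xs↓ xs>))
        (trans (cong (λ l → row l (toℕ i)) gaps≡gs) (row-tabulate g i))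

      d : ℤ
      d = - oₗ - + s

      offset-preimage : ∀ i → offset (lookup (entries (coding preimage)) i) ≡ o i + d
      offset-preimage i = trans (offset-coding preimage i)
        (trans (cong (λ y → + y - + s) (gap-preimage i)) (trans (cong (_- + s) (+g i)) (ℤ.+-assoc (o i) (- oₗ) (- + s))))

      -- Both vectors of offsets have the same sum, so their constant difference d vanishes.
      d≡0 : d ≡ 0ℤ
      d≡0 = [ (λ ()) , id ]′ (ℤ.i*j≡0⇒i≡0∨j≡0 (+ 2 * + t) (begin
        (+ 2 * + t) * d
          ≡⟨ difference (+ t * parity t) (∑offsets v) (+ t) d ⟩
        (+ t * parity t + ((∑offsets v + + t * d) + (∑offsets v + + t * d))) - (+ t * parity t + (∑offsets v + ∑offsets v))
          ≡⟨ cong (λ z → (+ t * parity t + (z + z)) - (+ t * parity t + (∑offsets v + ∑offsets v))) total ⟨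
        (+ t * parity t + (∑offsets v′ + ∑offsets v′)) - (+ t * parity t + (∑offsets v + ∑offsets v))
          ≡⟨ cong₂ _-_ (coding-balanced preimage) (sum≡0⇒balanced v (sum≡0 V)) ⟩
        0ℤ ∎))
        where
        open ≡-Reasoning
        v′ = lookup (entries (coding preimage))
        total : ∑offsets v′ ≡ ∑offsets v + + t * d
        total = trans (∑-cong (allFin t) offset-preimage) (trans (∑-+ o (λ _ → d) (allFin t))
          (cong (λ z → ∑offsets v + z) (trans (∑-const d (allFin t)) (cong (λ k → + k * d) (length-tabulate {n = t} id)))))
        difference : ∀ e s t d → (+ 2 * t) * d ≡ (e + ((s + t * d) + (s + t * d))) - (e + (s + s))
        difference = solve-∀

    coding-preimage : entries (coding preimage) ≡ entries V
    coding-preimage = trans (sym (tabulate∘lookup _)) (trans (tabulate-cong λ i → cong t₀+_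
      (trans (offset-preimage i) (trans (cong (λ z → o i + z) d≡0) (ℤ.+-identityʳ (o i))))) (tabulate∘lookup _))

  coding-surjective : ∀ {t} .{{_ : NonZero t}} (V : Coding t) → ∃[ κ ] entries (coding κ) ≡ entries V
  coding-surjective {suc n} V = preimage V , coding-preimage V

  codingBijection : ∀ t .{{_ : NonZero t}} → Bijection (Cores t) (Codings t)
  codingBijection t = record
    { to        = coding
    -- `codingEntries` takes only the parts, which are all that equality in `Cores t` compares.
    ; cong      = cong (codingEntries t)
    ; bijective = (λ {κ} {κ′} → coding-injective κ κ′) , λ V →
        let κ , eq = coding-surjective V in κ , λ same-parts → trans (cong (codingEntries t) same-parts) eq
    }

  -- The factors of the product formula

  ∑-cong-All : ∀ {f g : A → ℤ} {xs} → All (λ x → f x ≡ g x) xs → ∑ xs f ≡ ∑ xs g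
  ∑-cong-All []        = refl
  ∑-cong-All (eq ∷ eqs) = cong₂ _+_ eq (∑-cong-All eqs)

  ∑-replicate : ∀ (f : A → ℤ) n x → ∑ (replicate n x) f ≡ + n * f x
  ∑-replicate f zero    x = refl
  ∑-replicate f (suc n) x = trans (cong (λ s → f x + s) (∑-replicate f n x)) (sym (ℤ.suc-* (+ n) (f x)))

  ∑-filter : ∀ {P : A → Set} (P? : Decidable P) (f : A → ℤ) xs →
             ∑ (filter P? xs) f ≡ ∑ xs (λ x → if does (P? x) then f x else 0ℤ)
  ∑-filter P? f []       = refl
  ∑-filter P? f (x ∷ xs) with does (P? x)
  ... | true  = cong (λ s → f x + s) (∑-filter P? f xs)
  ... | false = trans (∑-filter P? f xs) (sym (ℤ.+-identityˡ _))

  ∑-cartesianProduct : ∀ (f : A × B → ℤ) xs ys → ∑ (cartesianProduct xs ys) f ≡ ∑ xs (λ x → ∑ ys (λ y → f (x , y)))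
  ∑-cartesianProduct f []       ys = refl
  ∑-cartesianProduct f (x ∷ xs) ys =
    trans (∑-++ (map (x ,_) ys) _) (cong₂ _+_ (∑-map (x ,_) ys) (∑-cartesianProduct f xs ys))

  length-hookList : ∀ ls → length (hookList ls) ≡ sum ls
  length-hookList []       = refl
  length-hookList (l ∷ ls) =
    trans (length-++ (firstRow l ls)) (cong₂ ℕ._+_ (length-applyUpTo _ l) (length-hookList ls))

  length-hookLengths : ∀ μ → length (hookLengths μ) ≡ size μ
  length-hookLengths μ = trans (cong length (hookLengths≡ μ)) (length-hookList (parts μ))

  [_≟_] : ℕ → ℕ → ℤ
  [ m ≟ n ] = if does (m ℕ.≟ n) then + 1 else 0ℤ

  -- Only i = t - suc h contributes, and it is in range exactly when suc h < t. The successor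
  -- matters: at hook length 0 the right side would be `c t`.
  ∑-reflect : ∀ (c : ℕ → ℤ) t h → ∑ [1⋯ t -1] (λ i → [ suc h ≟ t ∸ i ] * c i) ≡ Δ c t (suc h)
  ∑-reflect c t h′ = trans (∑-applyUpTo suc (t ∸ 1) _) (go c t)
    where
    open ≡-Reasoning
    h = suc h′
    go : ∀ c t → ∑ (upTo (t ∸ 1)) (λ k → [ h ≟ t ∸ suc k ] * c (suc k)) ≡ Δ c t h
    go c zero          = refl
    go c (suc zero)    = refl
    go c (suc t@(suc s)) = trans (∑-upTo-suc s (λ k → [ h ≟ t ∸ k ] * c (suc k)))
      (trans (cong (λ x → [ h ≟ t ] * c 1 + x) (go (c ∘ suc) t)) (first (ℕ.<-cmp h t)))
      where
      first : _ → [ h ≟ t ] * c 1 + Δ (c ∘ suc) t h ≡ Δ c (suc t) h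
      first (tri≈ _ refl _) =
        trans (cong₂ (λ b x → (if b then + 1 else 0ℤ) * c 1 + x) (dec-true (h ℕ.≟ h) refl) (Δ-≤ (c ∘ suc) (ℕ.≤-refl {h})))
        (trans (trans (ℤ.+-identityʳ _) (ℤ.*-identityˡ (c 1))) (sym (trans (Δ-> c (ℕ.n<1+n h)) (cong c (ℕ.m+n∸n≡m 1 h)))))
      first (tri< h<t h≢t _) =
        trans (cong₂ (λ b x → (if b then + 1 else 0ℤ) * c 1 + x) (dec-false (h ℕ.≟ t) h≢t) (Δ-> (c ∘ suc) h<t))
        (trans (ℤ.+-identityˡ _) (sym (trans (Δ-> c (ℕ.m<n⇒m<1+n h<t)) (cong c (ℕ.+-∸-assoc 1 (ℕ.<⇒≤ h<t))))))
      first (tri> _ h≢t t<h) =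
        trans (cong₂ (λ b x → (if b then + 1 else 0ℤ) * c 1 + x) (dec-false (h ℕ.≟ t) h≢t) (Δ-≤ (c ∘ suc) (ℕ.<⇒≤ t<h)))
        (sym (Δ-≤ c t<h))

  -- Exchange the sums over i and over boxes: a box of hook length h < t is counted by β_i for i = t
  -- - h alone. The exponents thus turn into the truncated values c(t - h) that occur in `D₂`.
  ∑-β : ∀ t μ (c : ℕ → ℤ) → ∑ [1⋯ t -1] (λ i → + β t μ i * c i) ≡ ∑ (hookLengths μ) (Δ c t)
  ∑-β t μ c = begin
    ∑ [1⋯ t -1] (λ i → + β t μ i * c i)
      ≡⟨ ∑-cong [1⋯ t -1] (λ i → trans (cong (_* c i) (count i)) (sym (∑-*ʳ (c i) _ (boxes μ)))) ⟩
    ∑ [1⋯ t -1] (λ i → ∑ (boxes μ) (λ b → [ hook μ b ≟ t ∸ i ] * c i))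
      ≡⟨ ∑-swap (λ i b → [ hook μ b ≟ t ∸ i ] * c i) [1⋯ t -1] (boxes μ) ⟩
    ∑ (boxes μ) (λ b → ∑ [1⋯ t -1] (λ i → [ hook μ b ≟ t ∸ i ] * c i))
      ≡⟨ ∑-cong (boxes μ) (λ b → ∑-reflect c t (arm μ b ℕ.+ leg μ b)) ⟩
    ∑ (boxes μ) (λ b → Δ c t (hook μ b))
      ≡⟨ ∑-map (hook μ) (boxes μ) ⟨
    ∑ (hookLengths μ) (Δ c t) ∎
    where
    open ≡-Reasoning
    count : ∀ i → + β t μ i ≡ ∑ (boxes μ) (λ b → [ hook μ b ≟ t ∸ i ])
    count i =
      trans (sym (trans (∑-const (+ 1) (filter P? (boxes μ))) (ℤ.*-identityʳ _))) (∑-filter P? (λ _ → + 1) (boxes μ))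
      where P? = λ b → hook μ b ℕ.≟ t ∸ i

  -- According to the sign of h - t, one truncated term gives the value and the other vanishes. At h
  -- = t both would vanish, while the left side would be f 0; in a core this does not occur.
  Δ-ℤ : ∀ (f : ℤ → ℤ) {h t} → h ≢ t → f (+ h - + t) ≡ Δ (f ∘ +_) h t + Δ (λ n → f (- + n)) t h
  Δ-ℤ f {h} {t} h≢t with ℕ.<-cmp h t
  ... | tri≈ _ h≡t _ = contradiction h≡t h≢t
  ... | tri< h<t _ _ = sym (trans (cong₂ _+_ (Δ-≤ _ (ℕ.<⇒≤ h<t)) (Δ-> _ h<t)) (trans (ℤ.+-identityˡ _)
    (cong f (sym (trans (ℤ.m-n≡m⊖n h t) (ℤ.⊖-< h<t))))))
  ... | tri> _ _ t<h = sym (trans (cong₂ _+_ (Δ-> _ t<h) (Δ-≤ _ (ℕ.<⇒≤ t<h))) (trans (ℤ.+-identityʳ _)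
    (cong f (sym (trans (ℤ.m-n≡m⊖n h t) (ℤ.⊖-≥ (ℕ.<⇒≤ t<h)))))))

  module _ {t : ℕ} .{{_ : NonZero t}} (κ : Core t) where

    private
      μ = partition κ
      H = hookLengths μ
      gs = core-gaps κ
      v = lookup (entries (coding κ))
      open ≡-Reasoning

    core-identity : ∀ f → ∑ H (D₂ f t) + ∑ [1⋯ t -1] (λ i → + (t ∸ i) * f i) ≡ ∑ H (λ h → f h + f h) + ⟪ f ⟫ gs gs
    core-identity = hook-identity t {H = H} (betas↓ κ) (gaps-↭ (betas↓ κ) (core-closed κ))
      (λ g → trans (cong (λ H → ∑ H g + ⟪ g ⟫ (betas (parts μ)) (betas (parts μ))) (hookLengths≡ μ))
                   (hookList-∑ (parts-decreasing μ) g))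

    diff-coding : ∀ i j → diff (v i) (v j) ≡ + gap κ i - + gap κ j
    diff-coding i j =
      trans (cong₂ _-_ (offset-coding κ i) (offset-coding κ j)) (cancel (+ gap κ i) (+ gap κ j) (+ (length (parts μ) ℕ.+ half t)))
      where
      cancel : ∀ a b s → (a - s) - (b - s) ≡ a - b
      cancel = solve-∀

    -- `gap` reverses the order, so the pairs i < j are those with a positive difference, and `Δ` is
    -- 0 on all others.
    ∑-increasingPairs : ∀ (f : ℤ → ℤ) → ∑ (increasingPairs t) (λ (i , j) → f (diff (v i) (v j))) ≡ ⟪ f ∘ +_ ⟫ gs gs
    ∑-increasingPairs f = begin
      ∑ (increasingPairs t) (λ (i , j) → f (diff (v i) (v j)))
        ≡⟨ ∑-filter (λ (i , j) → i Fin.<? j) (λ (i , j) → f (diff (v i) (v j))) (cartesianProduct (allFin t) (allFin t)) ⟩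
      ∑ (cartesianProduct (allFin t) (allFin t)) (λ (i , j) → if does (i Fin.<? j) then f (diff (v i) (v j)) else 0ℤ)
        ≡⟨ ∑-cartesianProduct _ (allFin t) (allFin t) ⟩
      ∑ (allFin t) (λ i → ∑ (allFin t) (λ j → if does (i Fin.<? j) then f (diff (v i) (v j)) else 0ℤ))
        ≡⟨ ∑-cong (allFin t) (λ i → ∑-cong (allFin t) (λ j → ordered i j (Fin.<-cmp i j))) ⟩
      ∑ (allFin t) (λ i → ∑ (allFin t) (λ j → Δ (f ∘ +_) (gap κ i) (gap κ j)))
        ≡⟨ ∑-cong (allFin t) (λ i → trans (sym (∑-map (gap κ) (allFin t))) (cong (λ l → ∑ l (Δ (f ∘ +_) (gap κ i))) (map-gap κ))) ⟩
      ∑ (allFin t) (λ i → ∑ gs (Δ (f ∘ +_) (gap κ i)))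
        ≡⟨ trans (sym (∑-map (gap κ) (allFin t))) (cong (λ l → ∑ l (λ a → ∑ gs (Δ (f ∘ +_) a))) (map-gap κ)) ⟩
      ⟪ f ∘ +_ ⟫ gs gs ∎
      where
      ordered : ∀ i j → _ → (if does (i Fin.<? j) then f (diff (v i) (v j)) else 0ℤ) ≡ Δ (f ∘ +_) (gap κ i) (gap κ j)
      ordered i j (tri< i<j _ _) =
        trans (cong (λ b → if b then f (diff (v i) (v j)) else 0ℤ) (dec-true (i Fin.<? j) i<j))
        (trans (cong f (trans (diff-coding i j) (trans (ℤ.m-n≡m⊖n (gap κ i) (gap κ j)) (ℤ.⊖-≥ (ℕ.<⇒≤ (gap-decreasing κ i<j))))))
          (sym (Δ-> (f ∘ +_) (gap-decreasing κ i<j))))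
      ordered i j (tri≈ i≮j refl _) =
        trans (cong (λ b → if b then f (diff (v i) (v j)) else 0ℤ) (dec-false (i Fin.<? j) i≮j))
        (sym (Δ-≤ (f ∘ +_) (ℕ.≤-refl {gap κ i})))
      ordered i j (tri> i≮j _ j<i) =
        trans (cong (λ b → if b then f (diff (v i) (v j)) else 0ℤ) (dec-false (i Fin.<? j) i≮j))
        (sym (Δ-≤ (f ∘ +_) (ℕ.<⇒≤ (gap-decreasing κ j<i))))

    -- The arguments of `τ` on the two sides, with multiplicity, after all denominators are cleared.
    numerators denominators : List ℤ
    numerators = concatMap (λ h → (+ h - + t) ∷ (+ h + + t) ∷ []) H
              ++ concatMap (λ i → replicate (β t μ i ℕ.+ (t ∸ i)) (+ i)) [1⋯ t -1]
    denominators = concatMap (λ h → + h ∷ + h ∷ []) H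
                ++ (concatMap (λ i → replicate (β t μ i) (- + i)) [1⋯ t -1]
                ++ map (λ (i , j) → diff (v i) (v j)) (increasingPairs t))

    -- The negative arguments h - t, for h < t, match those of τ(-i) with exponent β_i. On positive
    -- arguments the τ(i) with exponent β_i supply the term f(t - h) of `D₂`, and `core-identity`
    -- applies.
    multiset-identity : numerators ↭ denominators
    multiset-identity = ∑-≗⇒↭ ℤ._≟_ numerators denominators λ f → begin
      ∑ numerators f
        ≡⟨ trans (∑-++ (concatMap _ H) _) (cong₂ _+_ (∑-concatMap _ H) (trans (∑-concatMap _ [1⋯ t -1])
             (∑-cong [1⋯ t -1] (λ i → trans (∑-replicate f (β t μ i ℕ.+ (t ∸ i)) (+ i)) (split (β t μ i) (t ∸ i) (f (+ i))))))) ⟩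
      ∑ H (λ h → f (+ h - + t) + (f (+ h + + t) + 0ℤ)) + ∑ [1⋯ t -1] (λ i → + β t μ i * f (+ i) + + (t ∸ i) * f (+ i))
        ≡⟨ cong₂ _+_ (trans (∑-+ _ _ H) (cong₂ _+_ (trans (∑-cong-All (near f)) (∑-+ _ _ H)) (∑-cong H (far f))))
             (trans (∑-+ _ _ [1⋯ t -1]) (cong (_+ w f) (∑-β t μ (f ∘ +_)))) ⟩
      ((∑ H (λ h → Δ (f ∘ +_) h t) + ∑ H (Δ (λ n → f (- + n)) t)) + ∑ H (λ h → f (+ (t ℕ.+ h)))) + (∑ H (Δ (f ∘ +_) t) + w f)
        ≡⟨ regroup (∑ H (λ h → Δ (f ∘ +_) h t)) _ _ _ (w f) ⟩
      (∑ H (λ h → f (+ (t ℕ.+ h))) + ∑ H (λ h → Δ (f ∘ +_) h t) + ∑ H (Δ (f ∘ +_) t) + w f) + ∑ H (Δ (λ n → f (- + n)) t)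
        ≡⟨ cong (λ s → s + w f + ∑ H (Δ (λ n → f (- + n)) t))
             (trans (∑-+ (λ h → f (+ (t ℕ.+ h)) + Δ (f ∘ +_) h t) (Δ (f ∘ +_) t) H)
               (cong (_+ ∑ H (Δ (f ∘ +_) t)) (∑-+ (λ h → f (+ (t ℕ.+ h))) (λ h → Δ (f ∘ +_) h t) H))) ⟨
      (∑ H (D₂ (f ∘ +_) t) + w f) + ∑ H (Δ (λ n → f (- + n)) t)
        ≡⟨ cong₂ _+_ (core-identity (f ∘ +_)) (sym (∑-β t μ (λ n → f (- + n)))) ⟩
      (∑ H (λ h → f (+ h) + f (+ h)) + ⟪ f ∘ +_ ⟫ gs gs) + ∑ [1⋯ t -1] (λ i → + β t μ i * f (- + i))
        ≡⟨ trans (ℤ.+-assoc (∑ H (λ h → f (+ h) + f (+ h))) _ _)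
             (cong (λ s → ∑ H (λ h → f (+ h) + f (+ h)) + s) (ℤ.+-comm (⟪ f ∘ +_ ⟫ gs gs) _)) ⟩
      ∑ H (λ h → f (+ h) + f (+ h)) + (∑ [1⋯ t -1] (λ i → + β t μ i * f (- + i)) + ⟪ f ∘ +_ ⟫ gs gs)
        ≡⟨ cong₂ _+_ (∑-cong H (λ h → cong (λ s → f (+ h) + s) (sym (ℤ.+-identityʳ (f (+ h))))))
             (cong₂ _+_ (∑-cong [1⋯ t -1] (λ i → sym (∑-replicate f (β t μ i) (- + i))))
               (trans (sym (∑-increasingPairs f)) (sym (∑-map _ (increasingPairs t))))) ⟩
      ∑ H (λ h → f (+ h) + (f (+ h) + 0ℤ)) + (∑ [1⋯ t -1] (λ i → ∑ (replicate (β t μ i) (- + i)) f)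
        + ∑ (map (λ (i , j) → diff (v i) (v j)) (increasingPairs t)) f)
        ≡⟨ trans (∑-++ (concatMap _ H) _) (cong₂ _+_ (∑-concatMap _ H)
             (trans (∑-++ (concatMap _ [1⋯ t -1]) _) (cong (_+ ∑ (map (λ (i , j) → diff (v i) (v j)) (increasingPairs t)) f)
               (∑-concatMap _ [1⋯ t -1])))) ⟨
      ∑ denominators f ∎
      where
      w : (ℤ → ℤ) → ℤ
      w f = ∑ [1⋯ t -1] (λ i → + (t ∸ i) * f (+ i))
      split : ∀ m n x → + (m ℕ.+ n) * x ≡ + m * x + + n * x
      split m n x = trans (cong (_* x) (ℤ.pos-+ m n)) (ℤ.*-distribʳ-+ x (+ m) (+ n))
      near : ∀ (f : ℤ → ℤ) → All (λ h → f (+ h - + t) ≡ Δ (f ∘ +_) h t + Δ (λ n → f (- + n)) t h) H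
      near f = All.map (λ {h} t∤h → Δ-ℤ f {h} {t} (λ { refl → t∤h ∣-refl })) (isCore κ)
      far : ∀ (f : ℤ → ℤ) h → f (+ h + + t) + 0ℤ ≡ f (+ (t ℕ.+ h))
      far f h = trans (ℤ.+-identityʳ _) (cong f (cong +_ (ℕ.+-comm h t)))
      regroup : ∀ a b c d e → ((a + b) + c) + (d + e) ≡ (c + a + d + e) + b
      regroup = solve-∀

  -- The formula for the size

  square : ℕ → ℤ
  square n = + n * + n

  Δ-square : ∀ a b → Δ square a b + Δ square b a ≡ (+ a - + b) * (+ a - + b)
  Δ-square zero    zero    = refl
  Δ-square zero    (suc b) = trans (ℤ.+-identityˡ _) (negate (+ suc b))
    where
    negate : ∀ x → x * x ≡ (+ 0 - x) * (+ 0 - x)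
    negate = solve-∀
  Δ-square (suc a) zero    = trans (ℤ.+-identityʳ _) (sym (cong (λ x → x * x) (ℤ.+-identityʳ (+ suc a))))
  Δ-square (suc a) (suc b) = trans (Δ-square a b) (sym (cong (λ x → x * x) (cancel (+ a) (+ b))))
    where
    cancel : ∀ a b → (+ 1 + a) - (+ 1 + b) ≡ a - b
    cancel = solve-∀

  -- Twice Lagrange's identity for the sum of all squared differences.
  ⟪square⟫ : ∀ as → let S = ∑ as (λ x → + x); Q = ∑ as square; n = + length as in
    ⟪ square ⟫ as as + ⟪ square ⟫ as as ≡ (n * Q - S * S) + (n * Q - S * S)
  ⟪square⟫ as = begin
    ⟪ square ⟫ as as + ⟪ square ⟫ as as
      ≡⟨ cong (λ x → ⟪ square ⟫ as as + x) (∑-swap (Δ square) as as) ⟩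
    ⟪ square ⟫ as as + ∑ as (λ a → ∑ as (λ b → Δ square b a))
      ≡⟨ ∑-+ _ _ as ⟨
    ∑ as (λ a → ∑ as (Δ square a) + ∑ as (λ b → Δ square b a))
      ≡⟨ ∑-cong as (λ a → trans (sym (∑-+ _ _ as)) (∑-cong as (λ b → trans (Δ-square a b) (expand (+ a) (+ b))))) ⟩
    ∑ as (λ a → ∑ as (λ b → (square a + - (+ 2 * + a) * + b) + square b))
      ≡⟨ ∑-cong as inner ⟩
    ∑ as (λ a → (n * square a + (- (+ 2) * S) * + a) + Q)
      ≡⟨ trans (∑-+ _ _ as) (cong₂ _+_ (trans (∑-+ _ _ as) (cong₂ _+_ (∑-*ˡ n square as) (∑-*ˡ (- (+ 2) * S) (λ x → + x) as))) (∑-const Q as)) ⟩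
    (n * Q + (- (+ 2) * S) * S) + n * Q
      ≡⟨ collect n Q S ⟩
    (n * Q - S * S) + (n * Q - S * S) ∎
    where
    open ≡-Reasoning
    n = + length as
    S = ∑ as (λ x → + x)
    Q = ∑ as square
    expand : ∀ a b → (a - b) * (a - b) ≡ (a * a + - (+ 2 * a) * b) + b * b
    expand = solve-∀
    twist : ∀ a s n q → (n * (a * a) + - (+ 2 * a) * s) + q ≡ (n * (a * a) + (- (+ 2) * s) * a) + q
    twist = solve-∀
    collect : ∀ n q s → (n * q + (- (+ 2) * s) * s) + n * q ≡ (n * q - s * s) + (n * q - s * s)
    collect = solve-∀
    inner : ∀ a → ∑ as (λ b → (square a + - (+ 2 * + a) * + b) + square b) ≡ (n * square a + (- (+ 2) * S) * + a) + Q
    inner a = trans (∑-+ _ _ as) (trans (cong (_+ Q) (trans (∑-+ _ _ as)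
      (cong₂ _+_ (∑-const (square a) as) (∑-*ˡ (- (+ 2 * + a)) (λ x → + x) as)))) (twist (+ a) S n Q))

  ∑-upTo-square : ∀ n → + 6 * ∑ (upTo n) square ≡ + n * (+ n - + 1) * (+ 2 * + n - + 1)
  ∑-upTo-square zero    = refl
  ∑-upTo-square (suc n) = begin
    + 6 * ∑ (upTo (suc n)) square
      ≡⟨ cong (λ x → + 6 * x) (∑-upTo-last n square) ⟩
    + 6 * (∑ (upTo n) square + + n * + n)
      ≡⟨ ℤ.*-distribˡ-+ (+ 6) (∑ (upTo n) square) (+ n * + n) ⟩
    + 6 * ∑ (upTo n) square + + 6 * (+ n * + n)
      ≡⟨ cong (_+ + 6 * (+ n * + n)) (∑-upTo-square n) ⟩
    + n * (+ n - + 1) * (+ 2 * + n - + 1) + + 6 * (+ n * + n)            ≡⟨ step (+ n) ⟩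
    (+ 1 + + n) * ((+ 1 + + n) - + 1) * (+ 2 * (+ 1 + + n) - + 1)        ∎
    where
    open ≡-Reasoning
    step : ∀ n → n * (n - + 1) * (+ 2 * n - + 1) + + 6 * (n * n) ≡ (+ 1 + n) * ((+ 1 + n) - + 1) * (+ 2 * (+ 1 + n) - + 1)
    step = solve-∀

  z/d*d≡z : ∀ z d .{{_ : NonZero d}} → (z ℚ./ d) ℚ.* fromℤ (+ d) ≡ fromℤ z
  z/d*d≡z z d@(suc _) = ℚ.toℚᵘ-injective (begin
    ℚ.toℚᵘ ((z ℚ./ d) ℚ.* fromℤ (+ d))                 ≈⟨ ℚ.toℚᵘ-homo-* (z ℚ./ d) (fromℤ (+ d)) ⟩
    ℚ.toℚᵘ (z ℚ./ d) ℚᵘ.* ℚ.toℚᵘ (fromℤ (+ d))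
      ≈⟨ ℚᵘ.*-cong (ℚ.toℚᵘ-fromℚᵘ (z ℚᵘ./ d)) (ℚ.toℚᵘ-fromℚᵘ (+ d ℚᵘ./ 1)) ⟩
    (z ℚᵘ./ d) ℚᵘ.* (+ d ℚᵘ./ 1)
      ≈⟨ ℚᵘ.*≡* (trans (ℤ.*-assoc z (+ d) (+ 1)) (cong (λ x → z * x)
        (trans (ℤ.*-identityʳ (+ d)) (cong +_ (sym (ℕ.*-identityʳ d)))))) ⟩
    z ℚᵘ./ 1                                           ≈⟨ ℚ.toℚᵘ-fromℚᵘ (z ℚᵘ./ 1) ⟨
    ℚ.toℚᵘ (fromℤ z)                                   ∎)
    where open ℚᵘ.≃-Reasoning

  fromℤ-neg : ∀ z → fromℤ (- z) ≡ ℚ.- fromℤ z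
  fromℤ-neg z = trans (solve 2 (λ a b → a := (a :+ b) :- b) refl (fromℤ (- z)) (fromℤ z))
    (trans (cong (ℚ._- fromℤ z) (trans (sym (fromℤ-+ (- z) z)) (cong fromℤ (ℤ.+-inverseˡ z)))) (ℚ.+-identityˡ _))

  fromℤ-homo-+ : ∀ {a b x y} → fromℤ a ≡ x → fromℤ b ≡ y → fromℤ (a + b) ≡ x ℚ.+ y
  fromℤ-homo-+ {a} {b} p q = trans (fromℤ-+ a b) (cong₂ ℚ._+_ p q)

  fromℤ-homo-sub : ∀ {a b x y} → fromℤ a ≡ x → fromℤ b ≡ y → fromℤ (a - b) ≡ x ℚ.- y
  fromℤ-homo-sub {a} {b} p q = trans (fromℤ-+ a (- b)) (cong₂ ℚ._+_ p (trans (fromℤ-neg b) (cong (ℚ.-_) q)))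

  fromℤ-homo-* : ∀ {a b x y} → fromℤ a ≡ x → fromℤ b ≡ y → fromℤ (a * b) ≡ x ℚ.* y
  fromℤ-homo-* {a} {b} p q = trans (fromℤ-* a b) (cong₂ ℚ._*_ p q)

  module _ {t : ℕ} .{{_ : NonZero t}} (κ : Core t) where

    private
      μ  = partition κ
      H  = hookLengths μ
      gs = core-gaps κ
      N  = + size μ
      S  = ∑ gs (λ x → + x)
      Q  = ∑ gs square
      s  = length (parts μ) ℕ.+ half t

    -- For f(n) = n² the parallelogram law gives `D₂ f t h` = 2h² + 2t², so the sums of h² cancel
    -- and the hook lengths are merely counted. On {0, ..., t - 1} the form is t²(t² - 1)/12, the
    -- origin of (t² - 1)/24.
    size-gaps : + 24 * (+ t * + t) * N + + t * + t * (+ t * + t - + 1) ≡ + 12 * (+ t * Q - S * S)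
    size-gaps = arithmetic (+ t) N S Q (∑ us (λ x → + x)) (∑ us square) (⟪ square ⟫ us us) (⟪ square ⟫ gs gs) (∑ H (λ h → square h + square h))
      (trans (cong₂ _+_ expand (⟪⟫-upTo square t)) (core-identity κ square))
      (trans (⟪square⟫ us)
        (cong (λ n → (+ n * ∑ us square - ∑ us (λ x → + x) * ∑ us (λ x → + x)) +
                     (+ n * ∑ us square - ∑ us (λ x → + x) * ∑ us (λ x → + x))) (length-upTo t)))
      (trans (⟪square⟫ gs) (cong (λ n → (+ n * Q - S * S) + (+ n * Q - S * S)) (core-gaps-length κ)))
      (∑-upTo-id t) (∑-upTo-square t)
      where
      us = upTo t
      open ≡-Reasoning
      pointwise : ∀ h → D₂ square t h ≡ (square h + square h) + + 2 * (+ t * + t)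
      pointwise h = begin
        + (t ℕ.+ h) * + (t ℕ.+ h) + Δ square h t + Δ square t h
          ≡⟨ ℤ.+-assoc (+ (t ℕ.+ h) * + (t ℕ.+ h)) _ _ ⟩
        + (t ℕ.+ h) * + (t ℕ.+ h) + (Δ square h t + Δ square t h)
          ≡⟨ cong₂ (λ x y → x * x + y) (ℤ.pos-+ t h) (Δ-square h t) ⟩
        (+ t + + h) * (+ t + + h) + (+ h - + t) * (+ h - + t)
          ≡⟨ parallelogram (+ t) (+ h) ⟩
        (square h + square h) + + 2 * (+ t * + t) ∎
        where
        parallelogram : ∀ t h → (t + h) * (t + h) + (h - t) * (h - t) ≡ (h * h + h * h) + + 2 * (t * t)
        parallelogram = solve-∀
      expand : ∑ H (λ h → square h + square h) + N * (+ 2 * (+ t * + t)) ≡ ∑ H (D₂ square t)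
      expand = sym (trans (∑-cong H pointwise) (trans (∑-+ _ _ H)
        (cong (λ x → ∑ H (λ h → square h + square h) + x)
          (trans (∑-const (+ 2 * (+ t * + t)) H) (cong (λ n → + n * (+ 2 * (+ t * + t))) (length-hookLengths μ))))))
      arithmetic : ∀ t N S Q S₀ Q₀ U G h → h + N * (+ 2 * (t * t)) + U ≡ h + G →
        U + U ≡ (t * Q₀ - S₀ * S₀) + (t * Q₀ - S₀ * S₀) → G + G ≡ (t * Q - S * S) + (t * Q - S * S) →
        S₀ + S₀ ≡ t * (t - + 1) → + 6 * Q₀ ≡ t * (t - + 1) * (+ 2 * t - + 1) →
        + 24 * (t * t) * N + t * t * (t * t - + 1) ≡ + 12 * (t * Q - S * S)
      arithmetic t N S Q S₀ Q₀ U G h e₁ e₂ e₃ e₄ e₅ = begin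
        + 24 * (t * t) * N + t * t * (t * t - + 1)
          ≡⟨ split t N ⟩
        + 24 * (t * t) * N + (+ 2 * t * (t * (t - + 1) * (+ 2 * t - + 1)) - + 3 * ((t * (t - + 1)) * (t * (t - + 1))))
          ≡⟨ cong₂ (λ x y → + 24 * (t * t) * N + (+ 2 * t * x - + 3 * (y * y))) e₅ e₄ ⟨
        + 24 * (t * t) * N + (+ 2 * t * (+ 6 * Q₀) - + 3 * ((S₀ + S₀) * (S₀ + S₀)))
          ≡⟨ fold t N S₀ Q₀ ⟩
        + 24 * (t * t) * N + + 6 * ((t * Q₀ - S₀ * S₀) + (t * Q₀ - S₀ * S₀))
          ≡⟨ cong (λ x → + 24 * (t * t) * N + + 6 * x) e₂ ⟨
        + 24 * (t * t) * N + + 6 * (U + U)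
          ≡⟨ insert t N U h ⟩
        + 12 * ((h + N * (+ 2 * (t * t)) + U) - h)
          ≡⟨ cong (λ x → + 12 * (x - h)) e₁ ⟩
        + 12 * ((h + G) - h)
          ≡⟨ remove h G ⟩
        + 6 * (G + G)
          ≡⟨ cong (λ x → + 6 * x) e₃ ⟩
        + 6 * ((t * Q - S * S) + (t * Q - S * S))
          ≡⟨ double (t * Q - S * S) ⟩
        + 12 * (t * Q - S * S) ∎
        where
        split : ∀ t N → + 24 * (t * t) * N + t * t * (t * t - + 1) ≡
          + 24 * (t * t) * N + (+ 2 * t * (t * (t - + 1) * (+ 2 * t - + 1)) - + 3 * ((t * (t - + 1)) * (t * (t - + 1))))
        split = solve-∀
        fold : ∀ t N s q → + 24 * (t * t) * N + (+ 2 * t * (+ 6 * q) - + 3 * ((s + s) * (s + s))) ≡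
          + 24 * (t * t) * N + + 6 * ((t * q - s * s) + (t * q - s * s))
        fold = solve-∀
        insert : ∀ t N u h → + 24 * (t * t) * N + + 6 * (u + u) ≡ + 12 * ((h + N * (+ 2 * (t * t)) + u) - h)
        insert = solve-∀
        remove : ∀ h g → + 12 * ((h + g) - h) ≡ + 6 * (g + g)
        remove = solve-∀
        double : ∀ x → + 6 * (x + x) ≡ + 12 * x
        double = solve-∀

    private
      V : ℚ
      V = sumOfSquares (coding κ)
      c 12ℚ 24ℚ : ℚ
      12ℚ = fromℤ (+ 12)
      24ℚ = fromℤ (+ 24)
      c = t₀ t ℚ.- fromℤ (+ s)
      T : ℚ
      T = fromℤ (+ t)

      value-coding : ∀ i → value (lookup (entries (coding κ)) i) ≡ c ℚ.+ fromℤ (+ gap κ i)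
      value-coding i = trans (cong (λ o → t₀ t ℚ.+ fromℤ o) (offset-coding κ i))
        (trans (cong (t₀ t ℚ.+_) (fromℤ-homo-sub {+ gap κ i} {+ s} refl refl))
          (solve 3 (λ a g s → a :+ (g :+ :- s) := (a :- s) :+ g) refl (t₀ t) (fromℤ (+ gap κ i)) (fromℤ (+ s))))

      ∑-gap : ∀ f → ∑ (allFin t) (λ i → f (gap κ i)) ≡ ∑ gs f
      ∑-gap f = trans (sym (∑-map (gap κ) (allFin t))) (cong (λ l → ∑ l f) (map-gap κ))

      length-allFin : length (allFin t) ≡ t
      length-allFin = length-tabulate {n = t} id

      centred : T ℚ.* c ℚ.+ fromℤ S ≡ 0ℚ
      centred = trans (sym (trans (cong sumℚ (map-cong value-coding (allFin t)))
        (trans (sumℚ-translate c (λ i → + gap κ i) (allFin t))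
          (cong₂ (λ n x → fromℤ (+ n) ℚ.* c ℚ.+ fromℤ x) length-allFin (∑-gap (λ x → + x)))))) (sum≡0 (coding κ))

      V≡ : V ≡ T ℚ.* (c ℚ.* c) ℚ.+ (c ℚ.+ c) ℚ.* fromℤ S ℚ.+ fromℤ Q
      V≡ = trans (cong sumℚ (map-cong (λ i → cong₂ ℚ._*_ (value-coding i) (value-coding i)) (allFin t)))
        (trans (sumℚ-translate² c (λ i → + gap κ i) (allFin t))
          (trans (cong (λ n → fromℤ (+ n) ℚ.* (c ℚ.* c) ℚ.+ (c ℚ.+ c) ℚ.* fromℤ (∑ (allFin t) (λ i → + gap κ i))
                ℚ.+ fromℤ (∑ (allFin t) (λ i → square (gap κ i)))) length-allFin)
            (cong₂ (λ x y → T ℚ.* (c ℚ.* c) ℚ.+ (c ℚ.+ c) ℚ.* fromℤ x ℚ.+ fromℤ y) (∑-gap (λ x → + x)) (∑-gap square))))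

      -- t · Σ v² - (Σ v)² does not change under translation, and the entries of the coding sum to
      -- 0.
      spread : T ℚ.* V ≡ T ℚ.* fromℤ Q ℚ.- fromℤ S ℚ.* fromℤ S
      spread = begin
        T ℚ.* V
          ≡⟨ cong (T ℚ.*_) V≡ ⟩
        T ℚ.* (T ℚ.* (c ℚ.* c) ℚ.+ (c ℚ.+ c) ℚ.* fromℤ S ℚ.+ fromℤ Q)
          ≡⟨ solve 4 (λ T c S Q → T :* (T :* (c :* c) :+ (c :+ c) :* S :+ Q) := ((T :* c :+ S) :* (T :* c :+ S) :+ T :* Q) :- S :* S)
               refl T c (fromℤ S) (fromℤ Q) ⟩
        ((T ℚ.* c ℚ.+ fromℤ S) ℚ.* (T ℚ.* c ℚ.+ fromℤ S) ℚ.+ T ℚ.* fromℤ Q) ℚ.- fromℤ S ℚ.* fromℤ S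
          ≡⟨ cong (λ x → (x ℚ.* x ℚ.+ T ℚ.* fromℤ Q) ℚ.- fromℤ S ℚ.* fromℤ S) centred ⟩
        (0ℚ ℚ.* 0ℚ ℚ.+ T ℚ.* fromℤ Q) ℚ.- fromℤ S ℚ.* fromℤ S
          ≡⟨ cong (ℚ._- fromℤ S ℚ.* fromℤ S) (ℚ.+-identityˡ (T ℚ.* fromℤ Q)) ⟩
        T ℚ.* fromℤ Q ℚ.- fromℤ S ℚ.* fromℤ S ∎
        where open ≡-Reasoning

      size-spread : 24ℚ ℚ.* (T ℚ.* T) ℚ.* fromℤ N ℚ.+ T ℚ.* T ℚ.* (T ℚ.* T ℚ.- 1ℚ) ≡ 12ℚ ℚ.* (T ℚ.* V)
      size-spread = trans (sym lhs) (trans (cong fromℤ size-gaps) (trans rhs (cong (12ℚ ℚ.*_) (sym spread))))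
        where
        lhs : fromℤ (+ 24 * (+ t * + t) * N + + t * + t * (+ t * + t - + 1)) ≡ _
        lhs = fromℤ-homo-+ {+ 24 * (+ t * + t) * N} {+ t * + t * (+ t * + t - + 1)}
          (fromℤ-homo-* {+ 24 * (+ t * + t)} {N} (fromℤ-homo-* {+ 24} {+ t * + t} refl t²) refl)
          (fromℤ-homo-* {+ t * + t} {+ t * + t - + 1} t² (fromℤ-homo-sub {+ t * + t} {+ 1} t² refl))
          where t² = fromℤ-homo-* {+ t} {+ t} refl refl
        rhs : fromℤ (+ 12 * (+ t * Q - S * S)) ≡ _
        rhs = fromℤ-homo-* {+ 12} {+ t * Q - S * S} refl (fromℤ-homo-sub {+ t * Q} {S * S}
          (fromℤ-homo-* {+ t} {Q} refl refl) (fromℤ-homo-* {S} {S} refl refl))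

    size-formula : fromℤ (+ size μ) ≡ (ℚ._/_ (+ 1) (2 ℕ.* t) {{m*n≢0 2 t}}) ℚ.* sumOfSquares (coding κ)
                                      ℚ.- ((+ (t ℕ.^ 2)) ℤ.- (+ 1)) ℚ./ 24
    size-formula = begin
      fromℤ N
        ≡⟨ solve 1 (λ n → n := con 1ℚ :* con 1ℚ :* n) refl (fromℤ N) ⟩
      1ℚ ℚ.* 1ℚ ℚ.* fromℤ N
        -- With u = 1/(2t), the factor u²/6 is 1/(24t²). Inserting (u · 2T)² = 1 divides
        -- `size-spread` by 24t² using ring operations only.
        ≡⟨ cong (λ x → x ℚ.* x ℚ.* fromℤ N) u2t≡1 ⟨
      (u ℚ.* (T ℚ.+ T)) ℚ.* (u ℚ.* (T ℚ.+ T)) ℚ.* fromℤ N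
        ≡⟨ solve 3 (λ u T n → (u :* (T :+ T)) :* (u :* (T :+ T)) :* n :=
             con 1/6 :* (u :* u) :* ((con 24ℚ :* (T :* T) :* n :+ T :* T :* (T :* T :- con 1ℚ)) :- T :* T :* (T :* T :- con 1ℚ))) refl u T (fromℤ N) ⟩
      1/6 ℚ.* (u ℚ.* u) ℚ.* ((24ℚ ℚ.* (T ℚ.* T) ℚ.* fromℤ N ℚ.+ T ℚ.* T ℚ.* (T ℚ.* T ℚ.- 1ℚ)) ℚ.- T ℚ.* T ℚ.* (T ℚ.* T ℚ.- 1ℚ))
        ≡⟨ cong (λ x → 1/6 ℚ.* (u ℚ.* u) ℚ.* (x ℚ.- T ℚ.* T ℚ.* (T ℚ.* T ℚ.- 1ℚ))) size-spread ⟩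
      1/6 ℚ.* (u ℚ.* u) ℚ.* (12ℚ ℚ.* (T ℚ.* V) ℚ.- T ℚ.* T ℚ.* (T ℚ.* T ℚ.- 1ℚ))
        ≡⟨ solve 3 (λ u T V → con 1/6 :* (u :* u) :* (con 12ℚ :* (T :* V) :- T :* T :* (T :* T :- con 1ℚ)) :=
             u :* V :* (u :* (T :+ T)) :- con 1/24 :* ((u :* (T :+ T)) :* (u :* (T :+ T))) :* (T :* T :- con 1ℚ)) refl u T V ⟩
      u ℚ.* V ℚ.* (u ℚ.* (T ℚ.+ T)) ℚ.- 1/24 ℚ.* ((u ℚ.* (T ℚ.+ T)) ℚ.* (u ℚ.* (T ℚ.+ T))) ℚ.* (T ℚ.* T ℚ.- 1ℚ)
        ≡⟨ cong₂ (λ x y → u ℚ.* V ℚ.* x ℚ.- 1/24 ℚ.* (x ℚ.* x) ℚ.* y) u2t≡1 (sym w24≡) ⟩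
      u ℚ.* V ℚ.* 1ℚ ℚ.- 1/24 ℚ.* (1ℚ ℚ.* 1ℚ) ℚ.* (w ℚ.* 24ℚ)
        ≡⟨ solve 3 (λ u V w → u :* V :* con 1ℚ :- con 1/24 :* (con 1ℚ :* con 1ℚ) :* (w :* con 24ℚ) := u :* V :- w) refl u V w ⟩
      u ℚ.* V ℚ.- w ∎
      where
      open ≡-Reasoning
      1/6 1/24 u w : ℚ
      1/6  = + 1 ℚ./ 6
      1/24 = + 1 ℚ./ 24
      u = ℚ._/_ (+ 1) (2 ℕ.* t) {{m*n≢0 2 t}}
      w = ((+ (t ℕ.^ 2)) ℤ.- (+ 1)) ℚ./ 24
      u2t≡1 : u ℚ.* (T ℚ.+ T) ≡ 1ℚ
      u2t≡1 = trans (cong (u ℚ.*_) (trans (sym (fromℤ-+ (+ t) (+ t))) (cong (λ n → fromℤ (+ n)) (cong (t ℕ.+_) (sym (ℕ.+-identityʳ t))))))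
        (z/d*d≡z (+ 1) (2 ℕ.* t) {{m*n≢0 2 t}})
      w24≡ : w ℚ.* 24ℚ ≡ T ℚ.* T ℚ.- 1ℚ
      w24≡ = trans (z/d*d≡z (+ (t ℕ.^ 2) - + 1) 24) (fromℤ-homo-sub {+ (t ℕ.^ 2)} {+ 1}
        (trans (cong fromℤ (trans (cong +_ (cong (t ℕ.*_) (ℕ.*-identityʳ t))) (ℤ.pos-* t t))) (fromℤ-* (+ t) (+ t))) refl)

  -- Products and quotients in the field

  module _ {c ℓ₁ ℓ₂} (F : HeytingField c ℓ₁ ℓ₂) where

    open HeytingField F using (Carrier; _≈_; _#_; 0#; 1#; #⇒invertible; isCommutativeRing; heytingCommutativeRing)
      renaming (_*_ to _·_; _+_ to _⊕_; -_ to ⊖_)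
    open FieldNotation F
    open import Algebra.Apartness.Properties.HeytingCommutativeRing heytingCommutativeRing
      using (1#0; x#0y#0→xy#0; x-0≈x)
    private
      ring : CommutativeRing c ℓ₁
      ring = record { isCommutativeRing = isCommutativeRing }
    open CommutativeRing ring
      using (*-cong; *-congˡ; *-congʳ; *-assoc; *-comm; *-identityˡ; *-identityʳ; *-commutativeSemigroup)
      renaming (setoid to ≈-setoid; refl to ≈-refl; sym to ≈-sym; trans to ≈-trans)
    open import Algebra.Properties.CommutativeSemigroup *-commutativeSemigroup
      renaming (interchange to *-interchange; x∙yz≈y∙xz to x*yz≈y*xz)
    open import Relation.Binary.Reasoning.Setoid ≈-setoid

    ∏-++ : ∀ (f : A → Carrier) xs ys → ∏ (xs ++ ys) f ≈ ∏ xs f · ∏ ys f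
    ∏-++ f []       ys = ≈-sym (*-identityˡ _)
    ∏-++ f (x ∷ xs) ys = ≈-trans (*-congˡ (∏-++ f xs ys)) (≈-sym (*-assoc _ _ _))

    ∏-concatMap : ∀ (f : B → Carrier) (g : A → List B) (h : A → Carrier) →
                  (∀ x → ∏ (g x) f ≈ h x) → ∀ xs → ∏ (concatMap g xs) f ≈ ∏ xs h
    ∏-concatMap f g h g≈h []       = ≈-refl
    ∏-concatMap f g h g≈h (x ∷ xs) =
      ≈-trans (∏-++ f (g x) _) (*-cong (g≈h x) (∏-concatMap f g h g≈h xs))

    ∏-replicate : ∀ (f : A → Carrier) n x → ∏ (replicate n x) f ≈ f x ^ n
    ∏-replicate f zero    x = ≈-refl
    ∏-replicate f (suc n) x = *-congˡ (∏-replicate f n x)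

    ∏-map : ∀ (f : B → Carrier) (g : A → B) xs → ∏ (map g xs) f ≈ ∏ xs (f ∘ g)
    ∏-map f g []       = ≈-refl
    ∏-map f g (x ∷ xs) = *-congˡ (∏-map f g xs)

    ∏-↭ : ∀ (f : A → Carrier) {xs ys} → xs ↭ ys → ∏ xs f ≈ ∏ ys f
    ∏-↭ f ↭.refl         = ≈-refl
    ∏-↭ f (↭.prep x p)   = *-congˡ (∏-↭ f p)
    ∏-↭ f (↭.swap x y p) = ≈-trans (*-congˡ (*-congˡ (∏-↭ f p))) (x*yz≈y*xz (f x) (f y) _)
    ∏-↭ f (↭.trans p q)  = ≈-trans (∏-↭ f p) (∏-↭ f q)

    inverseˡ : ∀ {y} (y#0 : y # 0#) → inverse y#0 · y ≈ 1#
    inverseˡ y#0 with _ , y⁻¹y≈1 , _ ← #⇒invertible y#0 = ≈-trans (*-congˡ (≈-sym (x-0≈x _))) y⁻¹y≈1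

    cancelʳ : ∀ {a b} d → d # 0# → a · d ≈ b · d → a ≈ b
    cancelʳ {a} {b} d d#0 ad≈bd = begin
      a                        ≈⟨ undo a ⟨
      a · d · inverse d#0      ≈⟨ *-congʳ ad≈bd ⟩
      b · d · inverse d#0      ≈⟨ undo b ⟩
      b                        ∎
      where
      undo : ∀ x → x · d · inverse d#0 ≈ x
      undo x = begin
        x · d · inverse d#0    ≈⟨ *-assoc x d _ ⟩
        x · (d · inverse d#0)  ≈⟨ *-congˡ (≈-trans (*-comm d _) (inverseˡ d#0)) ⟩
        x · 1#                 ≈⟨ *-identityʳ x ⟩
        x                      ∎

    ∏-#0 : ∀ xs (f : A → Carrier) → (∀ x → x ∈ xs → f x # 0#) → ∏ xs f # 0#
    ∏-#0 []       f f#0 = 1#0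
    ∏-#0 (x ∷ xs) f f#0 = x#0y#0→xy#0 (f#0 x (here refl)) (∏-#0 xs f (λ y → f#0 y ∘ there))

    ∏∈-/ : ∀ xs (num den : A → Carrier) (den#0 : ∀ x → x ∈ xs → den x # 0#) →
           ∏∈ xs (λ x x∈xs → num x / den x [ den#0 x x∈xs ]) · ∏ xs den ≈ ∏ xs num
    ∏∈-/ []       num den den#0 = *-identityˡ 1#
    ∏∈-/ (x ∷ xs) num den den#0 = begin
      num x · d⁻¹ · q · (den x · ∏ xs den)    ≈⟨ *-interchange _ q (den x) _ ⟩
      num x · d⁻¹ · den x · (q · ∏ xs den)
        ≈⟨ *-cong (*-assoc _ _ _) (∏∈-/ xs num den (λ y → den#0 y ∘ there)) ⟩
      num x · (d⁻¹ · den x) · ∏ xs num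
        ≈⟨ *-congʳ (≈-trans (*-congˡ (inverseˡ (den#0 x (here refl)))) (*-identityʳ _)) ⟩
      num x · ∏ xs num                        ∎
      where
      d⁻¹ = inverse (den#0 x (here refl))
      q = ∏∈ xs (λ y y∈xs → num y / den y [ den#0 y (there y∈xs) ])

    -- The product of all denominators is apart from 0, hence can be cancelled. This leaves an
    -- equation without division, to which a permutation of factors applies.
    ∏∈-cross-multiply : ∀ xs (a b : A → Carrier) (b#0 : ∀ x → x ∈ xs → b x # 0#)
      ys (c d : B → Carrier) (d#0 : ∀ y → y ∈ ys → d y # 0#) p →
      ∏ xs a · ∏ ys d ≈ ∏ xs b · (∏ ys c · p) →
      ∏∈ xs (λ x x∈xs → a x / b x [ b#0 x x∈xs ]) ≈ ∏∈ ys (λ y y∈ys → c y / d y [ d#0 y y∈ys ]) · p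
    ∏∈-cross-multiply xs a b b#0 ys c d d#0 p eq =
      cancelʳ (∏ xs b · ∏ ys d) (x#0y#0→xy#0 (∏-#0 xs b b#0) (∏-#0 ys d d#0)) (begin
        q · (∏ xs b · ∏ ys d)          ≈⟨ *-assoc q _ _ ⟨
        q · ∏ xs b · ∏ ys d            ≈⟨ *-congʳ (∏∈-/ xs a b b#0) ⟩
        ∏ xs a · ∏ ys d                ≈⟨ eq ⟩
        ∏ xs b · (∏ ys c · p)          ≈⟨ *-congˡ (*-congʳ (∏∈-/ ys c d d#0)) ⟨
        ∏ xs b · (r · ∏ ys d · p)      ≈⟨ *-congˡ (xy∙z≈xz∙y r _ p) ⟩
        ∏ xs b · (r · p · ∏ ys d)      ≈⟨ x*yz≈y*xz (∏ xs b) (r · p) _ ⟩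
        r · p · (∏ xs b · ∏ ys d)      ∎)
      where
      q = ∏∈ xs (λ x x∈xs → a x / b x [ b#0 x x∈xs ])
      r = ∏∈ ys (λ y y∈ys → c y / d y [ d#0 y y∈ys ])

    hook-quotients : ∀ {t} .{{_ : NonZero t}} (τ : ℤ → Carrier) (κ : Core t) →
      let μ = partition κ
          v = lookup (entries (coding κ))
      in
      (τh#0 : ∀ h → h ∈ hookLengths μ → τ (+ h) # 0#)
      (τi#0 : ∀ i → i ∈ [1⋯ t -1] → τ (+ i) # 0#) →
      ∏∈ (hookLengths μ) (λ h h∈ → (τ (+ h - + t) · τ (+ h + + t)) / τ (+ h) ^ 2 [ ^-#0 2 (τh#0 h h∈) ])
      ≈
      ∏∈ [1⋯ t -1] (λ i i∈ →
        τ (- + i) ^ β t μ i / τ (+ i) ^ (β t μ i ℕ.+ (t ∸ i)) [ ^-#0 (β t μ i ℕ.+ (t ∸ i)) (τi#0 i i∈) ])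
      · ∏ (increasingPairs t) (λ (i , j) → τ (diff (v i) (v j)))
    hook-quotients {t} τ κ τh#0 τi#0 =
      ∏∈-cross-multiply H (λ h → τ (+ h - + t) · τ (+ h + + t)) (λ h → τ (+ h) ^ 2) (λ h h∈ → ^-#0 2 (τh#0 h h∈))
        is (λ i → τ (- + i) ^ β t μ i) (λ i → τ (+ i) ^ (β t μ i ℕ.+ (t ∸ i)))
        (λ i i∈ → ^-#0 (β t μ i ℕ.+ (t ∸ i)) (τi#0 i i∈))
        (∏ (increasingPairs t) (λ (i , j) → τ (diff (v i) (v j))))
        (begin
          ∏ H (λ h → τ (+ h - + t) · τ (+ h + + t)) · ∏ is (λ i → τ (+ i) ^ (β t μ i ℕ.+ (t ∸ i)))
            ≈⟨ *-cong (∏-concatMap τ _ _ (λ h → *-congˡ (*-identityʳ _)) H)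
                      (∏-concatMap τ _ _ (λ i → ∏-replicate τ (β t μ i ℕ.+ (t ∸ i)) (+ i)) is) ⟨
          ∏ (concatMap (λ h → (+ h - + t) ∷ (+ h + + t) ∷ []) H) τ
            · ∏ (concatMap (λ i → replicate (β t μ i ℕ.+ (t ∸ i)) (+ i)) is) τ
            ≈⟨ ∏-++ τ (concatMap (λ h → (+ h - + t) ∷ (+ h + + t) ∷ []) H) _ ⟨
          ∏ (numerators κ) τ
            -- The only property of `τ` used is that it is a function: equal arguments give equal
            -- factors.
            ≈⟨ ∏-↭ τ (multiset-identity κ) ⟩
          ∏ (denominators κ) τ
            ≈⟨ ≈-trans (∏-++ τ (concatMap (λ h → + h ∷ + h ∷ []) H) _)
                 (*-congˡ (∏-++ τ (concatMap (λ i → replicate (β t μ i) (- + i)) is) _)) ⟩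
          ∏ (concatMap (λ h → + h ∷ + h ∷ []) H) τ
            · (∏ (concatMap (λ i → replicate (β t μ i) (- + i)) is) τ
              · ∏ (map (λ (i , j) → diff (v i) (v j)) (increasingPairs t)) τ)
            -- `x ^ 2` and the product over a list of two equal entries both unfold to x · (x · 1#).
            ≈⟨ *-cong (∏-concatMap τ _ _ (λ h → ≈-refl) H)
                 (*-cong (∏-concatMap τ _ _ (λ i → ∏-replicate τ (β t μ i) (- + i)) is)
                   (∏-map τ (λ (i , j) → diff (v i) (v j)) (increasingPairs t))) ⟩
          ∏ H (λ h → τ (+ h) ^ 2) · (∏ is (λ i → τ (- + i) ^ β t μ i)
            · ∏ (increasingPairs t) (λ (i , j) → τ (diff (v i) (v j)))) ∎)
      where
      μ = partition κ
      H = hookLengths μ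
      is = [1⋯ t -1]
      v = lookup (entries (coding κ))

theorem1 : ∀ {c ℓ₁ ℓ₂} (t : ℕ) .{{_ : NonZero t}} (F : HeytingField c ℓ₁ ℓ₂) →
    let open HeytingField F
        open FieldNotation F
    in
    (τ : ℤ → Carrier) →
    Σ[ φ ∈ Bijection (Cores t) (Codings t) ]
      ((κ : Core t) →
        let μ = partition κ
            V = Bijection.to φ κ
            v = lookup (entries V)
        in
        (fromℤ (+ size μ)
          ≡ (ℚ._/_ (+ 1) (2 ℕ.* t) {{m*n≢0 2 t}}) ℚ.* sumOfSquares V
            ℚ.- ((+ (t ℕ.^ 2)) ℤ.- (+ 1)) ℚ./ 24)
        ×
        ((τh#0 : ∀ h → h ∈ hookLengths μ → τ (+ h) # 0#)
         (τi#0 : ∀ i → i ∈ [1⋯ t -1] → τ (+ i) # 0#) →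
         ∏∈ (hookLengths μ) (λ h h∈ →
           (τ (+ h ℤ.- + t) * τ (+ h ℤ.+ + t)) / τ (+ h) ^ 2 [ ^-#0 2 (τh#0 h h∈) ])
         ≈
         ∏∈ [1⋯ t -1] (λ i i∈ →
           τ (ℤ.- (+ i)) ^ β t μ i
             / τ (+ i) ^ (β t μ i ℕ.+ (t ∸ i)) [ ^-#0 (β t μ i ℕ.+ (t ∸ i)) (τi#0 i i∈) ])
         * ∏ (increasingPairs t) (λ (i , j) → τ (diff (v i) (v j)))))
theorem1 t F τ = codingBijection t , λ κ → size-formula κ , λ τh#0 τi#0 →
  hook-quotients F τ κ τh#0 τi#0
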